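{- Let $G=(V,E)$ be a perfect graph with $|V|=n$, and let $k\in\{2,\dots,n\}$ be an integer. Then the Clique Decision Algorithm (described in the context), run on input $(G,k)$ with any admissible choice of its parameters, correctly decides whether $G$ has a clique of size $k$: it returns "YES" if $G$ contains a clique of size $k$, and it returns "NO" if $G$ contains no clique of size $k$.
   Context: All graphs are finite and simple. A graph $G$ is perfect if $\chi(H)=\omega(H)$ for every induced subgraph $H$ of $G$, where $\chi$ is the chromatic number and $\omega$ the clique number. $\bar E$ denotes the set of nonedges of $G=(V,E)$ (unordered pairs of distinct nonadjacent vertices), and $V$ is identified with $[n]=\{1,\dots,n\}$. $J$ is the $n\times n$ all-ones matrix, $I$ the identity matrix, and $Y_{ij}$ the $n\times n$ symmetric matrix with ones in entries $(i,j)$ and $(j,i)$ and zeros elsewhere. Walk weights: for a symmetric $A\in\mathbb{R}^{n\times n}$ and an integer $t\ge 1$, $\psi_{t,A}(i,j)=\sum_{(v_1,\dots,v_{t+1})\in[n]^{t+1}:\,v_1=i,\,v_{t+1}=j}\ \prod_{m=1}^{t}A_{v_m v_{m+1}}$, and $\psi_{t,A}(i)=\psi_{t,A}(i,i)$. Walk Counting Procedure. Input: a symmetric matrix $A\in\mathbb{R}^{n\times n}$ and an integer $\hat T\ge 1$. Let $S=\{i\in[n]:\psi_{2\hat T,A}(i)>0\}$, $\beta=\max_{i\in S}\frac{\psi_{2\hat T+1,A}(i)}{\psi_{2\hat T,A}(i)}$, let $i_0\in S$ be any index attaining this maximum, and let $x\in\mathbb{R}^n$ be given by $x_j=\psi_{\hat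 T,A}(i_0,j)$. Output: $(\beta,x)$. Clique Decision Algorithm. Input: a perfect graph $G=(V,E)$ with $|V|=n$, and an integer $k\in\{2,\dots,n\}$. Parameters: $\epsilon=\frac{1}{2n}\cdot\frac{1}{n(n-1)(k-1)+2}$; any $\hat\epsilon\in\left(0,\frac{1}{(k+1)((k-1)n(n-1)+2)}\right]$; any integer $T>4\ln(|\bar E|+1)\,n^2\,((k-1)n(n-1)+2)^2$; any integer $\hat T\ge\frac{1}{\hat\epsilon}\ln\left(\frac{2n}{\hat\epsilon}\right)$. Initialization: $w^1_{ij}=1$ for $ij\in\bar E$ and $w^1_0=1$. For $t=1,\dots,T$: (1) $p^t_{ij}=\frac{w^t_{ij}}{\sum_{ij\in\bar E}w^t_{ij}+w^t_0}$ for $ij\in\bar E$, and $p^t_0=\frac{w^t_0}{\sum_{ij\in\bar E}w^t_{ij}+w^t_0}$. (2) $A_{G_{p^t}}=\sum_{ij\in\bar E}-p^t_{ij}Y_{ij}+p^t_0J+I$. (3) $(\beta^t,x^t)$ is the output of the Walk Counting Procedure on $(A_{G_{p^t}},\hat T)$. (4) If $\beta^t<(1-\hat\epsilon)(p^t_0k+1)$, return "NO" and stop. (5) $w^{t+1}_{ij}=w^t_{ij}\left(1+\frac{\epsilon}{n}\frac{2x^t_ix^t_j}{\|x^t\|_2^2}\right)$ for $ij\in\bar E$, and $w^{t+1}_0=w^t_0\left(1-\frac{\epsilon}{n}\left(\frac{(\sum_{i\in[n]}x^t_i)^2}{\|x^t\|_2^2}-k\right)\right)$. If the loop finishes without returning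 "NO", return "YES". -}

module Defs where

open import Algebra.Properties.CommutativeMonoid.Sum as Sum using ()
open import Data.Bool.Base using (if_then_else_)
open import Data.Fin.Base as Fin using (Fin; inject₁)
open import Data.Fin.Properties as Fin using ()
open import Data.Fin.Subset using (Subset; _∈_; ∣_∣)
open import Data.Integer.Base using (+_)
open import Data.Nat.Base as ℕ using (ℕ; zero; suc; _∸_)
open import Data.Product.Base using (∃; ∃-syntax; Σ-syntax; _×_; _,_)
open import Data.Rational.Base
  using (ℚ; 0ℚ; 1ℚ; _+_; _*_; _-_; -_; _<_; _≤_; _÷_; ≢-nonZero)
  renaming (_/_ to _/ℤ_)
open import Data.Rational.Properties as ℚ using ()
open import Data.Sum.Base using (_⊎_)
open import Data.Vec.Base using (Vec; []; _∷_; head; last; lookup)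
open import Function.Base using (_∘_)
open import Function.Bundles using (_↣_; module Injection)
open import Relation.Binary.PropositionalEquality.Core using (_≡_; _≢_)
open import Relation.Nullary.Decidable.Core
  using (Dec; yes; no; does; ¬?; _×-dec_)
open import Relation.Nullary.Negation.Core using (¬_)

open Sum ℚ.+-0-commutativeMonoid public using () renaming (sum to ∑)
open Sum ℚ.*-1-commutativeMonoid public using () renaming (sum to ∏)

------------------------------------------------------------------------
-- Rationals

fromℕ : ℕ → ℚ
fromℕ m = + m /ℤ 1

-- Total division with the junk value p / 0 = 0.  The denominators that
-- occur in the algorithm below are all positive.
infixl 7 _/_
_/_ : ℚ → ℚ → ℚ
p / q with q ℚ.≟ 0ℚ
... | yes _   = 0ℚ
... | no  q≢0 = _÷_ p q {{≢-nonZero q≢0}}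

------------------------------------------------------------------------
-- Real numbers

-- A pair of sets of rationals, { q ∣ q < x } and { q ∣ x < q }.  The
-- operations are defined on arbitrary pairs, so they carry no proofs;
-- on pairs satisfying IsDedekind they are the usual real operations.
record Cut : Set₁ where
  field
    lower : ℚ → Set
    upper : ℚ → Set

open Cut public

record IsDedekind (x : Cut) : Set where
  field
    lower-inhabited : ∃ (lower x)
    upper-inhabited : ∃ (upper x)
    lower-closed    : ∀ {p q} → p < q → lower x q → lower x p
    lower-rounded   : ∀ {p} → lower x p → ∃[ q ] (p < q × lower x q)
    upper-closed    : ∀ {p q} → p < q → upper x p → upper x q
    upper-rounded   : ∀ {q} → upper x q → ∃[ p ] (p < q × upper x p)
    disjoint        : ∀ {q} → ¬ (lower x q × upper x q)
    located         : ∀ {p q} → p < q → lower x p ⊎ upper x q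

ι : ℚ → Cut
ι q = record { lower = _< q ; upper = q <_ }

infix 4 _<ᴿ_ _≤ᴿ_
_<ᴿ_ : Cut → Cut → Set
x <ᴿ y = ∃[ q ] (upper x q × lower y q)

_≤ᴿ_ : Cut → Cut → Set
x ≤ᴿ y = ∀ q → lower x q → lower y q

infixl 6 _-ᴿ_
_-ᴿ_ : Cut → Cut → Cut
x -ᴿ y = record
  { lower = λ q → ∃[ a ] ∃[ d ] (lower x a × upper y d × q < a - d)
  ; upper = λ q → ∃[ b ] ∃[ c ] (upper x b × lower y c × b - c < q)
  }

_∈⟨_,_⟩ : Cut → ℚ → ℚ → Set
x ∈⟨ a , b ⟩ = lower x a × upper x b

-- Interval multiplication: xy lies between the least and the greatest of
-- the products of endpoints of rational intervals around x and y.
infixl 7 _*ᴿ_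
_*ᴿ_ : Cut → Cut → Cut
x *ᴿ y = record
  { lower = λ q → ∃[ a ] ∃[ b ] ∃[ c ] ∃[ d ]
      (x ∈⟨ a , b ⟩ × y ∈⟨ c , d ⟩ ×
       q < a * c × q < a * d × q < b * c × q < b * d)
  ; upper = λ q → ∃[ a ] ∃[ b ] ∃[ c ] ∃[ d ]
      (x ∈⟨ a , b ⟩ × y ∈⟨ c , d ⟩ ×
       a * c < q × a * d < q × b * c < q × b * d < q)
  }

-- The reciprocal of a positive real.
recip⁺ : Cut → Cut
recip⁺ x = record
  { lower = λ q → ∃[ b ] (upper x b × q * b < 1ℚ)
  ; upper = λ q → ∃[ a ] (0ℚ < a × lower x a × 1ℚ < q * a)
  }

-- The limit of a convergent sequence.
lim : (ℕ → ℚ) → Cut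
lim s = record
  { lower = λ q → ∃[ r ] (q < r × ∃[ N ] (∀ m → N ℕ.≤ m → r ≤ s m))
  ; upper = λ q → ∃[ r ] (r < q × ∃[ N ] (∀ m → N ℕ.≤ m → s m ≤ r))
  }

-- expTerm q i = qⁱ / i!
expTerm : ℚ → ℕ → ℚ
expTerm q zero    = 1ℚ
expTerm q (suc i) = expTerm q i * (q / fromℕ (suc i))

exp : ℚ → Cut
exp q = lim (λ m → ∑ {m} (expTerm q ∘ Fin.toℕ))

-- The inverse of exp on the positive reals: q < ln x iff exp q < x, and
-- ln x < q iff x < exp q.
ln : Cut → Cut
ln x = record
  { lower = λ q → exp q <ᴿ x
  ; upper = λ q → x <ᴿ exp q
  }

------------------------------------------------------------------------
-- Graphs

record Graph (n : ℕ) : Set₁ where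
  infix 4 _~_ _~?_
  field
    _~_      : Fin n → Fin n → Set
    _~?_     : ∀ u v → Dec (u ~ v)
    ~-sym    : ∀ {u v} → u ~ v → v ~ u
    ~-irrefl : ∀ {u} → ¬ (u ~ u)

-- The induced subgraph on the image of an injection; up to relabelling
-- the vertices, every induced subgraph has this form.
induced : ∀ {m n} → Graph n → Fin m ↣ Fin n → Graph m
induced G e = record
  { _~_      = λ u v → to u ~ to v
  ; _~?_     = λ u v → to u ~? to v
  ; ~-sym    = ~-sym
  ; ~-irrefl = ~-irrefl
  }
  where
  open Graph G
  open Injection e using (to)

module _ {n} (G : Graph n) where
  open Graph G

  IsClique : Subset n → Set
  IsClique K = ∀ {u v} → u ∈ K → v ∈ K → u ≢ v → u ~ v

  HasClique : ℕ → Set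
  HasClique m = ∃[ K ] (IsClique K × ∣ K ∣ ≡ m)

  IsCliqueNumber : ℕ → Set
  IsCliqueNumber m = HasClique m × (∀ m′ → HasClique m′ → m′ ℕ.≤ m)

  Colourable : ℕ → Set
  Colourable c = Σ[ f ∈ (Fin n → Fin c) ] (∀ {u v} → u ~ v → f u ≢ f v)

  IsChromaticNumber : ℕ → Set
  IsChromaticNumber c = Colourable c × (∀ c′ → Colourable c′ → c ℕ.≤ c′)

Perfect : ∀ {n} → Graph n → Set
Perfect {n} G = ∀ {m} (e : Fin m ↣ Fin n) →
  ∃[ c ] (IsChromaticNumber (induced G e) c × IsCliqueNumber (induced G e) c)

module _ {n} (G : Graph n) where
  open Graph G

  -- A nonedge is an unordered pair, represented here by its increasing
  -- ordering.
  Nonedge : Fin n → Fin n → Set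
  Nonedge i j = i Fin.< j × ¬ (i ~ j)

  nonedge? : ∀ i j → Dec (Nonedge i j)
  nonedge? i j = (i Fin.<? j) ×-dec ¬? (i ~? j)

  ∑ᴱ̄ : (Fin n → Fin n → ℚ) → ℚ
  ∑ᴱ̄ f = ∑ λ i → ∑ λ j → if does (nonedge? i j) then f i j else 0ℚ

  #nonedges : ℚ
  #nonedges = ∑ᴱ̄ λ _ _ → 1ℚ

------------------------------------------------------------------------
-- Matrices and walks

Matrix : ℕ → Set
Matrix n = Fin n → Fin n → ℚ

J : ∀ {n} → Matrix n
J _ _ = 1ℚ

I : ∀ {n} → Matrix n
I u v = if does (u Fin.≟ v) then 1ℚ else 0ℚ

-- Used for i ≢ j only.
Y : ∀ {n} → Fin n → Fin n → Matrix n
Y i j u v = I i u * I j v + I i v * I j u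

∑-tuples : ∀ {n} m → (Vec (Fin n) m → ℚ) → ℚ
∑-tuples zero    f = f []
∑-tuples (suc m) f = ∑ λ v → ∑-tuples m (f ∘ (v ∷_))

ψ : ∀ {n} → ℕ → Matrix n → Fin n → Fin n → ℚ
ψ t A i j = ∑-tuples (suc t) λ v →
  if does ((head v Fin.≟ i) ×-dec (last v Fin.≟ j))
  then ∏ (λ (m : Fin t) → A (lookup v (inject₁ m)) (lookup v (Fin.suc m)))
  else 0ℚ

------------------------------------------------------------------------
-- Walk Counting Procedure

module WalkCounting {n} (A : Matrix n) (T̂ : ℕ) where

  S : Fin n → Set
  S i = 0ℚ < ψ (2 ℕ.* T̂) A i i

  ratio : Fin n → ℚ
  ratio i = ψ (2 ℕ.* T̂ ℕ.+ 1) A i i / ψ (2 ℕ.* T̂) A i i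

  record Output (β : ℚ) (x : Fin n → ℚ) : Set where
    field
      i₀         : Fin n
      i₀∈S       : S i₀
      i₀-maximal : ∀ i → S i → ratio i ≤ ratio i₀
      β-value    : β ≡ ratio i₀
      x-value    : ∀ j → x j ≡ ψ T̂ A i₀ j

------------------------------------------------------------------------
-- Clique Decision Algorithm

data Answer : Set where
  YES NO : Answer

-- Only the entries wᴱ̄ i j at nonedges i < j are ever used.
record Weights (n : ℕ) : Set where
  field
    wᴱ̄ : Fin n → Fin n → ℚ
    w₀ : ℚ

open Weights public

module Algorithm {n} (G : Graph n) (k : ℕ) where

  C : ℕ
  C = (k ∸ 1) ℕ.* n ℕ.* (n ∸ 1) ℕ.+ 2

  ε : ℚ
  ε = (1ℚ / fromℕ (2 ℕ.* n)) * (1ℚ / fromℕ C)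

  record Admissible (ε̂ : Cut) (T T̂ : ℕ) : Set where
    field
      ε̂-real     : IsDedekind ε̂
      ε̂-positive : ι 0ℚ <ᴿ ε̂
      ε̂-bound    : ε̂ ≤ᴿ ι (1ℚ / fromℕ ((k ℕ.+ 1) ℕ.* C))
      T-bound    : ι (fromℕ 4) *ᴿ ln (ι (#nonedges G + 1ℚ))
                     *ᴿ ι (fromℕ (n ℕ.^ 2 ℕ.* C ℕ.^ 2))
                   <ᴿ ι (fromℕ T)
      T̂-bound    : recip⁺ ε̂ *ᴿ ln (ι (fromℕ (2 ℕ.* n)) *ᴿ recip⁺ ε̂)
                   ≤ᴿ ι (fromℕ T̂)

  initial : Weights n
  initial = record { wᴱ̄ = λ _ _ → 1ℚ ; w₀ = 1ℚ }

  normalise : Weights n → Weights n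
  normalise w = record
    { wᴱ̄ = λ i j → wᴱ̄ w i j / total
    ; w₀ = w₀ w / total
    }
    where
    total = ∑ᴱ̄ G (wᴱ̄ w) + w₀ w

  matrix : Weights n → Matrix n
  matrix p u v =
    ∑ᴱ̄ G (λ i j → - wᴱ̄ p i j * Y i j u v) + w₀ p * J u v + I u v

  update : Weights n → (Fin n → ℚ) → Weights n
  update w x = record
    { wᴱ̄ = λ i j → wᴱ̄ w i j *
        (1ℚ + (ε / fromℕ n) * ((fromℕ 2 * x i * x j) / ‖x‖²))
    ; w₀ = w₀ w *
        (1ℚ - (ε / fromℕ n) * ((∑ x * ∑ x) / ‖x‖² - fromℕ k))
    }
    where
    ‖x‖² = ∑ λ i → x i * x i

  BelowThreshold : Cut → Weights n → ℚ → Set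
  BelowThreshold ε̂ p β =
    ι β <ᴿ (ι 1ℚ -ᴿ ε̂) *ᴿ ι (w₀ p * fromℕ k + 1ℚ)

  -- Loop ε̂ T̂ a r w: with r iterations left and current weights w, the
  -- algorithm returns a whatever choices of i₀ are made.  The first
  -- component says that the Walk Counting Procedure has an output, so
  -- that the execution never gets stuck.  The test compares a rational
  -- with a real, so its two branches are given by implications and not
  -- by a case split on a decision.
  Loop : Cut → ℕ → Answer → ℕ → Weights n → Set
  Loop ε̂ T̂ a zero    w = a ≡ YES
  Loop ε̂ T̂ a (suc r) w =
    (∃[ β ] ∃[ x ] Output β x) ×
    (∀ β x → Output β x →
      (BelowThreshold ε̂ p β → a ≡ NO) ×
      (¬ BelowThreshold ε̂ p β → Loop ε̂ T̂ a r (update w x)))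
    where
    p = normalise w
    open WalkCounting (matrix p) T̂

  Returns : Cut → ℕ → ℕ → Answer → Set
  Returns ε̂ T T̂ a = Loop ε̂ T̂ a T initial

-- Let ω = p₀ k + 1.  If K is a clique of size k, its indicator vector has Rayleigh quotient ω for
-- every matrix A of the algorithm.  A is positive semidefinite, so the moments ⟨v, Aˢ v⟩ and
-- tr Aˢ are log-convex in s, which gives ω ^ 2T̂ ≤ n β ^ 2T̂; as T̂ is large, β is never below the
-- threshold.
--
-- If there is no clique of size k, perfection yields a colouring with c = k - 1 colours, and
-- Cauchy-Schwarz over the colour classes shows that for every x the gains 2 xᵢ xⱼ / ‖x‖² of the
-- monochromatic pairs and k - (∑ x)² / ‖x‖² of the apex, weighted by 2 c and 2, sum to at least 2.
-- While β stays above the threshold, the total weight grows at most by a factor 1 + η / C per step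
-- (η = ε / n), whereas the product of the corresponding C weights grows at least by 1 + 13 η / 8.
-- Since the product is at most the C-th power of the total weight, this cannot go on for T steps.
-- Logarithms are avoided: all comparisons with exp go through its partial sums.

module Submission where

open import Defs
open import Algebra.Bundles using (CommutativeRing)
import Algebra.Properties.CommutativeMonoid.Sum as CMSum
import Algebra.Properties.CommutativeSemiring.Exp as Exp
import Algebra.Properties.Semiring.Sum as SRSum
open import Data.Bool.Base using (true; false; if_then_else_; _∧_)
open import Data.Empty using (⊥)
open import Data.Fin.Base as Fin using (Fin; zero; suc; inject₁; punchIn; toℕ)
open import Data.Fin.Properties as Fin using ()
open import Data.Fin.Subset using (Subset; ∣_∣; _⊆_) renaming (⊥ to ⊥ₛ)
open import Data.Fin.Subset.Properties using (∉⊥; ∣⊥∣≡0; s⊆s)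
open import Data.Integer.Base as ℤ using ()
open import Data.Integer.Properties as ℤ using ()
open import Data.Maybe.Base using (Maybe; just; nothing)
open import Data.Nat.Base as ℕ using (ℕ; zero; suc; z≤n; s≤s)
open import Data.Nat.Properties as ℕ using ()
open import Data.Product.Base using (∃-syntax; _×_; _,_; proj₁; proj₂)
open import Data.Rational.Base as ℚ
  using (ℚ; 0ℚ; 1ℚ; ½; _+_; _*_; _-_; -_; _<_; _≤_; ≢-nonZero; positive; nonNegative; mkℚ)
open import Data.Rational.Properties as ℚ using ()
import Data.Rational.Unnormalised.Base as ℚᵘ
import Data.Rational.Unnormalised.Properties as ℚᵘ
open import Data.Sum.Base using (_⊎_; inj₁; inj₂)
open import Data.Vec.Base using (Vec; []; _∷_; last; lookup)
open import Data.Vec.Properties as Vec using ()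
open import Function.Base using (_∘_)
open import Function.Construct.Identity using (↣-id)
open import Level using (0ℓ)
open import Relation.Binary.Definitions using (tri<; tri≈; tri>)
open import Relation.Binary.PropositionalEquality
  using (_≡_; _≢_; refl; sym; trans; cong; cong₂; subst; subst₂; module ≡-Reasoning)
open import Relation.Nullary.Decidable.Core using (Dec; yes; no; does)
open import Relation.Nullary.Decidable using (dec-true; dec-false)
open import Relation.Nullary.Negation.Core using (¬_; contradiction)
open import Tactic.RingSolver using (solve-∀)
open import Tactic.RingSolver.Core.AlmostCommutativeRing
  using (AlmostCommutativeRing; fromCommutativeRing)

open CMSum ℚ.+-0-commutativeMonoid public
  using (∑-distrib-+; ∑-comm) renaming (sum-cong-≗ to ∑-cong; sum-init-last to ∑-init-last)
open CMSum ℚ.*-1-commutativeMonoid public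
  using () renaming (sum-cong-≗ to ∏-cong; ∑-distrib-+ to ∏-distrib-*)
open SRSum (CommutativeRing.semiring ℚ.+-*-commutativeRing) public
  using () renaming (*-distribˡ-sum to *-distribˡ-∑; *-distribʳ-sum to *-distribʳ-∑)
open Exp (CommutativeRing.commutativeSemiring ℚ.+-*-commutativeRing) public
  using (_^_; ^-homo-*; ^-distrib-*; ^-assocʳ)

-- The data of the algorithm are rational, so the argument is carried out in the ordered field ℚ,
-- where eigenvalues and logarithms are missing. Spectral information is needed only as ratios of
-- consecutive moments, and log-convexity makes these ratios increase; cuts enter only through ε̂
-- and the bounds on T and T̂. The constants of the second half arise as follows. `C` counts
-- constraints with multiplicity: each ordered pair of distinct vertices k - 1 times and the apex
-- twice. Per step the first-order gains of the product are at least 2 η, and the second-order terms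
-- cost at most 3 η / 8. The rate η / C of the total weight comes from the upper bound for ε̂, which
-- is 1 / C when multiplied by k + 1; the C-th power then gains about 1 + η. Of the surplus 5 η / 8,
-- the share η / 2 becomes the decay rate h = η / (2 C) = 1 / (4 n² C²), for which the bound on T
-- reads T h > ln L, where L is the initial total weight; the remaining η / 8 absorbs errors of
-- higher order.

ℚ-ring : AlmostCommutativeRing 0ℓ 0ℓ
ℚ-ring = fromCommutativeRing ℚ.+-*-commutativeRing 0≟_
  where
  0≟_ : ∀ x → Maybe (0ℚ ≡ x)
  0≟ x with 0ℚ ℚ.≟ x
  ... | yes eq = just eq
  ... | no _   = nothing

-- Ordered field arithmetic

module _ where

  private variable
    a b c d : ℚ

  0≤1 : 0ℚ ≤ 1ℚ
  0≤1 = ℚ.nonNegative⁻¹ 1ℚ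

  0<1 : 0ℚ < 1ℚ
  0<1 = ℚ.positive⁻¹ 1ℚ

  0≤+ : 0ℚ ≤ a → 0ℚ ≤ b → 0ℚ ≤ a + b
  0≤+ = ℚ.+-mono-≤

  0<+ : 0ℚ < a → 0ℚ ≤ b → 0ℚ < a + b
  0<+ = ℚ.+-mono-<-≤

  *-monoˡ-≤ : 0ℚ ≤ c → a ≤ b → c * a ≤ c * b
  *-monoˡ-≤ {c} 0≤c = ℚ.*-monoˡ-≤-nonNeg c {{nonNegative 0≤c}}

  *-monoʳ-≤ : 0ℚ ≤ c → a ≤ b → a * c ≤ b * c
  *-monoʳ-≤ {c} 0≤c = ℚ.*-monoʳ-≤-nonNeg c {{nonNegative 0≤c}}

  *-monoˡ-< : 0ℚ < c → a < b → c * a < c * b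
  *-monoˡ-< {c} 0<c = ℚ.*-monoʳ-<-pos c {{positive 0<c}}

  *-monoʳ-< : 0ℚ < c → a < b → a * c < b * c
  *-monoʳ-< {c} 0<c = ℚ.*-monoˡ-<-pos c {{positive 0<c}}

  0≤* : 0ℚ ≤ a → 0ℚ ≤ b → 0ℚ ≤ a * b
  0≤* {a} 0≤a 0≤b = subst₂ _≤_ (ℚ.*-zeroʳ a) refl (*-monoˡ-≤ 0≤a 0≤b)

  0<* : 0ℚ < a → 0ℚ < b → 0ℚ < a * b
  0<* {a} 0<a 0<b = subst₂ _<_ (ℚ.*-zeroʳ a) refl (*-monoˡ-< 0<a 0<b)

  *-mono-≤ : 0ℚ ≤ a → 0ℚ ≤ d → a ≤ b → c ≤ d → a * c ≤ b * d
  *-mono-≤ 0≤a 0≤d a≤b c≤d = ℚ.≤-trans (*-monoˡ-≤ 0≤a c≤d) (*-monoʳ-≤ 0≤d a≤b)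

  *-cancelˡ-≤ : 0ℚ < c → c * a ≤ c * b → a ≤ b
  *-cancelˡ-≤ {c} 0<c = ℚ.*-cancelˡ-≤-pos c {{positive 0<c}}

  *-cancelʳ-≤ : 0ℚ < c → a * c ≤ b * c → a ≤ b
  *-cancelʳ-≤ {c} 0<c = ℚ.*-cancelʳ-≤-pos c {{positive 0<c}}

  *-cancelʳ-< : 0ℚ < c → a * c < b * c → a < b
  *-cancelʳ-< {c} 0<c = ℚ.*-cancelʳ-<-nonNeg c {{nonNegative (ℚ.<⇒≤ 0<c)}}

  *-cancelʳ-≡ : 0ℚ < c → a * c ≡ b * c → a ≡ b
  *-cancelʳ-≡ 0<c eq = ℚ.≤-antisym (*-cancelʳ-≤ 0<c (ℚ.≤-reflexive eq))
                                   (*-cancelʳ-≤ 0<c (ℚ.≤-reflexive (sym eq)))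

  0<*⇒0< : 0ℚ < c → 0ℚ < a * c → 0ℚ < a
  0<*⇒0< {c} 0<c 0<ac = *-cancelʳ-< 0<c (subst₂ _<_ (sym (ℚ.*-zeroˡ c)) refl 0<ac)

  ≤⇒0≤- : a ≤ b → 0ℚ ≤ b - a
  ≤⇒0≤- {a} a≤b = subst₂ _≤_ (ℚ.+-inverseʳ a) refl (ℚ.+-monoˡ-≤ (- a) a≤b)

  <⇒0<- : a < b → 0ℚ < b - a
  <⇒0<- {a} a<b = subst₂ _<_ (ℚ.+-inverseʳ a) refl (ℚ.+-monoˡ-< (- a) a<b)

  ≤-by : ∀ c → 0ℚ ≤ c → b ≡ a + c → a ≤ b
  ≤-by {a = a} c 0≤c refl = subst (_≤ a + c) (ℚ.+-identityʳ a) (ℚ.+-monoʳ-≤ a 0≤c)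

  <-by : ∀ c → 0ℚ < c → b ≡ a + c → a < b
  <-by {a = a} c 0<c refl = subst (_< a + c) (ℚ.+-identityʳ a) (ℚ.+-monoʳ-< a 0<c)

  ≤+ : ∀ a → 0ℚ ≤ c → a ≤ a + c
  ≤+ a 0≤c = ≤-by _ 0≤c refl

  ≤+ˡ : ∀ a → 0ℚ ≤ c → a ≤ c + a
  ≤+ˡ {c} a 0≤c = ≤-by _ 0≤c (ℚ.+-comm c a)

  0≤-square : ∀ a → 0ℚ ≤ a * a
  0≤-square a with ℚ.≤-total 0ℚ a
  ... | inj₁ 0≤a = 0≤* 0≤a 0≤a
  ... | inj₂ a≤0 = subst (0ℚ ≤_) (lemma a) (0≤* 0≤-a 0≤-a)
    where
    0≤-a : 0ℚ ≤ 0ℚ - a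
    0≤-a = ≤⇒0≤- a≤0
    lemma : ∀ a → (0ℚ - a) * (0ℚ - a) ≡ a * a
    lemma = solve-∀ ℚ-ring

  /-*-cancel : ∀ a → 0ℚ < b → a / b * b ≡ a
  /-*-cancel {b} a 0<b with b ℚ.≟ 0ℚ
  ... | yes refl = contradiction 0<b (ℚ.<-irrefl refl)
  ... | no b≢0   = trans (ℚ.*-assoc a _ b)
    (trans (cong (a *_) (ℚ.*-inverseˡ b {{≢-nonZero b≢0}})) (ℚ.*-identityʳ a))

  /-unique : 0ℚ < b → c * b ≡ a → c ≡ a / b
  /-unique 0<b eq = *-cancelʳ-≡ 0<b (trans eq (sym (/-*-cancel _ 0<b)))

  0≤/ : 0ℚ ≤ a → 0ℚ < b → 0ℚ ≤ a / b
  0≤/ {a} {b} 0≤a 0<b = *-cancelʳ-≤ 0<b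
    (subst₂ _≤_ (sym (ℚ.*-zeroˡ b)) (sym (/-*-cancel a 0<b)) 0≤a)

  0</ : 0ℚ < a → 0ℚ < b → 0ℚ < a / b
  0</ {a} {b} 0<a 0<b = 0<*⇒0< 0<b (subst (0ℚ <_) (sym (/-*-cancel a 0<b)) 0<a)

  0≤^ : 0ℚ ≤ a → ∀ m → 0ℚ ≤ a ^ m
  0≤^ 0≤a zero    = 0≤1
  0≤^ 0≤a (suc m) = 0≤* 0≤a (0≤^ 0≤a m)

  0<^ : 0ℚ < a → ∀ m → 0ℚ < a ^ m
  0<^ 0<a zero    = 0<1
  0<^ 0<a (suc m) = 0<* 0<a (0<^ 0<a m)

  ^-monoˡ-≤ : 0ℚ ≤ a → a ≤ b → ∀ m → a ^ m ≤ b ^ m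
  ^-monoˡ-≤ 0≤a a≤b zero    = ℚ.≤-refl
  ^-monoˡ-≤ 0≤a a≤b (suc m) =
    *-mono-≤ 0≤a (0≤^ (ℚ.≤-trans 0≤a a≤b) m) a≤b (^-monoˡ-≤ 0≤a a≤b m)

  1≤^ : 1ℚ ≤ a → ∀ m → 1ℚ ≤ a ^ m
  1≤^ 1≤a zero    = ℚ.≤-refl
  1≤^ 1≤a (suc m) = *-mono-≤ 0≤1 (ℚ.≤-trans 0≤1 (1≤^ 1≤a m)) 1≤a (1≤^ 1≤a m)

  1^ : ∀ m → 1ℚ ^ m ≡ 1ℚ
  1^ zero    = refl
  1^ (suc m) = trans (ℚ.*-identityˡ (1ℚ ^ m)) (1^ m)

  ^-monoˡ-< : 0ℚ ≤ a → a < b → ∀ m → a ^ suc m < b ^ suc m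
  ^-monoˡ-< {a} {b} 0≤a a<b m = ℚ.≤-<-trans
    (*-monoˡ-≤ 0≤a (^-monoˡ-≤ 0≤a (ℚ.<⇒≤ a<b) m))
    (*-monoʳ-< (0<^ (ℚ.≤-<-trans 0≤a a<b) m) a<b)

  ^-cancelˡ-≤ : 0ℚ ≤ b → ∀ m → a ^ suc m ≤ b ^ suc m → a ≤ b
  ^-cancelˡ-≤ 0≤b m aᵐ≤bᵐ =
    ℚ.≮⇒≥ λ b<a → ℚ.<-irrefl refl (ℚ.<-≤-trans (^-monoˡ-< 0≤b b<a m) aᵐ≤bᵐ)

-- Embedding of the naturals

private
  toℚᵘ-fromℕ : ∀ m → ℚ.toℚᵘ (fromℕ m) ℚᵘ.≃ (ℚᵘ.mkℚᵘ (ℤ.+ m) 0)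
  toℚᵘ-fromℕ m = ℚ.toℚᵘ-fromℚᵘ (ℚᵘ.mkℚᵘ (ℤ.+ m) 0)

fromℕ-+ : ∀ m n → fromℕ (m ℕ.+ n) ≡ fromℕ m + fromℕ n
fromℕ-+ m n = ℚ.toℚᵘ-injective (begin
  ℚ.toℚᵘ (fromℕ (m ℕ.+ n))                   ≈⟨ toℚᵘ-fromℕ (m ℕ.+ n) ⟩
  ℚᵘ.mkℚᵘ (ℤ.+ (m ℕ.+ n)) 0                    ≈⟨ ℚᵘ.*≡* (cong (ℤ._* ℤ.+ 1) (cong₂ ℤ._+_ (sym (ℤ.*-identityʳ (ℤ.+ m))) (sym (ℤ.*-identityʳ (ℤ.+ n))))) ⟩
  ℚᵘ.mkℚᵘ (ℤ.+ m) 0 ℚᵘ.+ ℚᵘ.mkℚᵘ (ℤ.+ n) 0       ≈⟨ ℚᵘ.+-cong (toℚᵘ-fromℕ m) (toℚᵘ-fromℕ n) ⟨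
  ℚ.toℚᵘ (fromℕ m) ℚᵘ.+ ℚ.toℚᵘ (fromℕ n)     ≈⟨ ℚ.toℚᵘ-homo-+ (fromℕ m) (fromℕ n) ⟨
  ℚ.toℚᵘ (fromℕ m + fromℕ n)                 ∎)
  where open ℚᵘ.≃-Reasoning

fromℕ-suc : ∀ m → fromℕ (suc m) ≡ 1ℚ + fromℕ m
fromℕ-suc = fromℕ-+ 1

fromℕ-* : ∀ m n → fromℕ (m ℕ.* n) ≡ fromℕ m * fromℕ n
fromℕ-* zero    n = sym (ℚ.*-zeroˡ (fromℕ n))
fromℕ-* (suc m) n = begin
  fromℕ (n ℕ.+ m ℕ.* n)         ≡⟨ fromℕ-+ n (m ℕ.* n) ⟩
  fromℕ n + fromℕ (m ℕ.* n)     ≡⟨ cong (λ z → fromℕ n + z) (fromℕ-* m n) ⟩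
  fromℕ n + fromℕ m * fromℕ n   ≡⟨ lemma (fromℕ m) (fromℕ n) ⟩
  (1ℚ + fromℕ m) * fromℕ n      ≡⟨ cong (_* fromℕ n) (fromℕ-suc m) ⟨
  fromℕ (suc m) * fromℕ n       ∎
  where
  open ≡-Reasoning
  lemma : ∀ x y → y + x * y ≡ (1ℚ + x) * y
  lemma = solve-∀ ℚ-ring

0≤fromℕ : ∀ m → 0ℚ ≤ fromℕ m
0≤fromℕ zero    = ℚ.≤-refl
0≤fromℕ (suc m) = subst (0ℚ ≤_) (sym (fromℕ-suc m)) (0≤+ 0≤1 (0≤fromℕ m))

0<fromℕ-suc : ∀ m → 0ℚ < fromℕ (suc m)
0<fromℕ-suc m = subst (0ℚ <_) (sym (fromℕ-suc m)) (0<+ 0<1 (0≤fromℕ m))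

fromℕ-mono-≤ : ∀ {m n} → m ℕ.≤ n → fromℕ m ≤ fromℕ n
fromℕ-mono-≤ {m} {n} m≤n = ≤-by (fromℕ (n ℕ.∸ m)) (0≤fromℕ (n ℕ.∸ m))
  (trans (cong fromℕ (sym (ℕ.m+[n∸m]≡n m≤n))) (fromℕ-+ m (n ℕ.∸ m)))

0<fromℕ : ∀ {m} → 1 ℕ.≤ m → 0ℚ < fromℕ m
0<fromℕ {suc m} _ = 0<fromℕ-suc m

-- The numerator plus one is enough, since the denominator is at least 1.
archimedean : ∀ q → ∃[ m ] q < fromℕ m
archimedean (mkℚ (ℤ.+ p) d-1 _)      = suc p , ℚ.toℚᵘ-cancel-<
  (ℚᵘ.<-respʳ-≃ (ℚᵘ.≃-sym (toℚᵘ-fromℕ (suc p))) (ℚᵘ.*<* p<[1+p]d))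
  where
  p<[1+p]d : ℤ.+ p ℤ.* ℤ.+ 1 ℤ.< ℤ.+ suc p ℤ.* ℤ.+ suc d-1
  p<[1+p]d = subst₂ ℤ._<_ (sym (ℤ.*-identityʳ (ℤ.+ p))) (ℤ.pos-* (suc p) (suc d-1))
    (ℤ.+<+ (ℕ.<-≤-trans (ℕ.n<1+n p) (ℕ.m≤m*n (suc p) (suc d-1))))
archimedean q@(mkℚ ℤ.-[1+ p ] _ _) = 0 , ℚ.negative⁻¹ q

-- Finite sums and products

∑-0 : ∀ n → ∑ {n} (λ _ → 0ℚ) ≡ 0ℚ
∑-0 = CMSum.sum-replicate-zero ℚ.+-0-commutativeMonoid

∑-const : ∀ n a → ∑ {n} (λ _ → a) ≡ fromℕ n * a
∑-const zero    a = sym (ℚ.*-zeroˡ a)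
∑-const (suc n) a = trans (cong (λ z → a + z) (∑-const n a))
  (trans (lemma a (fromℕ n)) (cong (_* a) (sym (fromℕ-suc n))))
  where
  lemma : ∀ a n → a + n * a ≡ (1ℚ + n) * a
  lemma = solve-∀ ℚ-ring

∑-mono : ∀ {n} {f g : Fin n → ℚ} → (∀ i → f i ≤ g i) → ∑ f ≤ ∑ g
∑-mono {zero}  f≤g = ℚ.≤-refl
∑-mono {suc n} f≤g = ℚ.+-mono-≤ (f≤g zero) (∑-mono (f≤g ∘ suc))

0≤∑ : ∀ {n} {f : Fin n → ℚ} → (∀ i → 0ℚ ≤ f i) → 0ℚ ≤ ∑ f
0≤∑ {n} {f} 0≤f = subst (_≤ ∑ f) (∑-0 n) (∑-mono 0≤f)

term≤∑ : ∀ {n} {f : Fin n → ℚ} → (∀ i → 0ℚ ≤ f i) → ∀ i → f i ≤ ∑ f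
term≤∑ {suc n} {f} 0≤f zero    = ≤-by _ (0≤∑ (0≤f ∘ suc)) refl
term≤∑ {suc n} {f} 0≤f (suc i) = ≤-by (f zero + (∑ (f ∘ suc) - f (suc i)))
  (0≤+ (0≤f zero) (≤⇒0≤- (term≤∑ (0≤f ∘ suc) i))) (lemma (f zero) _ (f (suc i)))
  where
  lemma : ∀ a b c → a + b ≡ c + (a + (b - c))
  lemma = solve-∀ ℚ-ring

∑-neg : ∀ {n} (f : Fin n → ℚ) → ∑ (λ i → - f i) ≡ - ∑ f
∑-neg f = begin
  ∑ (λ i → - f i)        ≡⟨ ∑-cong (λ i → lemma (f i)) ⟩
  ∑ (λ i → - 1ℚ * f i)   ≡⟨ *-distribˡ-∑ (- 1ℚ) f ⟨
  - 1ℚ * ∑ f             ≡⟨ lemma (∑ f) ⟨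
  - ∑ f                  ∎
  where
  open ≡-Reasoning
  lemma : ∀ a → - a ≡ - 1ℚ * a
  lemma = solve-∀ ℚ-ring

∑-*-∑ : ∀ {m n} (f : Fin m → ℚ) (g : Fin n → ℚ) → ∑ f * ∑ g ≡ ∑ λ i → ∑ λ j → f i * g j
∑-*-∑ f g = trans (*-distribʳ-∑ (∑ g) f) (∑-cong λ i → *-distribˡ-∑ (f i) g)

0≤∏ : ∀ {n} {f : Fin n → ℚ} → (∀ i → 0ℚ ≤ f i) → 0ℚ ≤ ∏ f
0≤∏ {zero}  0≤f = 0≤1
0≤∏ {suc n} 0≤f = 0≤* (0≤f zero) (0≤∏ (0≤f ∘ suc))

-- Vectors and symmetric matrices

module _ {n : ℕ} where

  infix 8 _∙_
  _∙_ : (Fin n → ℚ) → (Fin n → ℚ) → ℚ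
  x ∙ y = ∑ λ i → x i * y i

  infixr 9 _·_
  _·_ : Matrix n → (Fin n → ℚ) → Fin n → ℚ
  (A · x) i = ∑ λ j → A i j * x j

  basis : Fin n → Fin n → ℚ
  basis j i = I i j

  Symmetric : Matrix n → Set
  Symmetric A = ∀ i j → A i j ≡ A j i

  PositiveSemidefinite : Matrix n → Set
  PositiveSemidefinite A = ∀ x → 0ℚ ≤ x ∙ (A · x)

  ∙-comm : ∀ x y → x ∙ y ≡ y ∙ x
  ∙-comm x y = ∑-cong λ i → ℚ.*-comm (x i) (y i)

  ∙-congʳ : ∀ x {y z} → (∀ i → y i ≡ z i) → x ∙ y ≡ x ∙ z
  ∙-congʳ x y≗z = ∑-cong λ i → cong (x i *_) (y≗z i)

  ∙-linearʳ : ∀ x y c z → x ∙ (λ i → y i - c * z i) ≡ x ∙ y - c * x ∙ z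
  ∙-linearʳ x y c z = begin
    ∑ (λ i → x i * (y i - c * z i))              ≡⟨ ∑-cong (λ i → lemma₁ (x i) (y i) c (z i)) ⟩
    ∑ (λ i → x i * y i + - c * (x i * z i))      ≡⟨ ∑-distrib-+ (λ i → x i * y i) (λ i → - c * (x i * z i)) ⟩
    x ∙ y + ∑ (λ i → - c * (x i * z i))          ≡⟨ cong (λ s → x ∙ y + s) (*-distribˡ-∑ (- c) (λ i → x i * z i)) ⟨
    x ∙ y + - c * x ∙ z                          ≡⟨ lemma₂ (x ∙ y) c (x ∙ z) ⟩
    x ∙ y - c * x ∙ z                            ∎
    where
    open ≡-Reasoning
    lemma₁ : ∀ x y c z → x * (y - c * z) ≡ x * y + - c * (x * z)
    lemma₁ = solve-∀ ℚ-ring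
    lemma₂ : ∀ x c z → x + - c * z ≡ x - c * z
    lemma₂ = solve-∀ ℚ-ring

  ∙-linearˡ : ∀ x y c z → (λ i → y i - c * z i) ∙ x ≡ y ∙ x - c * z ∙ x
  ∙-linearˡ x y c z = trans (∙-comm (λ i → y i - c * z i) x)
    (trans (∙-linearʳ x y c z) (cong₂ (λ s t → s - c * t) (∙-comm x y) (∙-comm x z)))

  ∙-self-nonneg : ∀ x → 0ℚ ≤ x ∙ x
  ∙-self-nonneg x = 0≤∑ λ i → 0≤-square (x i)

  -- Lagrange's identity: twice the difference of the two sides is the sum over all i, j of the
  -- squares of x i * y j - x j * y i. Doubling avoids a sum restricted to i < j.
  cauchy-schwarz : ∀ x y → (x ∙ y) * (x ∙ y) ≤ (x ∙ x) * (y ∙ y)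
  cauchy-schwarz x y = *-cancelˡ-≤ (0<+ 0<1 0≤1) (begin
    (1ℚ + 1ℚ) * ((x ∙ y) * (x ∙ y))
      ≡⟨ cong ((1ℚ + 1ℚ) *_) (∑-*-∑ (λ i → x i * y i) (λ i → x i * y i)) ⟩
    (1ℚ + 1ℚ) * ∑ (λ i → ∑ λ j → x i * y i * (x j * y j))
      ≡⟨ trans (*-distribˡ-∑ (1ℚ + 1ℚ) (λ i → ∑ λ j → x i * y i * (x j * y j)))
           (∑-cong λ i → *-distribˡ-∑ (1ℚ + 1ℚ) (λ j → x i * y i * (x j * y j))) ⟩
    ∑ (λ i → ∑ λ j → (1ℚ + 1ℚ) * (x i * y i * (x j * y j)))
      ≤⟨ ∑-mono (λ i → ∑-mono λ j → ≤-by _ (0≤-square (x i * y j - x j * y i))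
           (lemma (x i) (y i) (x j) (y j))) ⟩
    ∑ (λ i → ∑ λ j → x i * x i * (y j * y j) + x j * x j * (y i * y i))
      ≡⟨ trans (∑-cong λ i → ∑-distrib-+ (λ j → x i * x i * (y j * y j)) (λ j → x j * x j * (y i * y i)))
           (∑-distrib-+ (λ i → ∑ λ j → x i * x i * (y j * y j)) (λ i → ∑ λ j → x j * x j * (y i * y i))) ⟩
    ∑ (λ i → ∑ λ j → x i * x i * (y j * y j)) + ∑ (λ i → ∑ λ j → x j * x j * (y i * y i))
      ≡⟨ cong (∑ (λ i → ∑ λ j → x i * x i * (y j * y j)) +_) (∑-comm λ i j → x j * x j * (y i * y i)) ⟩
    ∑ (λ i → ∑ λ j → x i * x i * (y j * y j)) + ∑ (λ i → ∑ λ j → x i * x i * (y j * y j))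
      ≡⟨ cong₂ _+_ x²y² x²y² ⟨
    (x ∙ x) * (y ∙ y) + (x ∙ x) * (y ∙ y)
      ≡⟨ double ((x ∙ x) * (y ∙ y)) ⟩
    (1ℚ + 1ℚ) * ((x ∙ x) * (y ∙ y)) ∎)
    where
    open ℚ.≤-Reasoning
    x²y² : (x ∙ x) * (y ∙ y) ≡ ∑ (λ i → ∑ λ j → x i * x i * (y j * y j))
    x²y² = ∑-*-∑ (λ i → x i * x i) (λ i → y i * y i)
    double : ∀ a → a + a ≡ (1ℚ + 1ℚ) * a
    double = solve-∀ ℚ-ring
    lemma : ∀ a b c d → a * a * (d * d) + c * c * (b * b) ≡
                        (1ℚ + 1ℚ) * (a * b * (c * d)) + (a * d - c * b) * (a * d - c * b)
    lemma = solve-∀ ℚ-ring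

  ·-linear : ∀ A x c y i → (A · (λ j → x j - c * y j)) i ≡ (A · x) i - c * (A · y) i
  ·-linear A x c y i = ∙-linearʳ (A i) x c y

  ·-symmetric : ∀ {A} → Symmetric A → ∀ x y → (A · x) ∙ y ≡ x ∙ (A · y)
  ·-symmetric {A} A-sym x y = begin
    ∑ (λ i → ∑ (λ j → A i j * x j) * y i)     ≡⟨ ∑-cong (λ i → *-distribʳ-∑ (y i) (λ j → A i j * x j)) ⟩
    ∑ (λ i → ∑ λ j → A i j * x j * y i)       ≡⟨ ∑-comm (λ i j → A i j * x j * y i) ⟩
    ∑ (λ j → ∑ λ i → A i j * x j * y i)       ≡⟨ ∑-cong (λ j → ∑-cong λ i → trans (cong (λ a → a * x j * y i) (A-sym i j)) (lemma (A j i) (x j) (y i))) ⟩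
    ∑ (λ j → ∑ λ i → x j * (A j i * y i))     ≡⟨ ∑-cong (λ j → *-distribˡ-∑ (x j) (λ i → A j i * y i)) ⟨
    ∑ (λ j → x j * ∑ (λ i → A j i * y i))     ∎
    where
    open ≡-Reasoning
    lemma : ∀ a b c → a * b * c ≡ b * (a * c)
    lemma = solve-∀ ℚ-ring

  -- Iterated application to a vector, so that products of matrices and their associativity never
  -- arise.
  power : Matrix n → ℕ → (Fin n → ℚ) → Fin n → ℚ
  power A zero    x = x
  power A (suc s) x = A · power A s x

  power-·-comm : ∀ A s x i → power A s (A · x) i ≡ (A · power A s x) i
  power-·-comm A zero    x i = refl
  power-·-comm A (suc s) x i = ∙-congʳ (A i) (power-·-comm A s x)

  power-+ : ∀ A s t x i → power A (s ℕ.+ t) x i ≡ power A s (power A t x) i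
  power-+ A zero    t x i = refl
  power-+ A (suc s) t x i = ∙-congʳ (A i) (power-+ A s t x)

  power-linear : ∀ A s x c y i →
    power A s (λ j → x j - c * y j) i ≡ power A s x i - c * power A s y i
  power-linear A zero    x c y i = refl
  power-linear A (suc s) x c y i = trans (∙-congʳ (A i) (power-linear A s x c y))
    (·-linear A (power A s x) c (power A s y) i)

  module _ {A : Matrix n} (A-sym : Symmetric A) where

    power-symmetric : ∀ s x y → power A s x ∙ y ≡ x ∙ power A s y
    power-symmetric zero    x y = refl
    power-symmetric (suc s) x y = begin
      (A · power A s x) ∙ y      ≡⟨ ·-symmetric A-sym (power A s x) y ⟩
      power A s x ∙ (A · y)      ≡⟨ power-symmetric s x (A · y) ⟩
      x ∙ power A s (A · y)      ≡⟨ ∙-congʳ x (power-·-comm A s y) ⟩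
      x ∙ (A · power A s y)      ∎
      where open ≡-Reasoning

    power-+-∙ : ∀ s t x y → x ∙ power A (s ℕ.+ t) y ≡ power A s x ∙ power A t y
    power-+-∙ s t x y = trans (∙-congʳ x (power-+ A s t y)) (sym (power-symmetric s x (power A t y)))

  ∑-I : ∀ i (f : Fin n → ℚ) → ∑ (λ j → I i j * f j) ≡ f i
  ∑-I = go
    where
    go : ∀ {n} i (f : Fin n → ℚ) → ∑ (λ j → I i j * f j) ≡ f i
    go {suc n} zero    f = trans (cong₂ _+_ (ℚ.*-identityˡ (f zero))
      (trans (∑-cong λ j → ℚ.*-zeroˡ (f (suc j))) (∑-0 n))) (ℚ.+-identityʳ (f zero))
    go {suc n} (suc i) f = trans (cong₂ _+_ (ℚ.*-zeroˡ (f zero)) (go i (f ∘ suc)))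
      (ℚ.+-identityˡ (f (suc i)))

  I-sym : ∀ (i j : Fin n) → I i j ≡ I j i
  I-sym = go
    where
    go : ∀ {n} (i j : Fin n) → I i j ≡ I j i
    go zero    zero    = refl
    go zero    (suc j) = refl
    go (suc i) zero    = refl
    go (suc i) (suc j) = go i j

  basis-∙ : ∀ i x → basis i ∙ x ≡ x i
  basis-∙ i x = trans (∑-cong λ j → cong (_* x j) (I-sym j i)) (∑-I i x)

I-refl : ∀ {n} (i : Fin n) → I i i ≡ 1ℚ
I-refl zero    = refl
I-refl (suc i) = I-refl i

-- Walks

module _ {n : ℕ} (A : Matrix n) where

  private
    pathWeight : ∀ {t} → Vec (Fin n) (suc t) → ℚ
    pathWeight {t} v = ∏ λ (m : Fin t) → A (lookup v (inject₁ m)) (lookup v (suc m))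

    pathWeightTo : ∀ {t} → Fin n → Vec (Fin n) (suc t) → ℚ
    pathWeightTo j v = if does (last v Fin.≟ j) then pathWeight v else 0ℚ

    walksFrom : ℕ → Fin n → Fin n → ℚ
    walksFrom t j v = ∑-tuples t λ vs → pathWeightTo j (v ∷ vs)

    ∑-tuples-cong : ∀ t {f g : Vec (Fin n) t → ℚ} → (∀ v → f v ≡ g v) → ∑-tuples t f ≡ ∑-tuples t g
    ∑-tuples-cong zero    f≗g = f≗g []
    ∑-tuples-cong (suc t) f≗g = ∑-cong λ v → ∑-tuples-cong t λ vs → f≗g (v ∷ vs)

    *-distribˡ-∑-tuples : ∀ t a (f : Vec (Fin n) t → ℚ) → a * ∑-tuples t f ≡ ∑-tuples t λ v → a * f v
    *-distribˡ-∑-tuples zero    a f = refl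
    *-distribˡ-∑-tuples (suc t) a f = trans (*-distribˡ-∑ a (λ v → ∑-tuples t λ vs → f (v ∷ vs)))
      (∑-cong λ v → *-distribˡ-∑-tuples t a λ vs → f (v ∷ vs))

    if-∧ : ∀ b c x → (if b ∧ c then x else 0ℚ) ≡ (if b then 1ℚ else 0ℚ) * (if c then x else 0ℚ)
    if-∧ true  c x = sym (ℚ.*-identityˡ (if c then x else 0ℚ))
    if-∧ false c x = sym (ℚ.*-zeroˡ (if c then x else 0ℚ))

    if-* : ∀ b a x → (if b then a * x else 0ℚ) ≡ a * (if b then x else 0ℚ)
    if-* true  a x = refl
    if-* false a x = sym (ℚ.*-zeroʳ a)

    -- The condition on the head turns the outermost sum into a sum against a column of `I`, which
    -- selects `i`; the condition on the last vertex stays inside the walk weight.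
    ψ-walksFrom : ∀ t i j → ψ t A i j ≡ walksFrom t j i
    ψ-walksFrom t i j = begin
      ψ t A i j                             ≡⟨ ∑-cong (λ v → ∑-tuples-cong t λ vs → if-∧ (does (v Fin.≟ i)) (does (last (v ∷ vs) Fin.≟ j)) (pathWeight (v ∷ vs))) ⟩
      ∑ (λ v → ∑-tuples t λ vs → I v i * pathWeightTo j (v ∷ vs))
                                            ≡⟨ ∑-cong (λ v → *-distribˡ-∑-tuples t (I v i) λ vs → pathWeightTo j (v ∷ vs)) ⟨
      ∑ (λ v → I v i * walksFrom t j v)     ≡⟨ basis-∙ i (walksFrom t j) ⟩
      walksFrom t j i                       ∎
      where open ≡-Reasoning

    -- Peeling off the first edge: the factor `A i u` does not depend on the later vertices and
    -- leaves the sum over them. At length zero the condition on the last vertex is the entry of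
    -- `basis j`.
    walksFrom-power : ∀ t j i → walksFrom t j i ≡ power A t (basis j) i
    walksFrom-power zero    j i = refl
    walksFrom-power (suc t) j i = ∑-cong λ u → begin
      ∑-tuples t (λ vs → pathWeightTo j (i ∷ u ∷ vs))
        ≡⟨ ∑-tuples-cong t (λ vs → if-* (does (last (u ∷ vs) Fin.≟ j)) (A i u) (pathWeight (u ∷ vs))) ⟩
      ∑-tuples t (λ vs → A i u * pathWeightTo j (u ∷ vs))
        ≡⟨ *-distribˡ-∑-tuples t (A i u) (λ vs → pathWeightTo j (u ∷ vs)) ⟨
      A i u * walksFrom t j u
        ≡⟨ cong (A i u *_) (walksFrom-power t j u) ⟩
      A i u * power A t (basis j) u ∎
      where open ≡-Reasoning

  ψ-power : ∀ t i j → ψ t A i j ≡ power A t (basis j) i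
  ψ-power t i j = trans (ψ-walksFrom t i j) (walksFrom-power t j i)

  ψ-∙ : ∀ t i j → ψ t A i j ≡ basis i ∙ power A t (basis j)
  ψ-∙ t i j = trans (ψ-power t i j) (sym (basis-∙ i (power A t (basis j))))

-- Moments

-- Rearranged, the polynomial m (s + 2) - 2 c m (s + 1) + c² m s is nonnegative for every c; its
-- discriminant gives the usual m (s + 1)² ≤ m s * m (s + 2). In this form the condition is linear
-- in `m`, hence preserved by sums, and free of division.
LogConvex : (ℕ → ℚ) → Set
LogConvex m = ∀ c s → c * (m (suc s) - c * m s) ≤ m (suc (suc s)) - c * m (suc s)

∑-logConvex : ∀ {d} {m : Fin d → ℕ → ℚ} → (∀ i → LogConvex (m i)) → LogConvex λ s → ∑ λ i → m i s
∑-logConvex {m = m} m-lc c s = begin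
  c * (∑ (λ i → m i (suc s)) - c * ∑ λ i → m i s)           ≡⟨ cong (c *_) (difference s) ⟩
  c * ∑ (λ i → m i (suc s) - c * m i s)                     ≡⟨ *-distribˡ-∑ c (λ i → m i (suc s) - c * m i s) ⟩
  ∑ (λ i → c * (m i (suc s) - c * m i s))                   ≤⟨ ∑-mono (λ i → m-lc i c s) ⟩
  ∑ (λ i → m i (suc (suc s)) - c * m i (suc s))             ≡⟨ difference (suc s) ⟨
  ∑ (λ i → m i (suc (suc s))) - c * ∑ (λ i → m i (suc s))   ∎
  where
  open ℚ.≤-Reasoning
  difference : ∀ s → ∑ (λ i → m i (suc s)) - c * ∑ (λ i → m i s) ≡ ∑ (λ i → m i (suc s) - c * m i s)
  difference s = sym (trans (∑-distrib-+ (λ i → m i (suc s)) (λ i → - (c * m i s)))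
    (cong (λ a → ∑ (λ i → m i (suc s)) + a)
      (trans (∑-neg (λ i → c * m i s)) (cong -_ (sym (*-distribˡ-∑ c (λ i → m i s)))))))

module _ {m : ℕ → ℚ} (m-lc : LogConvex m) where

  -- The defect m (s + 1) - c * m s is multiplied by at least c at each step, so it stays
  -- nonnegative once it is so at 0.
  logConvex-growth : ∀ {c} → 0ℚ ≤ c → c * m 0 ≤ m 1 → ∀ s → c ^ s * m 0 ≤ m s
  logConvex-growth {c} 0≤c cm₀≤m₁ = go
    where
    step : ∀ s → 0ℚ ≤ m (suc s) - c * m s
    step zero    = ≤⇒0≤- cm₀≤m₁
    step (suc s) = ℚ.≤-trans (0≤* 0≤c (step s)) (m-lc c s)
    lemma : ∀ a b → a ≡ b + (a - b)
    lemma = solve-∀ ℚ-ring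
    go : ∀ s → c ^ s * m 0 ≤ m s
    go zero    = ℚ.≤-reflexive (ℚ.*-identityˡ (m 0))
    go (suc s) = ℚ.≤-trans (ℚ.≤-reflexive (ℚ.*-assoc c (c ^ s) (m 0)))
      (ℚ.≤-trans (*-monoˡ-≤ 0≤c (go s)) (≤-by _ (step s) (lemma (m (suc s)) (c * m s))))

  -- Ratios of consecutive terms increase with s, so a bound on the last ratio bounds all earlier
  -- ones; the induction therefore descends from s.
  logConvex-decay : ∀ {c} → 0ℚ < c → ∀ s → m (suc s) ≤ c * m s → m s ≤ c ^ s * m 0
  logConvex-decay {c} 0<c zero    _ = ℚ.≤-reflexive (sym (ℚ.*-identityˡ (m 0)))
  logConvex-decay {c} 0<c (suc s) m₂≤cm₁ = ℚ.≤-trans m₁≤cm₀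
    (ℚ.≤-trans (*-monoˡ-≤ (ℚ.<⇒≤ 0<c) (logConvex-decay 0<c s m₁≤cm₀))
      (ℚ.≤-reflexive (sym (ℚ.*-assoc c (c ^ s) (m 0)))))
    where
    lemma : ∀ a b → a ≡ b + (a - b)
    lemma = solve-∀ ℚ-ring
    m₁≤cm₀ : m (suc s) ≤ c * m s
    m₁≤cm₀ = *-cancelˡ-≤ 0<c (≤-by ((c * (c * m s - m (suc s)) - (c * m (suc s) - m (suc (suc s)))) + (c * m (suc s) - m (suc (suc s))))
      (0≤+ (ℚ.≤-trans (≤⇒0≤- (m-lc c s)) (ℚ.≤-reflexive (lemma₂ c (m s) (m (suc s)) (m (suc (suc s))))))
           (≤⇒0≤- m₂≤cm₁)) (lemma₃ c (m s) (m (suc s)) (m (suc (suc s)))))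
      where
      lemma₂ : ∀ c x y z → z - c * y - c * (y - c * x) ≡ c * (c * x - y) - (c * y - z)
      lemma₂ = solve-∀ ℚ-ring
      lemma₃ : ∀ c x y z → c * (c * x) ≡ c * y + ((c * (c * x - y) - (c * y - z)) + (c * y - z))
      lemma₃ = solve-∀ ℚ-ring

moment : ∀ {n} → Matrix n → (Fin n → ℚ) → ℕ → ℚ
moment A x s = x ∙ power A s x

module _ {n} {A : Matrix n} (A-sym : Symmetric A) (A-psd : PositiveSemidefinite A) where

  -- Symmetry moves one factor `A` to the left, so the moment of order s + 2 at `x` is the one of
  -- order s at `A · x`. Order 0 is a squared norm and order 1 the hypothesis.
  0≤moment : ∀ s x → 0ℚ ≤ moment A x s
  0≤moment zero          x = ∙-self-nonneg x
  0≤moment (suc zero)    x = A-psd x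
  0≤moment (suc (suc s)) x = subst (0ℚ ≤_) eq (0≤moment s (A · x))
    where
    eq : (A · x) ∙ power A s (A · x) ≡ x ∙ (A · A · power A s x)
    eq = trans (·-symmetric A-sym x (power A s (A · x)))
      (∙-congʳ x λ i → ∙-congʳ (A i) (power-·-comm A s x))

  -- The quadratic polynomial in c that has to be nonnegative is itself a moment: the one of order s
  -- at the vector A x - c x.
  moment-logConvex : ∀ x → LogConvex (moment A x)
  moment-logConvex x c s = ≤-by _ (0≤moment s y) (trans (lemma c (moment A x s) m₁ m₂) (cong (c * (m₁ - c * moment A x s) +_) (sym expand)))
    where
    open ≡-Reasoning
    y : Fin n → ℚ
    y i = (A · x) i - c * x i
    m₁ m₂ : ℚ
    m₁ = moment A x (suc s)
    m₂ = moment A x (suc (suc s))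
    lemma : ∀ c a b d → d - c * b ≡ c * (b - c * a) + ((d - c * b) - c * (b - c * a))
    lemma = solve-∀ ℚ-ring
    A∙P : (A · x) ∙ power A s x ≡ m₁
    A∙P = ·-symmetric A-sym x (power A s x)
    A∙PA : (A · x) ∙ power A s (A · x) ≡ m₂
    A∙PA = trans (·-symmetric A-sym x (power A s (A · x)))
      (∙-congʳ x λ i → ∙-congʳ (A i) (power-·-comm A s x))
    expand : moment A y s ≡ (m₂ - c * m₁) - c * (m₁ - c * moment A x s)
    expand = begin
      y ∙ power A s y
        ≡⟨ ∙-congʳ y (power-linear A s (A · x) c x) ⟩
      y ∙ (λ i → power A s (A · x) i - c * power A s x i)
        ≡⟨ ∙-linearʳ y (power A s (A · x)) c (power A s x) ⟩
      y ∙ power A s (A · x) - c * y ∙ power A s x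
        ≡⟨ cong₂ (λ a b → a - c * b) (∙-linearˡ (power A s (A · x)) (A · x) c x) (∙-linearˡ (power A s x) (A · x) c x) ⟩
      ((A · x) ∙ power A s (A · x) - c * x ∙ power A s (A · x)) - c * ((A · x) ∙ power A s x - c * moment A x s)
        ≡⟨ cong₂ (λ a b → a - c * b) (cong₂ (λ a b → a - c * b) A∙PA (∙-congʳ x (power-·-comm A s x))) (cong (λ a → a - c * moment A x s) A∙P) ⟩
      (m₂ - c * m₁) - c * (m₁ - c * moment A x s) ∎

-- The trace of Aˢ, written as a sum of moments so that log-convexity carries over termwise.
traceMoment : ∀ {n} → Matrix n → ℕ → ℚ
traceMoment A s = ∑ λ i → moment A (basis i) s

traceMoment-0 : ∀ {n} (A : Matrix n) → traceMoment A 0 ≡ fromℕ n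
traceMoment-0 {n} A = trans
  (∑-cong {n} {λ i → moment A (basis i) 0} {λ _ → 1ℚ} λ i → trans (basis-∙ i (basis i)) (I-refl i))
  (trans (∑-const n 1ℚ) (ℚ.*-identityʳ (fromℕ n)))

module _ {n} {A : Matrix n} (A-sym : Symmetric A) (A-psd : PositiveSemidefinite A) where

  traceMoment-logConvex : LogConvex (traceMoment A)
  traceMoment-logConvex = ∑-logConvex λ i → moment-logConvex A-sym A-psd (basis i)

  moment-+ : ∀ x s → moment A x (s ℕ.+ s) ≡ power A s x ∙ power A s x
  moment-+ x s = power-+-∙ A-sym s s x x

  -- Bound by the Frobenius norm of Aˢ: each entry of Aˢ x is the inner product of `x` with a row of
  -- Aˢ, Cauchy-Schwarz applies row by row, and the squared norms of the rows sum to tr A²ˢ.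
  moment≤traceMoment : ∀ s x → moment A x (s ℕ.+ s) ≤ traceMoment A (s ℕ.+ s) * x ∙ x
  moment≤traceMoment s x = begin
    moment A x (s ℕ.+ s)                                        ≡⟨ moment-+ x s ⟩
    power A s x ∙ power A s x                                   ≡⟨ ∑-cong (λ i → cong₂ _*_ (component i) (component i)) ⟩
    ∑ (λ i → (power A s (basis i) ∙ x) * (power A s (basis i) ∙ x))
                                                                ≤⟨ ∑-mono (λ i → cauchy-schwarz (power A s (basis i)) x) ⟩
    ∑ (λ i → (power A s (basis i) ∙ power A s (basis i)) * x ∙ x)  ≡⟨ *-distribʳ-∑ (x ∙ x) (λ i → power A s (basis i) ∙ power A s (basis i)) ⟨
    ∑ (λ i → power A s (basis i) ∙ power A s (basis i)) * x ∙ x ≡⟨ cong (_* x ∙ x) (∑-cong λ i → moment-+ (basis i) s) ⟨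
    traceMoment A (s ℕ.+ s) * x ∙ x                             ∎
    where
    open ℚ.≤-Reasoning
    component : ∀ i → power A s x i ≡ power A s (basis i) ∙ x
    component i = trans (sym (basis-∙ i (power A s x))) (sym (power-symmetric A-sym s (basis i) x))

  -- Power method: log-convexity of the moments replaces the spectral decomposition.
  rayleigh^≤n*ratio^ : ∀ {x r β} s → 0ℚ < x ∙ x → 0ℚ ≤ r → r * x ∙ x ≤ x ∙ (A · x) →
    0ℚ < β → traceMoment A (suc (s ℕ.+ s)) ≤ β * traceMoment A (s ℕ.+ s) →
    r ^ (s ℕ.+ s) ≤ fromℕ n * β ^ (s ℕ.+ s)
  rayleigh^≤n*ratio^ {x} {r} {β} s 0<xx 0≤r rayleigh 0<β ratio = *-cancelʳ-≤ 0<xx (begin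
    r ^ N * x ∙ x                   ≤⟨ logConvex-growth {moment A x} (moment-logConvex A-sym A-psd x) 0≤r rayleigh N ⟩
    moment A x N                    ≤⟨ moment≤traceMoment s x ⟩
    traceMoment A N * x ∙ x         ≤⟨ *-monoʳ-≤ (ℚ.<⇒≤ 0<xx) (logConvex-decay {traceMoment A} traceMoment-logConvex 0<β N ratio) ⟩
    β ^ N * traceMoment A 0 * x ∙ x ≡⟨ cong (_* x ∙ x) (trans (cong (β ^ N *_) (traceMoment-0 A)) (ℚ.*-comm (β ^ N) (fromℕ n))) ⟩
    fromℕ n * β ^ N * x ∙ x         ∎)
    where
    open ℚ.≤-Reasoning
    N : ℕ
    N = s ℕ.+ s

-- The exponential series

module _ where

  private variable
    q x y h : ℚ

  expSum : ℚ → ℕ → ℚ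
  expSum q m = ∑ {m} (expTerm q ∘ toℕ)

  expTerm-suc : ∀ q i → expTerm q (suc i) * fromℕ (suc i) ≡ q * expTerm q i
  expTerm-suc q i = begin
    expTerm q i * (q / fromℕ (suc i)) * fromℕ (suc i)   ≡⟨ ℚ.*-assoc (expTerm q i) (q / fromℕ (suc i)) (fromℕ (suc i)) ⟩
    expTerm q i * (q / fromℕ (suc i) * fromℕ (suc i))   ≡⟨ cong (expTerm q i *_) (/-*-cancel q (0<fromℕ-suc i)) ⟩
    expTerm q i * q                                     ≡⟨ ℚ.*-comm (expTerm q i) q ⟩
    q * expTerm q i                                     ∎
    where open ≡-Reasoning

  0≤expTerm : 0ℚ ≤ q → ∀ i → 0ℚ ≤ expTerm q i
  0≤expTerm 0≤q zero    = 0≤1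
  0≤expTerm 0≤q (suc i) = 0≤* (0≤expTerm 0≤q i) (0≤/ 0≤q (0<fromℕ-suc i))

  expTerm-mono : 0ℚ ≤ x → x ≤ y → ∀ i → expTerm x i ≤ expTerm y i
  expTerm-mono 0≤x x≤y zero = ℚ.≤-refl
  expTerm-mono {x} {y} 0≤x x≤y (suc i) = *-cancelʳ-≤ (0<fromℕ-suc i) (begin
    expTerm x (suc i) * fromℕ (suc i)   ≡⟨ expTerm-suc x i ⟩
    x * expTerm x i                     ≤⟨ *-mono-≤ 0≤x (0≤expTerm (ℚ.≤-trans 0≤x x≤y) i) x≤y (expTerm-mono 0≤x x≤y i) ⟩
    y * expTerm y i                     ≡⟨ expTerm-suc y i ⟨
    expTerm y (suc i) * fromℕ (suc i)   ∎)
    where open ℚ.≤-Reasoning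

  expSum-mono : 0ℚ ≤ x → x ≤ y → ∀ m → expSum x m ≤ expSum y m
  expSum-mono 0≤x x≤y m = ∑-mono {m} λ i → expTerm-mono 0≤x x≤y (toℕ i)

  ∑-suc : ∀ (f : ℕ → ℚ) m → ∑ {suc m} (f ∘ toℕ) ≡ ∑ {m} (f ∘ toℕ) + f m
  ∑-suc f m = trans (∑-init-last {m} (f ∘ toℕ))
    (cong₂ _+_ (∑-cong {m} λ i → cong f (Fin.toℕ-inject₁ i)) (cong f (Fin.toℕ-fromℕ m)))

  expSum≤expSum-suc : 0ℚ ≤ q → ∀ m → expSum q m ≤ expSum q (suc m)
  expSum≤expSum-suc {q} 0≤q m = ≤-by _ (0≤expTerm 0≤q m) (∑-suc (expTerm q) m)

  -- Discrete forms of (d/dx) xⁱ⁺¹/(i+1)! = xⁱ/i! and of exp′ = exp.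
  expTerm-+ : 0ℚ ≤ x → 0ℚ ≤ h → ∀ i →
    expTerm (x + h) (suc i) ≤ expTerm x (suc i) + h * expTerm (x + h) i
  expTerm-+ {x} {h} 0≤x 0≤h i = *-cancelʳ-≤ (0<fromℕ-suc i) (begin
    expTerm (x + h) (suc i) * fromℕ (suc i)           ≡⟨ expTerm-suc (x + h) i ⟩
    (x + h) * T                                       ≡⟨ lemma₁ x h T S ⟩
    x * S + h * T + x * (T - S)                       ≤⟨ ℚ.+-monoʳ-≤ (x * S + h * T) (slope i) ⟩
    x * S + h * T + h * (fromℕ i * T)                 ≡⟨ lemma₂ (x * S) h T (fromℕ i) ⟩
    x * S + h * T * (1ℚ + fromℕ i)                    ≡⟨ cong₂ (λ a b → a + h * T * b) (expTerm-suc x i) (fromℕ-suc i) ⟨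
    expTerm x (suc i) * fromℕ (suc i) + h * T * fromℕ (suc i)
                                                      ≡⟨ ℚ.*-distribʳ-+ (fromℕ (suc i)) (expTerm x (suc i)) (h * T) ⟨
    (expTerm x (suc i) + h * T) * fromℕ (suc i)       ∎)
    where
    open ℚ.≤-Reasoning
    T S : ℚ
    T = expTerm (x + h) i
    S = expTerm x i
    lemma₁ : ∀ x h t s → (x + h) * t ≡ x * s + h * t + x * (t - s)
    lemma₁ = solve-∀ ℚ-ring
    lemma₂ : ∀ a h t i → a + h * t + h * (i * t) ≡ a + h * t * (1ℚ + i)
    lemma₂ = solve-∀ ℚ-ring
    -- A form of x (xⁱ)′ = i xⁱ with a difference in place of the derivative. It is proved jointly
    -- with the surrounding lemma, whose instance at i yields the slope at suc i.
    slope : ∀ i → x * (expTerm (x + h) i - expTerm x i) ≤ h * (fromℕ i * expTerm (x + h) i)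
    slope zero = ℚ.≤-reflexive (lemma₃ x h)
      where
      lemma₃ : ∀ x h → x * (1ℚ - 1ℚ) ≡ h * (0ℚ * 1ℚ)
      lemma₃ = solve-∀ ℚ-ring
    slope (suc i) = begin
      x * (expTerm (x + h) (suc i) - expTerm x (suc i))     ≤⟨ *-monoˡ-≤ 0≤x (ℚ.+-monoˡ-≤ (- expTerm x (suc i)) (expTerm-+ 0≤x 0≤h i)) ⟩
      x * (expTerm x (suc i) + h * expTerm (x + h) i - expTerm x (suc i))
                                                            ≡⟨ lemma₄ x (expTerm x (suc i)) h (expTerm (x + h) i) ⟩
      h * (x * expTerm (x + h) i)                           ≤⟨ *-monoˡ-≤ 0≤h (*-monoʳ-≤ (0≤expTerm (0≤+ 0≤x 0≤h) i) (≤+ x 0≤h)) ⟩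
      h * ((x + h) * expTerm (x + h) i)                     ≡⟨ cong (h *_) (trans (ℚ.*-comm (fromℕ (suc i)) (expTerm (x + h) (suc i))) (expTerm-suc (x + h) i)) ⟨
      h * (fromℕ (suc i) * expTerm (x + h) (suc i))         ∎
      where
      lemma₄ : ∀ x s h t → x * (s + h * t - s) ≡ h * (x * t)
      lemma₄ = solve-∀ ℚ-ring

  -- Summing the termwise estimate leaves h times the sum that is one term shorter; monotonicity in
  -- the length repairs this shift. At x = 0 the limiting statement is 1 - h ≤ exp (- h).
  expSum-+ : 0ℚ ≤ x → 0ℚ ≤ h → ∀ m → expSum (x + h) m * (1ℚ - h) ≤ expSum x m
  expSum-+ {x} {h} 0≤x 0≤h zero    = ℚ.≤-reflexive (ℚ.*-zeroˡ (1ℚ - h))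
  expSum-+ {x} {h} 0≤x 0≤h (suc m) = begin
    S (suc m) * (1ℚ - h)                                ≡⟨ lemma₁ (S (suc m)) h ⟩
    S (suc m) - h * S (suc m)                           ≤⟨ ℚ.+-monoʳ-≤ (S (suc m)) (ℚ.neg-antimono-≤ (*-monoˡ-≤ 0≤h (expSum≤expSum-suc (0≤+ 0≤x 0≤h) m))) ⟩
    S (suc m) - h * S m                                 ≤⟨ ℚ.+-monoˡ-≤ (- (h * S m)) (ℚ.+-monoʳ-≤ 1ℚ (∑-mono {m} λ i → expTerm-+ 0≤x 0≤h (toℕ i))) ⟩
    1ℚ + ∑ {m} (λ i → expTerm x (suc (toℕ i)) + h * expTerm (x + h) (toℕ i)) - h * S m
                                                        ≡⟨ cong (λ z → 1ℚ + z - h * S m) (trans (∑-distrib-+ {m} (λ i → expTerm x (suc (toℕ i))) (λ i → h * expTerm (x + h) (toℕ i)))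
                                                             (cong (∑ {m} (λ i → expTerm x (suc (toℕ i))) +_) (sym (*-distribˡ-∑ {m} h (expTerm (x + h) ∘ toℕ))))) ⟩
    1ℚ + (∑ {m} (λ i → expTerm x (suc (toℕ i))) + h * S m) - h * S m
                                                        ≡⟨ lemma₂ 1ℚ (∑ {m} (λ i → expTerm x (suc (toℕ i)))) (h * S m) ⟩
    expSum x (suc m)                                    ∎
    where
    open ℚ.≤-Reasoning
    S : ℕ → ℚ
    S = expSum (x + h)
    lemma₁ : ∀ s h → s * (1ℚ - h) ≡ s - h * s
    lemma₁ = solve-∀ ℚ-ring
    lemma₂ : ∀ a b c → a + (b + c) - c ≡ a + b
    lemma₂ = solve-∀ ℚ-ring

  expSum-0 : ∀ m → expSum 0ℚ m ≤ 1ℚ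
  expSum-0 zero    = 0≤1
  expSum-0 (suc m) = ℚ.≤-reflexive (trans (cong (λ z → 1ℚ + z) (trans (∑-cong {m} λ i → expTerm-0 (toℕ i)) (∑-0 m))) (ℚ.+-identityʳ 1ℚ))
    where
    expTerm-0 : ∀ i → expTerm 0ℚ (suc i) ≡ 0ℚ
    expTerm-0 i = *-cancelʳ-≡ (0<fromℕ-suc i) (trans (expTerm-suc 0ℚ i)
      (trans (ℚ.*-zeroˡ (expTerm 0ℚ i)) (sym (ℚ.*-zeroˡ (fromℕ (suc i))))))

  -- Stands for (1 - h)ˡ ≤ exp (- l h), with the exponential moved to the other side. Both iteration
  -- bounds are exploited through it.
  expSum-multiple : 0ℚ ≤ h → h ≤ 1ℚ → ∀ l m → expSum (fromℕ l * h) m * (1ℚ - h) ^ l ≤ 1ℚ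
  expSum-multiple {h} 0≤h h≤1 zero m = begin
    expSum (0ℚ * h) m * 1ℚ   ≡⟨ trans (ℚ.*-identityʳ (expSum (0ℚ * h) m)) (cong (λ z → expSum z m) (ℚ.*-zeroˡ h)) ⟩
    expSum 0ℚ m              ≤⟨ expSum-0 m ⟩
    1ℚ                       ∎
    where open ℚ.≤-Reasoning
  expSum-multiple {h} 0≤h h≤1 (suc l) m = begin
    expSum (fromℕ (suc l) * h) m * ((1ℚ - h) * (1ℚ - h) ^ l)
      ≡⟨ cong (λ z → expSum z m * ((1ℚ - h) * (1ℚ - h) ^ l)) (trans (cong (_* h) (fromℕ-suc l)) (lemma (fromℕ l) h)) ⟩
    expSum (fromℕ l * h + h) m * ((1ℚ - h) * (1ℚ - h) ^ l)
      ≡⟨ ℚ.*-assoc (expSum (fromℕ l * h + h) m) (1ℚ - h) ((1ℚ - h) ^ l) ⟨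
    expSum (fromℕ l * h + h) m * (1ℚ - h) * (1ℚ - h) ^ l
      ≤⟨ *-monoʳ-≤ (0≤^ (≤⇒0≤- h≤1) l) (expSum-+ (0≤* (0≤fromℕ l) 0≤h) 0≤h m) ⟩
    expSum (fromℕ l * h) m * (1ℚ - h) ^ l
      ≤⟨ expSum-multiple 0≤h h≤1 l m ⟩
    1ℚ ∎
    where
    open ℚ.≤-Reasoning
    lemma : ∀ l h → (1ℚ + l) * h ≡ l * h + h
    lemma = solve-∀ ℚ-ring

  1+q≤expSum : 0ℚ ≤ q → ∀ m → 1ℚ + q ≤ expSum q (2 ℕ.+ m)
  1+q≤expSum {q} 0≤q m = ≤-by _ (0≤∑ {m} λ i → 0≤expTerm 0≤q (2 ℕ.+ toℕ i))
    (trans (cong (λ z → 1ℚ + (z + rest)) expTerm-1) (sym (ℚ.+-assoc 1ℚ q rest)))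
    where
    rest : ℚ
    rest = ∑ {m} λ i → expTerm q (2 ℕ.+ toℕ i)
    expTerm-1 : expTerm q 1 ≡ q
    expTerm-1 = trans (sym (ℚ.*-identityʳ (expTerm q 1))) (trans (expTerm-suc q 0) (ℚ.*-identityʳ q))

  -- For y ≥ 0 the partial sums of exp (- y) of even length are at most 1.  They are limits, as l
  -- tends to infinity, of partial sums of the binomial expansion of (1 - y / l)ˡ, to which the
  -- Bonferroni inequalities apply.

  -- The term (l choose i) xⁱ of the expansion of (1 + x)ˡ, with Pascal's rule built in.
  binTerm : ℚ → ℕ → ℕ → ℚ
  binTerm x l       zero    = 1ℚ
  binTerm x zero    (suc i) = 0ℚ
  binTerm x (suc l) (suc i) = binTerm x l (suc i) + x * binTerm x l i

  binSum : ℚ → ℕ → ℕ → ℚ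
  binSum x l m = ∑ {m} (binTerm x l ∘ toℕ)

  binSum-suc : ∀ x l m → binSum x (suc l) (suc m) ≡ binSum x l (suc m) + x * binSum x l m
  binSum-suc x l m = trans
    (cong (λ z → 1ℚ + z) (trans (∑-distrib-+ {m} (λ i → binTerm x l (suc (toℕ i))) (λ i → x * binTerm x l (toℕ i)))
      (cong (∑ {m} (λ i → binTerm x l (suc (toℕ i))) +_) (sym (*-distribˡ-∑ {m} x (binTerm x l ∘ toℕ))))))
    (sym (ℚ.+-assoc 1ℚ (∑ {m} λ i → binTerm x l (suc (toℕ i))) (x * binSum x l m)))

  -- The recurrence in i that parallels `expTerm-suc`, so that binomial and exponential terms can be
  -- compared one by one.
  binTerm-suc : ∀ x l i → binTerm x l (suc i) * fromℕ (suc i) ≡ (fromℕ l - fromℕ i) * x * binTerm x l i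
  binTerm-suc x zero zero = lemma x
    where
    lemma : ∀ x → 0ℚ * 1ℚ ≡ (0ℚ - 0ℚ) * x * 1ℚ
    lemma = solve-∀ ℚ-ring
  binTerm-suc x zero (suc i) = lemma x (fromℕ (suc i)) (fromℕ (suc (suc i)))
    where
    lemma : ∀ x i j → 0ℚ * j ≡ (0ℚ - i) * x * 0ℚ
    lemma = solve-∀ ℚ-ring
  binTerm-suc x (suc l) zero = begin
    (binTerm x l 1 + x * 1ℚ) * 1ℚ      ≡⟨ lemma₁ (binTerm x l 1) x ⟩
    binTerm x l 1 * 1ℚ + x             ≡⟨ cong (_+ x) (binTerm-suc x l 0) ⟩
    (fromℕ l - 0ℚ) * x * 1ℚ + x        ≡⟨ lemma₂ (fromℕ l) x ⟩
    (1ℚ + fromℕ l - 0ℚ) * x * 1ℚ       ≡⟨ cong (λ z → (z - 0ℚ) * x * 1ℚ) (fromℕ-suc l) ⟨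
    (fromℕ (suc l) - 0ℚ) * x * 1ℚ      ∎
    where
    open ≡-Reasoning
    lemma₁ : ∀ b x → (b + x * 1ℚ) * 1ℚ ≡ b * 1ℚ + x
    lemma₁ = solve-∀ ℚ-ring
    lemma₂ : ∀ l x → (l - 0ℚ) * x * 1ℚ + x ≡ (1ℚ + l - 0ℚ) * x * 1ℚ
    lemma₂ = solve-∀ ℚ-ring
  binTerm-suc x (suc l) (suc i) = begin
    (b₂ + x * b₁) * fromℕ (2 ℕ.+ i)
      ≡⟨ lemma₁ b₂ x b₁ (fromℕ (2 ℕ.+ i)) ⟩
    b₂ * fromℕ (2 ℕ.+ i) + x * b₁ * fromℕ (2 ℕ.+ i)
      ≡⟨ cong₂ (λ y z → y + x * b₁ * z) (binTerm-suc x l (suc i)) (fromℕ-suc (suc i)) ⟩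
    (fromℕ l - fromℕ (suc i)) * x * b₁ + x * b₁ * (1ℚ + fromℕ (suc i))
      ≡⟨ lemma₂ (fromℕ l) (fromℕ (suc i)) x b₁ ⟩
    (fromℕ l - fromℕ (suc i)) * x * b₁ + x * (b₁ * fromℕ (suc i)) + x * b₁
      ≡⟨ cong (λ z → (fromℕ l - fromℕ (suc i)) * x * b₁ + x * z + x * b₁) (binTerm-suc x l i) ⟩
    (fromℕ l - fromℕ (suc i)) * x * b₁ + x * ((fromℕ l - fromℕ i) * x * b₀) + x * b₁
      ≡⟨ cong (λ z → (fromℕ l - z) * x * b₁ + x * ((fromℕ l - fromℕ i) * x * b₀) + x * b₁) (fromℕ-suc i) ⟩
    (fromℕ l - (1ℚ + fromℕ i)) * x * b₁ + x * ((fromℕ l - fromℕ i) * x * b₀) + x * b₁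
      ≡⟨ lemma₃ (fromℕ l) (fromℕ i) x b₁ b₀ ⟩
    (1ℚ + fromℕ l - (1ℚ + fromℕ i)) * x * (b₁ + x * b₀)
      ≡⟨ cong₂ (λ y z → (y - z) * x * (b₁ + x * b₀)) (fromℕ-suc l) (fromℕ-suc i) ⟨
    (fromℕ (suc l) - fromℕ (suc i)) * x * (b₁ + x * b₀) ∎
    where
    open ≡-Reasoning
    b₂ b₁ b₀ : ℚ
    b₂ = binTerm x l (suc (suc i))
    b₁ = binTerm x l (suc i)
    b₀ = binTerm x l i
    lemma₁ : ∀ a x b c → (a + x * b) * c ≡ a * c + x * b * c
    lemma₁ = solve-∀ ℚ-ring
    lemma₂ : ∀ l i x b → (l - i) * x * b + x * b * (1ℚ + i) ≡ (l - i) * x * b + x * (b * i) + x * b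
    lemma₂ = solve-∀ ℚ-ring
    lemma₃ : ∀ l i x b c → (l - (1ℚ + i)) * x * b + x * ((l - i) * x * c) + x * b
           ≡ (1ℚ + l - (1ℚ + i)) * x * (b + x * c)
    lemma₃ = solve-∀ ℚ-ring

  module _ (0≤h : 0ℚ ≤ h) (h≤1 : h ≤ 1ℚ) where

    private
      complement : ∀ a h → a + - h * a ≡ (1ℚ - h) * a
      complement = solve-∀ ℚ-ring

      0≤1-h : 0ℚ ≤ 1ℚ - h
      0≤1-h = ≤⇒0≤- h≤1

      binSum-0 : ∀ m → binSum (- h) 0 (suc m) ≡ 1ℚ
      binSum-0 m = trans (cong (λ z → 1ℚ + z) (∑-0 m)) (ℚ.+-identityʳ 1ℚ)

    -- Joint induction on l with `binSum-odd`: Pascal's rule writes the truncated sum for l + 1 as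
    -- one for l of the same length minus h times one that is a term shorter. The shorter one has
    -- the other parity, and the factor - h reverses its inequality.
    binSum-even : ∀ l m → binSum (- h) l (m ℕ.+ m) ≤ (1ℚ - h) ^ l
    binSum-odd : ∀ l m → (1ℚ - h) ^ l ≤ binSum (- h) l (suc (m ℕ.+ m))

    binSum-even l       zero    = 0≤^ 0≤1-h l
    binSum-even zero    (suc m) = ℚ.≤-reflexive (binSum-0 (m ℕ.+ suc m))
    binSum-even (suc l) (suc m) = begin
      binSum (- h) (suc l) (suc (m ℕ.+ suc m))
        ≡⟨ binSum-suc (- h) l (m ℕ.+ suc m) ⟩
      binSum (- h) l (suc (m ℕ.+ suc m)) + - h * binSum (- h) l (m ℕ.+ suc m)
        ≡⟨ cong (λ z → binSum (- h) l (suc (m ℕ.+ suc m)) + - h * binSum (- h) l z) (ℕ.+-suc m m) ⟩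
      binSum (- h) l (suc (m ℕ.+ suc m)) + - h * binSum (- h) l (suc (m ℕ.+ m))
        ≤⟨ ℚ.+-mono-≤ (binSum-even l (suc m)) (≤-by _ (0≤* 0≤h (≤⇒0≤- (binSum-odd l m))) (lemma h (binSum (- h) l (suc (m ℕ.+ m))) ((1ℚ - h) ^ l))) ⟩
      (1ℚ - h) ^ l + - h * (1ℚ - h) ^ l
        ≡⟨ complement ((1ℚ - h) ^ l) h ⟩
      (1ℚ - h) * (1ℚ - h) ^ l ∎
      where
      open ℚ.≤-Reasoning
      lemma : ∀ h a b → - h * b ≡ - h * a + h * (a - b)
      lemma = solve-∀ ℚ-ring

    binSum-odd zero    m = ℚ.≤-reflexive (sym (binSum-0 (m ℕ.+ m)))
    binSum-odd (suc l) m = begin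
      (1ℚ - h) * (1ℚ - h) ^ l
        ≡⟨ complement ((1ℚ - h) ^ l) h ⟨
      (1ℚ - h) ^ l + - h * (1ℚ - h) ^ l
        ≤⟨ ℚ.+-mono-≤ (binSum-odd l m) (≤-by _ (0≤* 0≤h (≤⇒0≤- (binSum-even l m))) (lemma h ((1ℚ - h) ^ l) (binSum (- h) l (m ℕ.+ m)))) ⟩
      binSum (- h) l (suc (m ℕ.+ m)) + - h * binSum (- h) l (m ℕ.+ m)
        ≡⟨ binSum-suc (- h) l (m ℕ.+ m) ⟨
      binSum (- h) (suc l) (suc (m ℕ.+ m)) ∎
      where
      open ℚ.≤-Reasoning
      lemma : ∀ h a b → - h * b ≡ - h * a + h * (a - b)
      lemma = solve-∀ ℚ-ring

  0≤∣∣ : ∀ q → 0ℚ ≤ ℚ.∣ q ∣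
  0≤∣∣ = ℚ.0≤∣p∣

  ≤∣∣ : ∀ q → q ≤ ℚ.∣ q ∣
  ≤∣∣ q with ℚ.≤-total 0ℚ q
  ... | inj₁ 0≤q = ℚ.≤-reflexive (sym (ℚ.0≤p⇒∣p∣≡p 0≤q))
  ... | inj₂ q≤0 = ℚ.≤-trans q≤0 (0≤∣∣ q)

  module _ (0≤y : 0ℚ ≤ y) where

    private
      -- `binBound` dominates the binomial terms in absolute value, and h * `errorBound` their
      -- distance from the exponential terms. Both are independent of h and l, so the error vanishes
      -- as h = y / l tends to 0.
      binBound : ℕ → ℚ
      binBound zero    = 1ℚ
      binBound (suc i) = (y + fromℕ i) * binBound i

      errorBound : ℕ → ℚ
      errorBound zero    = 0ℚ
      errorBound (suc i) = y * errorBound i + fromℕ i * binBound i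

      0≤binBound : ∀ i → 0ℚ ≤ binBound i
      0≤binBound zero    = 0≤1
      0≤binBound (suc i) = 0≤* (0≤+ 0≤y (0≤fromℕ i)) (0≤binBound i)

      -- The recurrences give i + 1 times the next term; dropping that factor only loses precision
      -- and spares a division.
      ∣∣≤∣*suc∣ : ∀ a i → ℚ.∣ a ∣ ≤ ℚ.∣ a * fromℕ (suc i) ∣
      ∣∣≤∣*suc∣ a i = begin
        ℚ.∣ a ∣                        ≡⟨ ℚ.*-identityʳ ℚ.∣ a ∣ ⟨
        ℚ.∣ a ∣ * 1ℚ                   ≤⟨ *-monoˡ-≤ (0≤∣∣ a) (≤-by (fromℕ i) (0≤fromℕ i) (fromℕ-suc i)) ⟩
        ℚ.∣ a ∣ * fromℕ (suc i)        ≡⟨ cong (ℚ.∣ a ∣ *_) (ℚ.0≤p⇒∣p∣≡p (0≤fromℕ (suc i))) ⟨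
        ℚ.∣ a ∣ * ℚ.∣ fromℕ (suc i) ∣  ≡⟨ ℚ.∣p*q∣≡∣p∣*∣q∣ a (fromℕ (suc i)) ⟨
        ℚ.∣ a * fromℕ (suc i) ∣        ∎
        where open ℚ.≤-Reasoning

    module _ (0≤h : 0ℚ ≤ h) (h≤1 : h ≤ 1ℚ) (l : ℕ) (lh≡y : fromℕ l * h ≡ y) where

      private
        b : ℕ → ℚ
        b = binTerm (- h) l

        t : ℕ → ℚ
        t = expTerm (- y)

        ∣b∣≤ : ∀ i → ℚ.∣ b i ∣ ≤ binBound i
        ∣b∣≤ zero    = ℚ.≤-refl
        ∣b∣≤ (suc i) = begin
          ℚ.∣ b (suc i) ∣                              ≤⟨ ∣∣≤∣*suc∣ (b (suc i)) i ⟩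
          ℚ.∣ b (suc i) * fromℕ (suc i) ∣              ≡⟨ cong ℚ.∣_∣ (trans (binTerm-suc (- h) l i) (lemma (fromℕ l) (fromℕ i) h (b i))) ⟩
          ℚ.∣ (fromℕ i * h - fromℕ l * h) * b i ∣      ≡⟨ ℚ.∣p*q∣≡∣p∣*∣q∣ (fromℕ i * h - fromℕ l * h) (b i) ⟩
          ℚ.∣ fromℕ i * h - fromℕ l * h ∣ * ℚ.∣ b i ∣  ≤⟨ *-mono-≤ (0≤∣∣ (fromℕ i * h - fromℕ l * h)) (0≤binBound i) coefficient (∣b∣≤ i) ⟩
          (y + fromℕ i) * binBound i                   ∎
          where
          open ℚ.≤-Reasoning
          lemma : ∀ l i h b → (l - i) * - h * b ≡ (i * h - l * h) * b
          lemma = solve-∀ ℚ-ring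
          coefficient : ℚ.∣ fromℕ i * h - fromℕ l * h ∣ ≤ y + fromℕ i
          coefficient = begin
            ℚ.∣ fromℕ i * h - fromℕ l * h ∣            ≤⟨ ℚ.∣p-q∣≤∣p∣+∣q∣ (fromℕ i * h) (fromℕ l * h) ⟩
            ℚ.∣ fromℕ i * h ∣ + ℚ.∣ fromℕ l * h ∣      ≡⟨ cong₂ _+_ (ℚ.0≤p⇒∣p∣≡p (0≤* (0≤fromℕ i) 0≤h)) (trans (cong ℚ.∣_∣ lh≡y) (ℚ.0≤p⇒∣p∣≡p 0≤y)) ⟩
            fromℕ i * h + y                            ≤⟨ ℚ.+-monoˡ-≤ y (*-monoˡ-≤ (0≤fromℕ i) h≤1) ⟩
            fromℕ i * 1ℚ + y                           ≡⟨ trans (cong (_+ y) (ℚ.*-identityʳ (fromℕ i))) (ℚ.+-comm (fromℕ i) y) ⟩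
            y + fromℕ i                                ∎

        ∣t-b∣≤ : ∀ i → ℚ.∣ t i - b i ∣ ≤ h * errorBound i
        ∣t-b∣≤ zero    = ℚ.≤-reflexive (sym (ℚ.*-zeroʳ h))
        ∣t-b∣≤ (suc i) = begin
          ℚ.∣ t (suc i) - b (suc i) ∣
            ≤⟨ ∣∣≤∣*suc∣ (t (suc i) - b (suc i)) i ⟩
          ℚ.∣ (t (suc i) - b (suc i)) * fromℕ (suc i) ∣
            ≡⟨ cong ℚ.∣_∣ recurrence ⟩
          ℚ.∣ fromℕ i * - h * b i - y * (t i - b i) ∣
            ≤⟨ ℚ.∣p-q∣≤∣p∣+∣q∣ (fromℕ i * - h * b i) (y * (t i - b i)) ⟩
          ℚ.∣ fromℕ i * - h * b i ∣ + ℚ.∣ y * (t i - b i) ∣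
            ≡⟨ cong₂ _+_ (trans (ℚ.∣p*q∣≡∣p∣*∣q∣ (fromℕ i * - h) (b i)) (cong (_* ℚ.∣ b i ∣) ∣-ih∣))
                         (trans (ℚ.∣p*q∣≡∣p∣*∣q∣ y (t i - b i)) (cong (_* ℚ.∣ t i - b i ∣) (ℚ.0≤p⇒∣p∣≡p 0≤y))) ⟩
          fromℕ i * h * ℚ.∣ b i ∣ + y * ℚ.∣ t i - b i ∣
            ≤⟨ ℚ.+-mono-≤ (*-monoˡ-≤ (0≤* (0≤fromℕ i) 0≤h) (∣b∣≤ i)) (*-monoˡ-≤ 0≤y (∣t-b∣≤ i)) ⟩
          fromℕ i * h * binBound i + y * (h * errorBound i)
            ≡⟨ lemma₂ (fromℕ i) h (binBound i) y (errorBound i) ⟩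
          h * (y * errorBound i + fromℕ i * binBound i) ∎
          where
          open ℚ.≤-Reasoning
          lemma₁ : ∀ l i h t b → - (l * h) * t - (l - i) * - h * b ≡ i * - h * b - l * h * (t - b)
          lemma₁ = solve-∀ ℚ-ring
          lemma₂ : ∀ i h b y e → i * h * b + y * (h * e) ≡ h * (y * e + i * b)
          lemma₂ = solve-∀ ℚ-ring
          lemma₃ : ∀ a b c → (a - b) * c ≡ a * c - b * c
          lemma₃ = solve-∀ ℚ-ring
          recurrence : (t (suc i) - b (suc i)) * fromℕ (suc i) ≡ fromℕ i * - h * b i - y * (t i - b i)
          recurrence = trans (lemma₃ (t (suc i)) (b (suc i)) (fromℕ (suc i)))
            (trans (cong₂ _-_ (expTerm-suc (- y) i) (binTerm-suc (- h) l i))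
              (subst (λ y → - y * t i - (fromℕ l - fromℕ i) * - h * b i ≡ fromℕ i * - h * b i - y * (t i - b i))
                lh≡y (lemma₁ (fromℕ l) (fromℕ i) h (t i) (b i))))
          ∣-ih∣ : ℚ.∣ fromℕ i * - h ∣ ≡ fromℕ i * h
          ∣-ih∣ = trans (cong ℚ.∣_∣ (sym (ℚ.neg-distribʳ-* (fromℕ i) h)))
            (trans (ℚ.∣-p∣≡∣p∣ (fromℕ i * h)) (ℚ.0≤p⇒∣p∣≡p (0≤* (0≤fromℕ i) 0≤h)))

      expSum≤binSum : ∀ m → expSum (- y) m ≤ binSum (- h) l m + h * ∑ {m} (errorBound ∘ toℕ)
      expSum≤binSum m = begin
        expSum (- y) m                                        ≤⟨ ∑-mono {m} (λ i → term (toℕ i)) ⟩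
        ∑ {m} (λ i → b (toℕ i) + h * errorBound (toℕ i))      ≡⟨ ∑-distrib-+ {m} (b ∘ toℕ) (λ i → h * errorBound (toℕ i)) ⟩
        binSum (- h) l m + ∑ {m} (λ i → h * errorBound (toℕ i)) ≡⟨ cong (binSum (- h) l m +_) (*-distribˡ-∑ {m} h (errorBound ∘ toℕ)) ⟨
        binSum (- h) l m + h * ∑ {m} (errorBound ∘ toℕ)       ∎
        where
        open ℚ.≤-Reasoning
        lemma : ∀ t b → t ≡ b + (t - b)
        lemma = solve-∀ ℚ-ring
        term : ∀ i → t i ≤ b i + h * errorBound i
        term i = ℚ.≤-trans (ℚ.≤-reflexive (lemma (t i) (b i)))
          (ℚ.+-monoʳ-≤ (b i) (ℚ.≤-trans (≤∣∣ (t i - b i)) (∣t-b∣≤ i)))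

    expSum-neg-even : ∀ m → expSum (- y) (m ℕ.+ m) ≤ 1ℚ
    expSum-neg-even m = ℚ.≮⇒≥ λ 1<e → absurd 1<e
      where
      e K : ℚ
      e = expSum (- y) (m ℕ.+ m)
      K = ∑ {m ℕ.+ m} (errorBound ∘ toℕ)
      absurd : 1ℚ < e → ⊥
      absurd 1<e = ℚ.<-irrefl refl (begin-strict
        y * K                       <⟨ small ⟩
        fromℕ l * (e - 1ℚ)          ≤⟨ *-monoˡ-≤ (0≤fromℕ l) (ℚ.+-monoˡ-≤ (- 1ℚ) bound) ⟩
        fromℕ l * (1ℚ + η * K - 1ℚ) ≡⟨ lemma₁ (fromℕ l) η K ⟩
        fromℕ l * η * K             ≡⟨ cong (_* K) lη≡y ⟩
        y * K                       ∎)
        where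
        open ℚ.≤-Reasoning
        0<δ : 0ℚ < e - 1ℚ
        0<δ = <⇒0<- 1<e
        -- `l` exceeds y, so that η = y / l is at most 1, and it exceeds y K / (e - 1), so that the
        -- error η K is smaller than e - 1. The successor keeps it positive.
        l₁ l₂ l : ℕ
        l₁ = proj₁ (archimedean y)
        l₂ = proj₁ (archimedean (y * K / (e - 1ℚ)))
        l  = suc (l₁ ℕ.+ l₂)
        l₁≤l : l₁ ℕ.≤ l
        l₁≤l = ℕ.m≤n⇒m≤1+n (ℕ.m≤m+n l₁ l₂)
        l₂≤l : l₂ ℕ.≤ l
        l₂≤l = ℕ.m≤n⇒m≤1+n (ℕ.m≤n+m l₂ l₁)
        small : y * K < fromℕ l * (e - 1ℚ)
        small = begin-strict
          y * K                             ≡⟨ /-*-cancel (y * K) 0<δ ⟨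
          y * K / (e - 1ℚ) * (e - 1ℚ)       <⟨ *-monoʳ-< 0<δ (ℚ.<-≤-trans (proj₂ (archimedean (y * K / (e - 1ℚ)))) (fromℕ-mono-≤ l₂≤l)) ⟩
          fromℕ l * (e - 1ℚ)                ∎
        η : ℚ
        η = y / fromℕ l
        lη≡y : fromℕ l * η ≡ y
        lη≡y = trans (ℚ.*-comm (fromℕ l) η) (/-*-cancel y (0<fromℕ-suc (l₁ ℕ.+ l₂)))
        0≤η : 0ℚ ≤ η
        0≤η = 0≤/ 0≤y (0<fromℕ-suc (l₁ ℕ.+ l₂))
        η≤1 : η ≤ 1ℚ
        η≤1 = *-cancelˡ-≤ (0<fromℕ-suc (l₁ ℕ.+ l₂)) (begin
          fromℕ l * η    ≡⟨ lη≡y ⟩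
          y              ≤⟨ ℚ.<⇒≤ (ℚ.<-≤-trans (proj₂ (archimedean y)) (fromℕ-mono-≤ l₁≤l)) ⟩
          fromℕ l        ≡⟨ ℚ.*-identityʳ (fromℕ l) ⟨
          fromℕ l * 1ℚ   ∎)
        bound : e ≤ 1ℚ + η * K
        bound = ℚ.≤-trans (expSum≤binSum 0≤η η≤1 l lη≡y (m ℕ.+ m))
          (ℚ.+-monoˡ-≤ (η * K) (ℚ.≤-trans (binSum-even 0≤η η≤1 l m) (^≤1 l)))
          where
          ^≤1 : ∀ l → (1ℚ - η) ^ l ≤ 1ℚ
          ^≤1 l = ℚ.≤-trans (^-monoˡ-≤ (≤⇒0≤- η≤1) (≤-by η 0≤η (lemma₂ η)) l) (ℚ.≤-reflexive (1^ l))
            where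
            lemma₂ : ∀ η → 1ℚ ≡ 1ℚ - η + η
            lemma₂ = solve-∀ ℚ-ring
        lemma₁ : ∀ l η k → l * (1ℚ + η * k - 1ℚ) ≡ l * η * k
        lemma₁ = solve-∀ ℚ-ring

  <ᴿexp⇒<expSum : upper (ln (ι q)) x → ∃[ N ] (∀ m → N ℕ.≤ m → q < expSum x m)
  <ᴿexp⇒<expSum (r , q<r , r′ , r<r′ , N , r′≤expSum) =
    N , λ m N≤m → ℚ.<-≤-trans (ℚ.<-trans q<r r<r′) (r′≤expSum m N≤m)

  -- For x ≤ 0 the partial sums of even length are at most 1 ≤ q, whereas all sufficiently long ones
  -- would have to exceed q; N + N is an even length beyond N. The sign is needed to evaluate
  -- interval products with ln L at their upper endpoints.
  ln-upper-positive : 1ℚ ≤ q → upper (ln (ι q)) x → 0ℚ < x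
  ln-upper-positive {q} {x} 1≤q x∈ = ℚ.≰⇒> λ x≤0 →
    let N , q<expSum = <ᴿexp⇒<expSum {q} {x} x∈
        0≤-x : 0ℚ ≤ - x
        0≤-x = ℚ.neg-antimono-≤ x≤0
    in ℚ.<-irrefl refl (ℚ.<-≤-trans (ℚ.≤-<-trans 1≤q (q<expSum (N ℕ.+ N) (ℕ.m≤m+n N N)))
         (subst (λ z → expSum z (N ℕ.+ N) ≤ 1ℚ) (neg-neg x) (expSum-neg-even 0≤-x N)))
    where
    neg-neg : ∀ x → - - x ≡ x
    neg-neg = solve-∀ ℚ-ring

-- Sums over nonedges

if-χ : ∀ b a → (if b then a else 0ℚ) ≡ (if b then 1ℚ else 0ℚ) * a
if-χ true  a = sym (ℚ.*-identityˡ a)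
if-χ false a = sym (ℚ.*-zeroˡ a)

if-mono : ∀ {P : Set} (P? : Dec P) {a b} → (P → a ≤ b) →
  (if does P? then a else 0ℚ) ≤ (if does P? then b else 0ℚ)
if-mono (yes p) a≤b = a≤b p
if-mono (no _)  a≤b = ℚ.≤-refl

0≤if : ∀ {P : Set} (P? : Dec P) {a} → (P → 0ℚ ≤ a) → 0ℚ ≤ (if does P? then a else 0ℚ)
0≤if (yes p) 0≤a = 0≤a p
0≤if (no _)  0≤a = ℚ.≤-refl

module _ {n} (G : Graph n) where

  private
    -- Writing the condition as a factor reduces the linearity of sums over nonedges to that of `∑`.
    χ : Fin n → Fin n → ℚ
    χ i j = if does (nonedge? G i j) then 1ℚ else 0ℚ

    ∑ᴱ̄-χ : ∀ f → ∑ᴱ̄ G f ≡ ∑ λ i → ∑ λ j → χ i j * f i j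
    ∑ᴱ̄-χ f = ∑-cong λ i → ∑-cong λ j → if-χ (does (nonedge? G i j)) (f i j)

  ∑ᴱ̄-mono : ∀ {f g} → (∀ i j → Nonedge G i j → f i j ≤ g i j) → ∑ᴱ̄ G f ≤ ∑ᴱ̄ G g
  ∑ᴱ̄-mono f≤g = ∑-mono λ i → ∑-mono λ j → if-mono (nonedge? G i j) (f≤g i j)

  ∑ᴱ̄-cong : ∀ {f g} → (∀ i j → Nonedge G i j → f i j ≡ g i j) → ∑ᴱ̄ G f ≡ ∑ᴱ̄ G g
  ∑ᴱ̄-cong f≡g = ℚ.≤-antisym (∑ᴱ̄-mono λ i j ij → ℚ.≤-reflexive (f≡g i j ij))
                             (∑ᴱ̄-mono λ i j ij → ℚ.≤-reflexive (sym (f≡g i j ij)))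

  ∑ᴱ̄-+ : ∀ f g → ∑ᴱ̄ G (λ i j → f i j + g i j) ≡ ∑ᴱ̄ G f + ∑ᴱ̄ G g
  ∑ᴱ̄-+ f g = begin
    ∑ᴱ̄ G (λ i j → f i j + g i j)
      ≡⟨ ∑ᴱ̄-χ (λ i j → f i j + g i j) ⟩
    ∑ (λ i → ∑ λ j → χ i j * (f i j + g i j))
      ≡⟨ ∑-cong (λ i → trans (∑-cong λ j → ℚ.*-distribˡ-+ (χ i j) (f i j) (g i j))
           (∑-distrib-+ (λ j → χ i j * f i j) (λ j → χ i j * g i j))) ⟩
    ∑ (λ i → ∑ (λ j → χ i j * f i j) + ∑ (λ j → χ i j * g i j))
      ≡⟨ ∑-distrib-+ (λ i → ∑ (λ j → χ i j * f i j)) (λ i → ∑ (λ j → χ i j * g i j)) ⟩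
    ∑ (λ i → ∑ λ j → χ i j * f i j) + ∑ (λ i → ∑ λ j → χ i j * g i j)
      ≡⟨ cong₂ _+_ (∑ᴱ̄-χ f) (∑ᴱ̄-χ g) ⟨
    ∑ᴱ̄ G f + ∑ᴱ̄ G g ∎
    where open ≡-Reasoning

  ∑-∑ᴱ̄-comm : ∀ {m} (f : Fin m → Fin n → Fin n → ℚ) →
    ∑ (λ u → ∑ᴱ̄ G (f u)) ≡ ∑ᴱ̄ G (λ i j → ∑ λ u → f u i j)
  ∑-∑ᴱ̄-comm f = begin
    ∑ (λ u → ∑ᴱ̄ G (f u))                               ≡⟨ ∑-cong (λ u → ∑ᴱ̄-χ (f u)) ⟩
    ∑ (λ u → ∑ λ i → ∑ λ j → χ i j * f u i j)          ≡⟨ ∑-comm (λ u i → ∑ λ j → χ i j * f u i j) ⟩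
    ∑ (λ i → ∑ λ u → ∑ λ j → χ i j * f u i j)          ≡⟨ ∑-cong (λ i → ∑-comm λ u j → χ i j * f u i j) ⟩
    ∑ (λ i → ∑ λ j → ∑ λ u → χ i j * f u i j)          ≡⟨ ∑-cong (λ i → ∑-cong λ j → *-distribˡ-∑ (χ i j) λ u → f u i j) ⟨
    ∑ (λ i → ∑ λ j → χ i j * ∑ λ u → f u i j)          ≡⟨ ∑ᴱ̄-χ (λ i j → ∑ λ u → f u i j) ⟨
    ∑ᴱ̄ G (λ i j → ∑ λ u → f u i j)                     ∎
    where open ≡-Reasoning

  *-distribˡ-∑ᴱ̄ : ∀ a f → a * ∑ᴱ̄ G f ≡ ∑ᴱ̄ G (λ i j → a * f i j)
  *-distribˡ-∑ᴱ̄ a f = begin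
    a * ∑ᴱ̄ G f                                   ≡⟨ cong (a *_) (∑ᴱ̄-χ f) ⟩
    a * ∑ (λ i → ∑ λ j → χ i j * f i j)          ≡⟨ *-distribˡ-∑ a (λ i → ∑ λ j → χ i j * f i j) ⟩
    ∑ (λ i → a * ∑ λ j → χ i j * f i j)          ≡⟨ ∑-cong (λ i → *-distribˡ-∑ a λ j → χ i j * f i j) ⟩
    ∑ (λ i → ∑ λ j → a * (χ i j * f i j))        ≡⟨ ∑-cong (λ i → ∑-cong λ j → lemma a (χ i j) (f i j)) ⟩
    ∑ (λ i → ∑ λ j → χ i j * (a * f i j))        ≡⟨ ∑ᴱ̄-χ (λ i j → a * f i j) ⟨
    ∑ᴱ̄ G (λ i j → a * f i j)                     ∎
    where
    open ≡-Reasoning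
    lemma : ∀ a b c → a * (b * c) ≡ b * (a * c)
    lemma = solve-∀ ℚ-ring

  *-distribʳ-∑ᴱ̄ : ∀ a f → ∑ᴱ̄ G f * a ≡ ∑ᴱ̄ G (λ i j → f i j * a)
  *-distribʳ-∑ᴱ̄ a f = trans (ℚ.*-comm (∑ᴱ̄ G f) a)
    (trans (*-distribˡ-∑ᴱ̄ a f) (∑ᴱ̄-cong λ i j _ → ℚ.*-comm a (f i j)))

  0≤∑ᴱ̄ : ∀ {f} → (∀ i j → Nonedge G i j → 0ℚ ≤ f i j) → 0ℚ ≤ ∑ᴱ̄ G f
  0≤∑ᴱ̄ 0≤f = 0≤∑ λ i → 0≤∑ λ j → 0≤if (nonedge? G i j) (0≤f i j)

  term≤∑ᴱ̄ : ∀ {f} → (∀ i j → Nonedge G i j → 0ℚ ≤ f i j) → ∀ i j → Nonedge G i j → f i j ≤ ∑ᴱ̄ G f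
  term≤∑ᴱ̄ {f} 0≤f i j ij = ℚ.≤-trans (selected (nonedge? G i j))
    (ℚ.≤-trans (term≤∑ (pointwise i) j) (term≤∑ (λ i → 0≤∑ (pointwise i)) i))
    where
    pointwise : ∀ i j → 0ℚ ≤ (if does (nonedge? G i j) then f i j else 0ℚ)
    pointwise i j = 0≤if (nonedge? G i j) (0≤f i j)
    selected : (d : Dec (Nonedge G i j)) → f i j ≤ (if does d then f i j else 0ℚ)
    selected (yes _)  = ℚ.≤-refl
    selected (no ¬ij) = contradiction ij ¬ij

-- The matrix of the algorithm

squares≤norm² : ∀ {n} (x : Fin n → ℚ) i j → i ≢ j → x i * x i + x j * x j ≤ x ∙ x
squares≤norm² x zero    zero    i≢j = contradiction refl i≢j
squares≤norm² x zero    (suc j) i≢j =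
  ℚ.+-monoʳ-≤ (x zero * x zero) (term≤∑ (λ u → 0≤-square (x (suc u))) j)
squares≤norm² x (suc i) zero    i≢j = ℚ.≤-trans
  (ℚ.≤-reflexive (ℚ.+-comm (x (suc i) * x (suc i)) (x zero * x zero)))
  (ℚ.+-monoʳ-≤ (x zero * x zero) (term≤∑ (λ u → 0≤-square (x (suc u))) i))
squares≤norm² x (suc i) (suc j) i≢j = ℚ.≤-trans
  (squares≤norm² (x ∘ suc) i j (i≢j ∘ cong suc))
  (≤-by _ (0≤-square (x zero)) (ℚ.+-comm (x zero * x zero) ((x ∘ suc) ∙ (x ∘ suc))))

module _ {n} (x : Fin n → ℚ) (i j : Fin n) (i≢j : i ≢ j) where

  2xy≤norm² : fromℕ 2 * x i * x j ≤ x ∙ x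
  2xy≤norm² = ℚ.≤-trans (≤-by _ (0≤-square (x i - x j)) (lemma (x i) (x j))) (squares≤norm² x i j i≢j)
    where
    lemma : ∀ a b → a * a + b * b ≡ (1ℚ + 1ℚ) * a * b + (a - b) * (a - b)
    lemma = solve-∀ ℚ-ring

  -norm²≤2xy : - (x ∙ x) ≤ fromℕ 2 * x i * x j
  -norm²≤2xy = ℚ.≤-trans (ℚ.neg-antimono-≤ (squares≤norm² x i j i≢j))
    (≤-by _ (0≤-square (x i + x j)) (lemma (x i) (x j)))
    where
    lemma : ∀ a b → (1ℚ + 1ℚ) * a * b ≡ - (a * a + b * b) + (a + b) * (a + b)
    lemma = solve-∀ ℚ-ring

nonedge⇒≢ : ∀ {n} (G : Graph n) {i j} → Nonedge G i j → i ≢ j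
nonedge⇒≢ G (i<j , _) refl = Fin.<-irrefl refl i<j

module _ {n} (G : Graph n) (k : ℕ) (p : Weights n) where
  open Algorithm G k

  private
    A : Matrix n
    A = matrix p

  matrix-symmetric : Symmetric A
  matrix-symmetric u v = cong₂ _+_
    (cong (_+ w₀ p * 1ℚ) (∑ᴱ̄-cong G λ i j _ → cong (- wᴱ̄ p i j *_) (lemma (I i u) (I j v) (I i v) (I j u))))
    (I-sym u v)
    where
    lemma : ∀ a b c d → a * b + c * d ≡ c * d + a * b
    lemma = solve-∀ ℚ-ring

  Y·x : ∀ (i j : Fin n) (x : Fin n → ℚ) u → (Y i j · x) u ≡ I i u * x j + I j u * x i
  Y·x i j x u = begin
    ∑ (λ v → (I i u * I j v + I i v * I j u) * x v)
      ≡⟨ ∑-cong (λ v → lemma (I i u) (I j v) (I i v) (I j u) (x v)) ⟩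
    ∑ (λ v → I i u * (I j v * x v) + I j u * (I i v * x v))
      ≡⟨ ∑-distrib-+ (λ v → I i u * (I j v * x v)) (λ v → I j u * (I i v * x v)) ⟩
    ∑ (λ v → I i u * (I j v * x v)) + ∑ (λ v → I j u * (I i v * x v))
      ≡⟨ cong₂ _+_ (*-distribˡ-∑ (I i u) (λ v → I j v * x v)) (*-distribˡ-∑ (I j u) (λ v → I i v * x v)) ⟨
    I i u * ∑ (λ v → I j v * x v) + I j u * ∑ (λ v → I i v * x v)
      ≡⟨ cong₂ (λ a b → I i u * a + I j u * b) (∑-I j x) (∑-I i x) ⟩
    I i u * x j + I j u * x i ∎
    where
    open ≡-Reasoning
    lemma : ∀ a b c d x → (a * b + c * d) * x ≡ a * (b * x) + d * (c * x)
    lemma = solve-∀ ℚ-ring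

  x∙Y·x : ∀ (i j : Fin n) (x : Fin n → ℚ) → x ∙ (Y i j · x) ≡ fromℕ 2 * x i * x j
  x∙Y·x i j x = begin
    ∑ (λ u → x u * (Y i j · x) u)
      ≡⟨ ∑-cong (λ u → trans (cong (x u *_) (Y·x i j x u)) (lemma₁ (x u) (I i u) (x j) (I j u) (x i))) ⟩
    ∑ (λ u → I i u * (x u * x j) + I j u * (x u * x i))
      ≡⟨ ∑-distrib-+ (λ u → I i u * (x u * x j)) (λ u → I j u * (x u * x i)) ⟩
    ∑ (λ u → I i u * (x u * x j)) + ∑ (λ u → I j u * (x u * x i))
      ≡⟨ cong₂ _+_ (∑-I i (λ u → x u * x j)) (∑-I j (λ u → x u * x i)) ⟩
    x i * x j + x j * x i
      ≡⟨ lemma₂ (x i) (x j) ⟩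
    fromℕ 2 * x i * x j ∎
    where
    open ≡-Reasoning
    lemma₁ : ∀ x a b c d → x * (a * b + c * d) ≡ a * (x * b) + c * (x * d)
    lemma₁ = solve-∀ ℚ-ring
    lemma₂ : ∀ a b → a * b + b * a ≡ (1ℚ + 1ℚ) * a * b
    lemma₂ = solve-∀ ℚ-ring

  -- Apart from symmetry, everything about the matrix of the algorithm is derived from this formula.
  quadraticForm : ∀ x → x ∙ (A · x) ≡
    w₀ p * (∑ x * ∑ x) + x ∙ x - ∑ᴱ̄ G (λ i j → wᴱ̄ p i j * (fromℕ 2 * x i * x j))
  quadraticForm x = begin
    ∑ (λ u → x u * (A · x) u)
      ≡⟨ ∑-cong (λ u → trans (cong (x u *_) (A·x u)) (lemma₂ (x u) (E u) (w₀ p) (∑ x))) ⟩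
    ∑ (λ u → x u * E u + w₀ p * ∑ x * x u + x u * x u)
      ≡⟨ trans (∑-distrib-+ (λ u → x u * E u + w₀ p * ∑ x * x u) (λ u → x u * x u))
           (cong (_+ x ∙ x) (∑-distrib-+ (λ u → x u * E u) (λ u → w₀ p * ∑ x * x u))) ⟩
    ∑ (λ u → x u * E u) + ∑ (λ u → w₀ p * ∑ x * x u) + x ∙ x
      ≡⟨ cong₂ (λ a b → a + b + x ∙ x) (trans x∙E (∑ᴱ̄-cong G λ i j _ → lemma₄ (wᴱ̄ p i j) (fromℕ 2 * x i * x j)))
           (sym (*-distribˡ-∑ (w₀ p * ∑ x) x)) ⟩
    ∑ᴱ̄ G (λ i j → - 1ℚ * (wᴱ̄ p i j * (fromℕ 2 * x i * x j))) + w₀ p * ∑ x * ∑ x + x ∙ x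
      ≡⟨ cong (λ a → a + w₀ p * ∑ x * ∑ x + x ∙ x) (*-distribˡ-∑ᴱ̄ G (- 1ℚ) (λ i j → wᴱ̄ p i j * (fromℕ 2 * x i * x j))) ⟨
    - 1ℚ * ∑ᴱ̄ G (λ i j → wᴱ̄ p i j * (fromℕ 2 * x i * x j)) + w₀ p * ∑ x * ∑ x + x ∙ x
      ≡⟨ lemma₃ (∑ᴱ̄ G (λ i j → wᴱ̄ p i j * (fromℕ 2 * x i * x j))) (w₀ p) (∑ x) (x ∙ x) ⟩
    w₀ p * (∑ x * ∑ x) + x ∙ x - ∑ᴱ̄ G (λ i j → wᴱ̄ p i j * (fromℕ 2 * x i * x j)) ∎
    where
    open ≡-Reasoning
    E : Fin n → ℚ
    E u = ∑ᴱ̄ G (λ i j → - wᴱ̄ p i j * (Y i j · x) u)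
    lemma₁ : ∀ a b c d → (a + b * 1ℚ + c) * d ≡ a * d + b * d + c * d
    lemma₁ = solve-∀ ℚ-ring
    lemma₂ : ∀ x e w s → x * (e + w * s + x) ≡ x * e + w * s * x + x * x
    lemma₂ = solve-∀ ℚ-ring
    lemma₃ : ∀ e w s x → - 1ℚ * e + w * s * s + x ≡ w * (s * s) + x - e
    lemma₃ = solve-∀ ℚ-ring
    lemma₄ : ∀ p y → - p * y ≡ - 1ℚ * (p * y)
    lemma₄ = solve-∀ ℚ-ring
    lemma₅ : ∀ a b c → a * (b * c) ≡ b * (a * c)
    lemma₅ = solve-∀ ℚ-ring
    A·x : ∀ u → (A · x) u ≡ E u + w₀ p * ∑ x + x u
    A·x u = begin
      ∑ (λ v → (D v + w₀ p * 1ℚ + I u v) * x v)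
        ≡⟨ ∑-cong (λ v → lemma₁ (D v) (w₀ p) (I u v) (x v)) ⟩
      ∑ (λ v → D v * x v + w₀ p * x v + I u v * x v)
        ≡⟨ trans (∑-distrib-+ (λ v → D v * x v + w₀ p * x v) (λ v → I u v * x v))
             (cong (_+ ∑ (λ v → I u v * x v)) (∑-distrib-+ (λ v → D v * x v) (λ v → w₀ p * x v))) ⟩
      ∑ (λ v → D v * x v) + ∑ (λ v → w₀ p * x v) + ∑ (λ v → I u v * x v)
        ≡⟨ cong₂ _+_ (cong₂ _+_ D∙x (sym (*-distribˡ-∑ (w₀ p) x))) (∑-I u x) ⟩
      E u + w₀ p * ∑ x + x u ∎
      where
      D : Fin n → ℚ
      D v = ∑ᴱ̄ G (λ i j → - wᴱ̄ p i j * Y i j u v)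
      D∙x : ∑ (λ v → D v * x v) ≡ E u
      D∙x = begin
        ∑ (λ v → D v * x v)
          ≡⟨ ∑-cong (λ v → *-distribʳ-∑ᴱ̄ G (x v) (λ i j → - wᴱ̄ p i j * Y i j u v)) ⟩
        ∑ (λ v → ∑ᴱ̄ G λ i j → - wᴱ̄ p i j * Y i j u v * x v)
          ≡⟨ ∑-∑ᴱ̄-comm G (λ v i j → - wᴱ̄ p i j * Y i j u v * x v) ⟩
        ∑ᴱ̄ G (λ i j → ∑ λ v → - wᴱ̄ p i j * Y i j u v * x v)
          ≡⟨ ∑ᴱ̄-cong G (λ i j _ → trans (∑-cong λ v → ℚ.*-assoc (- wᴱ̄ p i j) (Y i j u v) (x v))
               (sym (*-distribˡ-∑ (- wᴱ̄ p i j) (λ v → Y i j u v * x v)))) ⟩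
        E u ∎
    x∙E : ∑ (λ u → x u * E u) ≡ ∑ᴱ̄ G (λ i j → - wᴱ̄ p i j * (fromℕ 2 * x i * x j))
    x∙E = begin
      ∑ (λ u → x u * E u)
        ≡⟨ ∑-cong (λ u → *-distribˡ-∑ᴱ̄ G (x u) (λ i j → - wᴱ̄ p i j * (Y i j · x) u)) ⟩
      ∑ (λ u → ∑ᴱ̄ G λ i j → x u * (- wᴱ̄ p i j * (Y i j · x) u))
        ≡⟨ ∑-∑ᴱ̄-comm G (λ u i j → x u * (- wᴱ̄ p i j * (Y i j · x) u)) ⟩
      ∑ᴱ̄ G (λ i j → ∑ λ u → x u * (- wᴱ̄ p i j * (Y i j · x) u))
        ≡⟨ ∑ᴱ̄-cong G (λ i j _ → trans (∑-cong λ u → lemma₅ (x u) (- wᴱ̄ p i j) ((Y i j · x) u))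
             (trans (sym (*-distribˡ-∑ (- wᴱ̄ p i j) (λ u → x u * (Y i j · x) u)))
               (cong (- wᴱ̄ p i j *_) (x∙Y·x i j x)))) ⟩
      ∑ᴱ̄ G (λ i j → - wᴱ̄ p i j * (fromℕ 2 * x i * x j)) ∎

record Distribution {n} (G : Graph n) (p : Weights n) : Set where
  field
    0≤pᴱ̄ : ∀ i j → Nonedge G i j → 0ℚ ≤ wᴱ̄ p i j
    0<p₀ : 0ℚ < w₀ p
    total≡1 : ∑ᴱ̄ G (wᴱ̄ p) + w₀ p ≡ 1ℚ

module _ {n} {G : Graph n} {p : Weights n} (p-dist : Distribution G p) (k : ℕ) where
  open Algorithm G k
  open Distribution p-dist

  -- The identity matrix has coefficient 1, the total mass of `p`. Each nonedge uses up at most its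
  -- own share of ‖x‖², because 2 x i x j ≤ ‖x‖², and the share of the apex remains. Besides
  -- semidefiniteness this gives the positivity of the traces and of β.
  p₀‖x‖²≤x∙A·x : ∀ x → w₀ p * x ∙ x ≤ x ∙ (matrix p · x)
  p₀‖x‖²≤x∙A·x x = begin
    w₀ p * x ∙ x
      ≡⟨ lemma (w₀ p) (∑ᴱ̄ G (wᴱ̄ p)) (x ∙ x) ⟩
    (∑ᴱ̄ G (wᴱ̄ p) + w₀ p) * x ∙ x - ∑ᴱ̄ G (wᴱ̄ p) * x ∙ x
      ≡⟨ cong₂ _-_ (trans (cong (_* x ∙ x) total≡1) (ℚ.*-identityˡ (x ∙ x))) (*-distribʳ-∑ᴱ̄ G (x ∙ x) (wᴱ̄ p)) ⟩
    x ∙ x - ∑ᴱ̄ G (λ i j → wᴱ̄ p i j * x ∙ x)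
      ≤⟨ ℚ.+-mono-≤ (≤+ˡ (x ∙ x) (0≤* (ℚ.<⇒≤ 0<p₀) (0≤-square (∑ x))))
           (ℚ.neg-antimono-≤ (∑ᴱ̄-mono G λ i j ij → *-monoˡ-≤ (0≤pᴱ̄ i j ij) (2xy≤norm² x i j (nonedge⇒≢ G ij)))) ⟩
    w₀ p * (∑ x * ∑ x) + x ∙ x - ∑ᴱ̄ G (λ i j → wᴱ̄ p i j * (fromℕ 2 * x i * x j))
      ≡⟨ quadraticForm G k p x ⟨
    x ∙ (matrix p · x) ∎
    where
    open ℚ.≤-Reasoning
    lemma : ∀ a b c → a * c ≡ (b + a) * c - b * c
    lemma = solve-∀ ℚ-ring

  matrix-psd : PositiveSemidefinite (matrix p)
  matrix-psd x = ℚ.≤-trans (0≤* (ℚ.<⇒≤ 0<p₀) (∙-self-nonneg x)) (p₀‖x‖²≤x∙A·x x)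

  -- The trace starts at n > 0 and grows at least at rate p₀. Consequently the set `S` of the Walk
  -- Counting Procedure is never empty.
  0<traceMoment : 1 ℕ.≤ n → ∀ s → 0ℚ < traceMoment (matrix p) s
  0<traceMoment 1≤n s = ℚ.<-≤-trans (0<* (0<^ 0<p₀ s) (subst (0ℚ <_) (sym (traceMoment-0 (matrix p))) (0<fromℕ 1≤n)))
    (logConvex-growth {traceMoment (matrix p)}
      (traceMoment-logConvex (matrix-symmetric G k p) matrix-psd) (ℚ.<⇒≤ 0<p₀) base s)
    where
    open ℚ.≤-Reasoning
    base : w₀ p * traceMoment (matrix p) 0 ≤ traceMoment (matrix p) 1
    base = begin
      w₀ p * traceMoment (matrix p) 0            ≡⟨ *-distribˡ-∑ (w₀ p) (λ i → moment (matrix p) (basis i) 0) ⟩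
      ∑ (λ i → w₀ p * moment (matrix p) (basis i) 0)         ≤⟨ ∑-mono (λ i → p₀‖x‖²≤x∙A·x (basis i)) ⟩
      traceMoment (matrix p) 1                   ∎

-- The Walk Counting Procedure

square≤0⇒≡0 : ∀ {q} → q * q ≤ 0ℚ → q ≡ 0ℚ
square≤0⇒≡0 {q} qq≤0 with ℚ.<-cmp q 0ℚ
... | tri≈ _ q≡0 _ = q≡0
... | tri> _ _ 0<q = contradiction (ℚ.<-≤-trans (0<* 0<q 0<q) qq≤0) (ℚ.<-irrefl refl)
... | tri< q<0 _ _ = contradiction (ℚ.<-≤-trans (0<* 0<0-q 0<0-q) (ℚ.≤-trans (ℚ.≤-reflexive (lemma q)) qq≤0)) (ℚ.<-irrefl refl)
  where
  0<0-q : 0ℚ < 0ℚ - q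
  0<0-q = <⇒0<- q<0
  lemma : ∀ q → (0ℚ - q) * (0ℚ - q) ≡ q * q
  lemma = solve-∀ ℚ-ring

0≤∧≮⇒≡0 : ∀ {q} → 0ℚ ≤ q → ¬ (0ℚ < q) → q ≡ 0ℚ
0≤∧≮⇒≡0 0≤q 0≮q = ℚ.≤-antisym (ℚ.≮⇒≥ 0≮q) 0≤q

argmax : ∀ {n} {P : Fin n → Set} (P? : ∀ i → Dec (P i)) (f : Fin n → ℚ) →
  (∀ i → ¬ P i) ⊎ ∃[ i ] (P i × (∀ j → P j → f j ≤ f i))
argmax {zero}  P? f = inj₁ λ ()
argmax {suc n} P? f with P? zero | argmax (P? ∘ suc) (f ∘ suc)
... | no ¬p  | inj₁ none               = inj₁ λ { zero → ¬p ; (suc i) → none i }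
... | no ¬p  | inj₂ (i , p , max)      = inj₂ (suc i , p , λ { zero q → contradiction q ¬p ; (suc j) → max j })
... | yes p₀ | inj₁ none               = inj₂ (zero , p₀ , λ { zero _ → ℚ.≤-refl ; (suc j) q → contradiction q (none j) })
... | yes p₀ | inj₂ (i , p , max) with ℚ.≤-total (f zero) (f (suc i))
...   | inj₁ f₀≤fᵢ = inj₂ (suc i , p , λ { zero _ → f₀≤fᵢ ; (suc j) → max j })
...   | inj₂ fᵢ≤f₀ = inj₂ (zero , p₀ , λ { zero _ → ℚ.≤-refl ; (suc j) q → ℚ.≤-trans (max j q) fᵢ≤f₀ })

module _ {n} {A : Matrix n} (A-sym : Symmetric A) (A-psd : PositiveSemidefinite A) (T̂ : ℕ) where
  open WalkCounting A T̂

  private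
    N : ℕ
    N = T̂ ℕ.+ T̂

    ψ-even : ∀ i → ψ (2 ℕ.* T̂) A i i ≡ moment A (basis i) N
    ψ-even i = trans (ψ-∙ A (2 ℕ.* T̂) i i)
      (cong (λ t → moment A (basis i) (T̂ ℕ.+ t)) (ℕ.+-identityʳ T̂))

    ψ-odd : ∀ i → ψ (2 ℕ.* T̂ ℕ.+ 1) A i i ≡ moment A (basis i) (suc N)
    ψ-odd i = trans (ψ-∙ A (2 ℕ.* T̂ ℕ.+ 1) i i)
      (cong (moment A (basis i)) (trans (ℕ.+-comm (2 ℕ.* T̂) 1) (cong (λ t → suc (T̂ ℕ.+ t)) (ℕ.+-identityʳ T̂))))

    moment-odd : ∀ i → moment A (basis i) (suc N) ≡ power A T̂ (basis i) ∙ (A · power A T̂ (basis i))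
    moment-odd i = trans (cong (moment A (basis i)) (sym (ℕ.+-suc T̂ T̂)))
      (power-+-∙ A-sym T̂ (suc T̂) (basis i) (basis i))

    ratio-* : ∀ i → S i → ratio i * moment A (basis i) N ≡ moment A (basis i) (suc N)
    ratio-* i i∈S = trans (cong (ratio i *_) (sym (ψ-even i)))
      (trans (/-*-cancel (ψ (2 ℕ.* T̂ ℕ.+ 1) A i i) i∈S) (ψ-odd i))

    -- The maximum in the procedure ranges over `S`, but the trace over all indices. Outside `S` the
    -- vector A^T̂ eᵢ has norm zero, and Cauchy-Schwarz annihilates the next moment as well.
    moment≡0⇒moment-suc≡0 : ∀ i → moment A (basis i) N ≡ 0ℚ → moment A (basis i) (suc N) ≡ 0ℚ
    moment≡0⇒moment-suc≡0 i m≡0 = trans (moment-odd i) (square≤0⇒≡0 (begin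
      (x ∙ (A · x)) * (x ∙ (A · x))     ≤⟨ cauchy-schwarz x (A · x) ⟩
      (x ∙ x) * ((A · x) ∙ (A · x))     ≡⟨ cong (_* ((A · x) ∙ (A · x))) (trans (sym (moment-+ A-sym A-psd (basis i) T̂)) m≡0) ⟩
      0ℚ * ((A · x) ∙ (A · x))          ≡⟨ ℚ.*-zeroˡ ((A · x) ∙ (A · x)) ⟩
      0ℚ                                ∎))
      where
      open ℚ.≤-Reasoning
      x : Fin n → ℚ
      x = power A T̂ (basis i)

  module _ {β x} (output : Output β x) where
    open Output output

    private
      y : Fin n → ℚ
      y = power A T̂ (basis i₀)

      x≗y : ∀ j → x j ≡ y j
      x≗y j = begin
        x j                                ≡⟨ x-value j ⟩
        ψ T̂ A i₀ j                         ≡⟨ ψ-∙ A T̂ i₀ j ⟩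
        basis i₀ ∙ power A T̂ (basis j)     ≡⟨ power-symmetric A-sym T̂ (basis i₀) (basis j) ⟨
        y ∙ basis j                        ≡⟨ ∙-comm y (basis j) ⟩
        basis j ∙ y                        ≡⟨ basis-∙ j y ⟩
        y j                                ∎
        where open ≡-Reasoning

      x∙x≡ : x ∙ x ≡ moment A (basis i₀) N
      x∙x≡ = trans (∑-cong λ j → cong₂ _*_ (x≗y j) (x≗y j)) (sym (moment-+ A-sym A-psd (basis i₀) T̂))

      x∙A·x≡ : x ∙ (A · x) ≡ moment A (basis i₀) (suc N)
      x∙A·x≡ = trans (∑-cong λ j → cong₂ _*_ (x≗y j) (∙-congʳ (A j) x≗y)) (sym (moment-odd i₀))

    0<‖x‖² : 0ℚ < x ∙ x
    0<‖x‖² = subst (0ℚ <_) (trans (ψ-even i₀) (sym x∙x≡)) i₀∈S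

    -- `β` is the exact Rayleigh quotient of `x`, not merely an approximate eigenvalue; thus a test
    -- on `β` controls the gains that `x` causes in the update.
    β‖x‖²≡x∙A·x : β * x ∙ x ≡ x ∙ (A · x)
    β‖x‖²≡x∙A·x = trans (cong₂ _*_ β-value x∙x≡) (trans (ratio-* i₀ i₀∈S) (sym x∙A·x≡))

    -- The largest ratio bounds the ratio of the sums; indices outside `S` contribute zero to both.
    traceMoment-suc≤ : traceMoment A (suc N) ≤ β * traceMoment A N
    traceMoment-suc≤ = ℚ.≤-trans (∑-mono pointwise)
      (ℚ.≤-reflexive (sym (*-distribˡ-∑ β (λ i → moment A (basis i) N))))
      where
      pointwise : ∀ i → moment A (basis i) (suc N) ≤ β * moment A (basis i) N
      pointwise i with 0ℚ ℚ.<? ψ (2 ℕ.* T̂) A i i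
      ... | yes i∈S = ℚ.≤-trans (ℚ.≤-reflexive (sym (ratio-* i i∈S)))
        (*-monoʳ-≤ (0≤moment A-sym A-psd N (basis i)) (ℚ.≤-trans (i₀-maximal i i∈S) (ℚ.≤-reflexive (sym β-value))))
      ... | no i∉S = ℚ.≤-reflexive (trans (moment≡0⇒moment-suc≡0 i m≡0)
        (sym (trans (cong (β *_) m≡0) (ℚ.*-zeroʳ β))))
        where
        m≡0 : moment A (basis i) N ≡ 0ℚ
        m≡0 = 0≤∧≮⇒≡0 (0≤moment A-sym A-psd N (basis i)) (i∉S ∘ subst (0ℚ <_) (sym (ψ-even i)))

  output-exists : 0ℚ < traceMoment A N → ∃[ β ] ∃[ x ] Output β x
  output-exists 0<t with argmax (λ i → 0ℚ ℚ.<? ψ (2 ℕ.* T̂) A i i) ratio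
  ... | inj₂ (i , i∈S , max) = ratio i , ψ T̂ A i , record
    { i₀ = i ; i₀∈S = i∈S ; i₀-maximal = max ; β-value = refl ; x-value = λ _ → refl }
  ... | inj₁ none = contradiction 0<t (ℚ.<-irrefl (sym (trans (∑-cong λ i →
    trans (sym (ψ-even i)) (0≤∧≮⇒≡0 (subst (0ℚ ≤_) (sym (ψ-even i)) (0≤moment A-sym A-psd N (basis i))) (none i))) (∑-0 n))))

-- Dedekind cuts

-- For intervals of positive rationals, a * c is the least of the four products of endpoints.
lower-*ᴿ : ∀ {X Y a b c d q} → X ∈⟨ a , b ⟩ → Y ∈⟨ c , d ⟩ → 0ℚ < a → a ≤ b → 0ℚ < c → c ≤ d →
  q < a * c → lower (X *ᴿ Y) q
lower-*ᴿ {a = a} {b} {c} {d} X∈ Y∈ 0<a a≤b 0<c c≤d q<ac = a , b , c , d , X∈ , Y∈ , q<ac ,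
  ℚ.<-≤-trans q<ac (*-monoˡ-≤ (ℚ.<⇒≤ 0<a) c≤d) ,
  ℚ.<-≤-trans q<ac (*-monoʳ-≤ (ℚ.<⇒≤ 0<c) a≤b) ,
  ℚ.<-≤-trans q<ac (*-mono-≤ (ℚ.<⇒≤ 0<a) (ℚ.<⇒≤ (ℚ.<-≤-trans 0<c c≤d)) a≤b c≤d)

upper-*ᴿ : ∀ {X Y a b c d q} → X ∈⟨ a , b ⟩ → Y ∈⟨ c , d ⟩ → 0ℚ < a → a ≤ b → 0ℚ < c → c ≤ d →
  b * d < q → upper (X *ᴿ Y) q
upper-*ᴿ {a = a} {b} {c} {d} X∈ Y∈ 0<a a≤b 0<c c≤d bd<q = a , b , c , d , X∈ , Y∈ ,
  ℚ.≤-<-trans (*-mono-≤ (ℚ.<⇒≤ 0<a) 0≤d a≤b c≤d) bd<q ,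
  ℚ.≤-<-trans (*-monoʳ-≤ 0≤d a≤b) bd<q ,
  ℚ.≤-<-trans (*-monoˡ-≤ (ℚ.<⇒≤ (ℚ.<-≤-trans 0<a a≤b)) c≤d) bd<q ,
  bd<q
  where
  0≤d : 0ℚ ≤ d
  0≤d = ℚ.<⇒≤ (ℚ.<-≤-trans 0<c c≤d)

0≤expSum : ∀ {q} → 0ℚ ≤ q → ∀ m → 0ℚ ≤ expSum q m
0≤expSum 0≤q m = 0≤∑ {m} λ i → 0≤expTerm 0≤q (toℕ i)

module _ {ε̂ : Cut} (ε̂-real : IsDedekind ε̂) (0<ε̂ : ι 0ℚ <ᴿ ε̂) where
  open IsDedekind ε̂-real

  private
    -- A positive rational below ε̂. Products of cuts ask for intervals with two endpoints; where
    -- only one of them matters, `e₀` helps to supply the other.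
    e₀ : ℚ
    e₀ = proj₁ 0<ε̂

    0<e₀ : 0ℚ < e₀
    0<e₀ = proj₁ (proj₂ 0<ε̂)

    e₀<ε̂ : lower ε̂ e₀
    e₀<ε̂ = proj₂ (proj₂ 0<ε̂)

  lower<upper : ∀ {p q} → lower ε̂ p → upper ε̂ q → p < q
  lower<upper {p} {q} p<ε̂ ε̂<q with ℚ.<-cmp p q
  ... | tri< p<q _ _  = p<q
  ... | tri≈ _ refl _ = contradiction (p<ε̂ , ε̂<q) disjoint
  ... | tri> _ _ q<p  = contradiction (p<ε̂ , upper-closed q<p ε̂<q) disjoint

  upper⇒0< : ∀ {q} → upper ε̂ q → 0ℚ < q
  upper⇒0< ε̂<q = ℚ.<-trans 0<e₀ (lower<upper e₀<ε̂ ε̂<q)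

  -- The order of cuts speaks about lower sets only; locatedness converts it into an upper bound, at
  -- the price of passing from p to a larger q.
  ≤ᴿι⇒upper : ∀ {p q} → ε̂ ≤ᴿ ι p → p < q → upper ε̂ q
  ≤ᴿι⇒upper {p} ε̂≤p p<q with located p<q
  ... | inj₁ p<ε̂ = contradiction (ε̂≤p p p<ε̂) (ℚ.<-irrefl refl)
  ... | inj₂ ε̂<q = ε̂<q

  -- If the test succeeds, the lower endpoint chosen for 1 - ε̂ comes from a rational `d` above ε̂,
  -- and this `d` replaces the real number in the later estimates.
  <ᴿ[1-ε̂]*⇒ : ∀ {β l} → 0ℚ < β → 0ℚ < l → ι β <ᴿ (ι 1ℚ -ᴿ ε̂) *ᴿ ι l →
    ∃[ d ] (upper ε̂ d × d < 1ℚ × β < (1ℚ - d) * l)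
  <ᴿ[1-ε̂]*⇒ {β} {l} 0<β 0<l
    (q , β<q , a , b , c , d′ , ((a₁ , d , a₁<1 , ε̂<d , a<a₁-d) , _) , (c<l , l<d′) , q<ac , q<ad′ , _) =
    d , ε̂<d , <-by (1ℚ - d) (ℚ.<-trans 0<a a<1-d) (lemma d) , (begin-strict
      β             <⟨ β<q ⟩
      q             <⟨ q<ac ⟩
      a * c         <⟨ *-monoˡ-< 0<a c<l ⟩
      a * l         <⟨ *-monoʳ-< 0<l a<1-d ⟩
      (1ℚ - d) * l  ∎)
    where
    open ℚ.≤-Reasoning
    a<1-d : a < 1ℚ - d
    a<1-d = ℚ.<-trans a<a₁-d (ℚ.+-monoˡ-< (- d) a₁<1)
    -- The upper endpoint `d′` serves to fix the sign of `a`: it is positive, and 0 < β < a * d′.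
    0<a : 0ℚ < a
    0<a = 0<*⇒0< (ℚ.<-trans 0<l l<d′) (ℚ.<-trans 0<β (ℚ.<-trans β<q q<ad′))
    lemma : ∀ d → 1ℚ ≡ d + (1ℚ - d)
    lemma = solve-∀ ℚ-ring

  private
    gap₁ : ∀ e a → 1ℚ - a ≡ e + (1ℚ - e - a)
    gap₁ = solve-∀ ℚ-ring
    gap₂ : ∀ a d → 1ℚ ≡ a + d + (1ℚ - a - d)
    gap₂ = solve-∀ ℚ-ring
    gap₃ : ∀ b a d → b - d ≡ a + (b - (a + d))
    gap₃ = solve-∀ ℚ-ring
    gap₄ : ∀ a e → a + (1ℚ + 1ℚ) ≡ 1ℚ + 1ℚ - e + (a + e)
    gap₄ = solve-∀ ℚ-ring

  -- The hypothesis on `e` says ε̂ ≤ e. Density of ℚ splits the slack in β < (1 - e) l: first `a`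
  -- below 1 - e and `c` below `l` with a c > β still true, then `d` and `a₁` that certify `a` as a
  -- lower bound of 1 - ε̂. The upper endpoints a + 2 and l + 1 are arbitrary.
  ⇒<ᴿ[1-ε̂]* : ∀ {β l e} → 0ℚ < β → 0ℚ < l → (∀ d → e < d → upper ε̂ d) →
    β < (1ℚ - e) * l → ι β <ᴿ (ι 1ℚ -ᴿ ε̂) *ᴿ ι l
  ⇒<ᴿ[1-ε̂]* {β} {l} {e} 0<β 0<l ε̂≤e β<[1-e]l =
    between β/l<1-e λ a β/l<a a<1-e →
    let 0<a = ℚ.<-trans (0</ 0<β 0<l) β/l<a in
    between (β/a<l a 0<a β/l<a) λ c β/a<c c<l →
    between (β<ca a c 0<a β/a<c) λ q β<q q<ca →
    between (<-by {a = e} (1ℚ - e - a) (<⇒0<- a<1-e) (gap₁ e a)) λ d e<d d<1-a →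
    between (<-by {a = a + d} (1ℚ - a - d) (<⇒0<- d<1-a) (gap₂ a d)) λ a₁ a+d<a₁ a₁<1 →
    q , β<q , lower-*ᴿ {ι 1ℚ -ᴿ ε̂} {ι l} {a} {a + (1ℚ + 1ℚ)} {c} {l + 1ℚ}
      ((a₁ , d , a₁<1 , ε̂≤e d e<d , <-by (a₁ - (a + d)) (<⇒0<- a+d<a₁) (gap₃ a₁ a d)) ,
       (1ℚ + 1ℚ , e₀ , <-by 1ℚ 0<1 refl , e₀<ε̂ , <-by (a + e₀) (0<+ 0<a (ℚ.<⇒≤ 0<e₀)) (gap₄ a e₀)))
      (c<l , <-by 1ℚ 0<1 refl)
      0<a (≤+ a (ℚ.<⇒≤ (ℚ.positive⁻¹ (1ℚ + 1ℚ))))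
      (ℚ.<-trans (0</ 0<β 0<a) β/a<c) (ℚ.≤-trans (ℚ.<⇒≤ c<l) (≤+ l 0≤1))
      (subst (q <_) (ℚ.*-comm c a) q<ca)
    where
    between : ∀ {p q} {R : Set} → p < q → (∀ r → p < r → r < q → R) → R
    between p<q f = let r , p<r , r<q = ℚ.<-dense p<q in f r p<r r<q
    β/l<1-e : β / l < 1ℚ - e
    β/l<1-e = *-cancelʳ-< 0<l (subst (_< (1ℚ - e) * l) (sym (/-*-cancel β 0<l)) β<[1-e]l)
    β/a<l : ∀ a → 0ℚ < a → β / l < a → β / a < l
    β/a<l a 0<a β/l<a = *-cancelʳ-< 0<a (subst₂ _<_ (sym (/-*-cancel β 0<a)) (ℚ.*-comm a l)
      (subst (_< a * l) (/-*-cancel β 0<l) (*-monoʳ-< 0<l β/l<a)))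
    β<ca : ∀ a c → 0ℚ < a → β / a < c → β < c * a
    β<ca a c 0<a β/a<c = subst (_< c * a) (/-*-cancel β 0<a) (*-monoʳ-< 0<a β/a<c)

  -- The summand `a` is free, so that this upper endpoint automatically exceeds the lower endpoint
  -- `a` of the same interval.
  recip⁺-upper : ∀ {a} → 0ℚ < a → upper (recip⁺ ε̂) (a + (1ℚ + 1ℚ) / e₀)
  recip⁺-upper {a} 0<a = e₀ , 0<e₀ , e₀<ε̂ , <-by (a * e₀ + 1ℚ) (ℚ.<-≤-trans (0<* 0<a 0<e₀) (≤+ (a * e₀) 0≤1))
    (trans (ℚ.*-distribʳ-+ e₀ a ((1ℚ + 1ℚ) / e₀))
      (trans (cong (λ z → a * e₀ + z) (/-*-cancel (1ℚ + 1ℚ) 0<e₀)) (lemma (a * e₀))))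
    where
    lemma : ∀ x → x + (1ℚ + 1ℚ) ≡ 1ℚ + (x + 1ℚ)
    lemma = solve-∀ ℚ-ring

  private
    0≤2/e₀ : 0ℚ ≤ (1ℚ + 1ℚ) / e₀
    0≤2/e₀ = ℚ.<⇒≤ (0</ (ℚ.positive⁻¹ (1ℚ + 1ℚ)) 0<e₀)

  -- If M (1 - d)^(2 T̂) were at least 2, then exp (T̂ d + 1/2) ≤ 2 (1 - d)^(- T̂) ≤ M, so
  -- T̂ d + 1/2 ≤ ln (M / ε̂) and T̂ < T̂ + 1 / (2 d) ≤ (1 / ε̂) ln (M / ε̂).
  1-ε̂^-small : ∀ {M T̂ d} → fromℕ 4 ≤ M → upper ε̂ (½ * ½) →
    recip⁺ ε̂ *ᴿ ln (ι M *ᴿ recip⁺ ε̂) ≤ᴿ ι (fromℕ T̂) →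
    upper ε̂ d → d < 1ℚ → M * (1ℚ - d) ^ (T̂ ℕ.+ T̂) < 1ℚ + 1ℚ
  1-ε̂^-small {M} {T̂} {d} 4≤M ε̂<¼ T̂-bound ε̂<d d<1 = ℚ.≰⇒> λ 2≤My² →
    ℚ.<-irrefl refl (T̂-bound (fromℕ T̂) (product 2≤My²))
    where
    open ℚ.≤-Reasoning
    0<d : 0ℚ < d
    0<d = upper⇒0< ε̂<d
    0≤M : 0ℚ ≤ M
    0≤M = ℚ.≤-trans (0≤fromℕ 4) 4≤M
    0<½ : 0ℚ < ½
    0<½ = ℚ.positive⁻¹ ½
    z y q r : ℚ
    z = fromℕ T̂ * d
    y = (1ℚ - d) ^ T̂
    q = z + ½
    r = M + 1ℚ
    0≤z : 0ℚ ≤ z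
    0≤z = 0≤* (0≤fromℕ T̂) (ℚ.<⇒≤ 0<d)
    0≤1-d : 0ℚ ≤ 1ℚ - d
    0≤1-d = ≤⇒0≤- (ℚ.<⇒≤ d<1)
    0≤y : 0ℚ ≤ y
    0≤y = 0≤^ 0≤1-d T̂
    y≤1 : y ≤ 1ℚ
    y≤1 = ℚ.≤-trans (^-monoˡ-≤ 0≤1-d (≤-by d (ℚ.<⇒≤ 0<d) (lemma d)) T̂) (ℚ.≤-reflexive (1^ T̂))
      where
      lemma : ∀ d → 1ℚ ≡ 1ℚ - d + d
      lemma = solve-∀ ℚ-ring
    expSum≤M : 1ℚ + 1ℚ ≤ M * (1ℚ - d) ^ (T̂ ℕ.+ T̂) → ∀ m → expSum q m ≤ M
    expSum≤M 2≤My² m = *-cancelʳ-≤ 0<½ (begin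
      expSum q m * ½                ≤⟨ expSum-+ 0≤z (ℚ.<⇒≤ 0<½) m ⟩
      expSum z m                    ≡⟨ lemma₁ (expSum z m) ⟩
      expSum z m * (1ℚ + 1ℚ) * ½    ≤⟨ *-monoʳ-≤ (ℚ.<⇒≤ 0<½) (*-monoˡ-≤ (0≤expSum 0≤z m) 2≤My) ⟩
      expSum z m * (M * y) * ½      ≡⟨ lemma₂ (expSum z m) M y ½ ⟩
      M * (expSum z m * y) * ½      ≤⟨ *-monoʳ-≤ (ℚ.<⇒≤ 0<½) (*-monoˡ-≤ 0≤M (expSum-multiple (ℚ.<⇒≤ 0<d) (ℚ.<⇒≤ d<1) T̂ m)) ⟩
      M * 1ℚ * ½                    ≡⟨ cong (_* ½) (ℚ.*-identityʳ M) ⟩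
      M * ½                         ∎)
      where
      2≤My : 1ℚ + 1ℚ ≤ M * y
      2≤My = begin
        1ℚ + 1ℚ                       ≤⟨ 2≤My² ⟩
        M * (1ℚ - d) ^ (T̂ ℕ.+ T̂)      ≡⟨ cong (M *_) (^-homo-* (1ℚ - d) T̂ T̂) ⟩
        M * (y * y)                   ≤⟨ *-monoˡ-≤ 0≤M (*-monoˡ-≤ 0≤y y≤1) ⟩
        M * (y * 1ℚ)                  ≡⟨ cong (M *_) (ℚ.*-identityʳ y) ⟩
        M * y                         ∎
      lemma₁ : ∀ s → s ≡ s * (1ℚ + 1ℚ) * ½
      lemma₁ = solve-∀ ℚ-ring
      lemma₂ : ∀ s m y h → s * (m * y) * h ≡ m * (s * y) * h
      lemma₂ = solve-∀ ℚ-ring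
    -- Upper endpoints for M, 1 / ε̂ and ln (M / ε̂), which the interval products require but whose
    -- size is immaterial. The last one is valid because exp q₂ ≥ 1 + q₂.
    b₂ d₂ q₂ : ℚ
    b₂ = M + 1ℚ
    d₂ = fromℕ 3 + (1ℚ + 1ℚ) / e₀
    q₂ = q + (b₂ * d₂ + (1ℚ + 1ℚ))
    3<recip : lower (recip⁺ ε̂) (fromℕ 3)
    3<recip = ½ * ½ , ε̂<¼ , <-by (½ * ½) (ℚ.positive⁻¹ (½ * ½)) refl
    M∈ : ι M ∈⟨ M - 1ℚ , b₂ ⟩
    M∈ = <-by 1ℚ 0<1 (lemma M) , <-by 1ℚ 0<1 refl
      where
      lemma : ∀ m → m ≡ m - 1ℚ + 1ℚ
      lemma = solve-∀ ℚ-ring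
    0<M-1 : 0ℚ < M - 1ℚ
    0<M-1 = <⇒0<- (ℚ.<-≤-trans (<-by {a = 1ℚ} (fromℕ 3) (0<fromℕ-suc 2) refl) 4≤M)
    M-1≤b₂ : M - 1ℚ ≤ b₂
    M-1≤b₂ = ≤-by (1ℚ + 1ℚ) (ℚ.<⇒≤ (ℚ.positive⁻¹ (1ℚ + 1ℚ))) (lemma M)
      where
      lemma : ∀ m → m + 1ℚ ≡ m - 1ℚ + (1ℚ + 1ℚ)
      lemma = solve-∀ ℚ-ring
    recip∈ : recip⁺ ε̂ ∈⟨ fromℕ 3 , d₂ ⟩
    recip∈ = 3<recip , recip⁺-upper (0<fromℕ-suc 2)
    3≤d₂ : fromℕ 3 ≤ d₂
    3≤d₂ = ≤+ (fromℕ 3) 0≤2/e₀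
    -- The crude bound 1 / ε̂ > 3 suffices: 3 (M - 1) exceeds r = M + 1 as M ≥ 4.
    r<M/ε̂ : lower (ι M *ᴿ recip⁺ ε̂) r
    r<M/ε̂ = lower-*ᴿ {ι M} {recip⁺ ε̂} M∈ recip∈ 0<M-1 M-1≤b₂ (0<fromℕ-suc 2) 3≤d₂
      (<-by (M - fromℕ 4 + (M - fromℕ 4) + fromℕ 4) (ℚ.<-≤-trans (0<fromℕ-suc 3)
        (≤+ˡ (fromℕ 4) (0≤+ (≤⇒0≤- 4≤M) (≤⇒0≤- 4≤M)))) (lemma M))
      where
      lemma : ∀ m → (m - 1ℚ) * fromℕ 3 ≡ m + 1ℚ + (m - fromℕ 4 + (m - fromℕ 4) + fromℕ 4)
      lemma = solve-∀ ℚ-ring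
    M/ε̂<r₂ : upper (ι M *ᴿ recip⁺ ε̂) (b₂ * d₂ + 1ℚ)
    M/ε̂<r₂ = upper-*ᴿ {ι M} {recip⁺ ε̂} M∈ recip∈ 0<M-1 M-1≤b₂ (0<fromℕ-suc 2) 3≤d₂ (<-by 1ℚ 0<1 refl)
    0<q : 0ℚ < q
    0<q = ℚ.<-≤-trans 0<½ (≤+ˡ ½ 0≤z)
    0≤b₂d₂ : 0ℚ ≤ b₂ * d₂
    0≤b₂d₂ = 0≤* (0≤+ 0≤M 0≤1) (ℚ.≤-trans (0≤fromℕ 3) 3≤d₂)
    0≤b₂d₂+2 : 0ℚ ≤ b₂ * d₂ + (1ℚ + 1ℚ)
    0≤b₂d₂+2 = 0≤+ 0≤b₂d₂ (0≤+ 0≤1 0≤1)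
    q<ln : 1ℚ + 1ℚ ≤ M * (1ℚ - d) ^ (T̂ ℕ.+ T̂) → lower (ln (ι M *ᴿ recip⁺ ε̂)) q
    q<ln 2≤My² = r , (M , <-by 1ℚ 0<1 refl , 0 , λ m _ → expSum≤M 2≤My² m) , r<M/ε̂
    ln<q₂ : upper (ln (ι M *ᴿ recip⁺ ε̂)) q₂
    ln<q₂ = b₂ * d₂ + 1ℚ , M/ε̂<r₂ , b₂ * d₂ + (1ℚ + 1ℚ) , <-by 1ℚ 0<1 (lemma (b₂ * d₂)) , 2 , large
      where
      lemma : ∀ x → x + (1ℚ + 1ℚ) ≡ x + 1ℚ + 1ℚ
      lemma = solve-∀ ℚ-ring
      large : ∀ m → 2 ℕ.≤ m → b₂ * d₂ + (1ℚ + 1ℚ) ≤ expSum q₂ m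
      large (suc (suc m)) _ = ℚ.≤-trans (≤+ˡ (b₂ * d₂ + (1ℚ + 1ℚ)) (0≤+ 0≤1 (ℚ.<⇒≤ 0<q)))
        (ℚ.≤-trans (ℚ.≤-reflexive (ℚ.+-assoc 1ℚ q (b₂ * d₂ + (1ℚ + 1ℚ))))
          (1+q≤expSum (0≤+ (ℚ.<⇒≤ 0<q) 0≤b₂d₂+2) m))
      large (suc zero) (s≤s ())
    product : 1ℚ + 1ℚ ≤ M * (1ℚ - d) ^ (T̂ ℕ.+ T̂) →
      lower (recip⁺ ε̂ *ᴿ ln (ι M *ᴿ recip⁺ ε̂)) (fromℕ T̂)
    -- A lower bound 1 / d of the reciprocal needs a strict product, hence an upper point `d′` of ε̂
    -- strictly below `d`.
    product 2≤My² with d′ , d′<d , ε̂<d′ ← upper-rounded ε̂<d =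
      lower-*ᴿ {recip⁺ ε̂} {ln (ι M *ᴿ recip⁺ ε̂)}
        ((d′ , ε̂<d′ , subst (1ℚ / d * d′ <_) (/-*-cancel 1ℚ 0<d) (*-monoˡ-< 0<1/d d′<d)) , recip⁺-upper 0<1/d)
        (q<ln 2≤My² , ln<q₂)
        0<1/d (≤+ (1ℚ / d) 0≤2/e₀) 0<q (≤+ q 0≤b₂d₂+2)
        (<-by (1ℚ / d * ½) (0<* 0<1/d 0<½) (trans (lemma (1ℚ / d) (fromℕ T̂) d ½)
          (cong (_+ 1ℚ / d * ½) (trans (cong (_* fromℕ T̂) (/-*-cancel 1ℚ 0<d)) (ℚ.*-identityˡ (fromℕ T̂))))))
      where
      0<1/d : 0ℚ < 1ℚ / d
      0<1/d = 0</ 0<1 0<d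
      lemma : ∀ i t d h → i * (t * d + h) ≡ i * d * t + i * h
      lemma = solve-∀ ℚ-ring

module _ {L K q : ℚ} (1≤L : 1ℚ ≤ L) (0≤K : 0ℚ ≤ K) where

  -- The witness is the upper endpoint for ln L in the inner interval product. It is positive and K
  -- ≥ 0, so replacing the other upper endpoints by 4 and K only decreases the product.
  T-bound⇒ : ι (fromℕ 4) *ᴿ ln (ι L) *ᴿ ι K <ᴿ ι q → ∃[ x ] (upper (ln (ι L)) x × fromℕ 4 * x * K < q)
  T-bound⇒ (q′ , (_ , b , _ , d , (_ , (_ , b₁ , _ , d₁ , (_ , 4<b₁) , (_ , lnL<d₁) , _ , _ , _ , b₁d₁<b)) , (_ , K<d) , _ , _ , _ , bd<q′) , q′<q) =
    d₁ , lnL<d₁ , ℚ.<-trans (ℚ.≤-<-trans (*-mono-≤ 0≤4d₁ (ℚ.<⇒≤ (ℚ.≤-<-trans 0≤K K<d)) 4d₁≤b (ℚ.<⇒≤ K<d)) bd<q′) q′<q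
    where
    0<d₁ : 0ℚ < d₁
    0<d₁ = ln-upper-positive 1≤L lnL<d₁
    0≤4d₁ : 0ℚ ≤ fromℕ 4 * d₁
    0≤4d₁ = 0≤* (0≤fromℕ 4) (ℚ.<⇒≤ 0<d₁)
    4d₁≤b : fromℕ 4 * d₁ ≤ b
    4d₁≤b = ℚ.≤-trans (*-monoʳ-≤ (ℚ.<⇒≤ 0<d₁) (ℚ.<⇒≤ 4<b₁)) (ℚ.<⇒≤ b₁d₁<b)

-- The weights of the algorithm

record Positive {n} (G : Graph n) (w : Weights n) : Set where
  field
    0<wᴱ̄ : ∀ i j → Nonedge G i j → 0ℚ < wᴱ̄ w i j
    0<w₀ : 0ℚ < w₀ w

totalWeight : ∀ {n} → Graph n → Weights n → ℚ
totalWeight G w = ∑ᴱ̄ G (wᴱ̄ w) + w₀ w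

module _ {n} {G : Graph n} {w : Weights n} (w-pos : Positive G w) (k : ℕ) where
  open Algorithm G k
  open Positive w-pos

  0<totalWeight : 0ℚ < totalWeight G w
  0<totalWeight = ℚ.<-≤-trans 0<w₀ (≤+ˡ (w₀ w) (0≤∑ᴱ̄ G λ i j ij → ℚ.<⇒≤ (0<wᴱ̄ i j ij)))

  normalise-distribution : Distribution G (normalise w)
  normalise-distribution = record
    { 0≤pᴱ̄    = λ i j ij → 0≤/ (ℚ.<⇒≤ (0<wᴱ̄ i j ij)) 0<totalWeight
    ; 0<p₀    = 0</ 0<w₀ 0<totalWeight
    ; total≡1 = *-cancelʳ-≡ 0<totalWeight (begin
        (∑ᴱ̄ G (λ i j → wᴱ̄ w i j / t) + w₀ w / t) * t
          ≡⟨ ℚ.*-distribʳ-+ t (∑ᴱ̄ G (λ i j → wᴱ̄ w i j / t)) (w₀ w / t) ⟩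
        ∑ᴱ̄ G (λ i j → wᴱ̄ w i j / t) * t + w₀ w / t * t
          ≡⟨ cong₂ _+_ (trans (*-distribʳ-∑ᴱ̄ G t (λ i j → wᴱ̄ w i j / t))
               (∑ᴱ̄-cong G λ i j _ → /-*-cancel (wᴱ̄ w i j) 0<totalWeight))
               (/-*-cancel (w₀ w) 0<totalWeight) ⟩
        t
          ≡⟨ ℚ.*-identityˡ t ⟨
        1ℚ * t ∎)
    }
    where
    open ≡-Reasoning
    t : ℚ
    t = totalWeight G w

-- Used in dimension n to bound the apex gain, and in dimension c for the sums over the colour
-- classes.
∑²≤n‖x‖² : ∀ {n} (x : Fin n → ℚ) → ∑ x * ∑ x ≤ fromℕ n * x ∙ x
∑²≤n‖x‖² {n} x = begin
  ∑ x * ∑ x                                ≡⟨ cong₂ _*_ 1∙x 1∙x ⟩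
  ((λ _ → 1ℚ) ∙ x) * ((λ _ → 1ℚ) ∙ x)      ≤⟨ cauchy-schwarz (λ _ → 1ℚ) x ⟩
  ∑ {n} (λ _ → 1ℚ) * x ∙ x                 ≡⟨ cong (_* x ∙ x) (trans (∑-const n 1ℚ) (ℚ.*-identityʳ (fromℕ n))) ⟩
  fromℕ n * x ∙ x                          ∎
  where
  open ℚ.≤-Reasoning
  1∙x : ∑ x ≡ (λ _ → 1ℚ) ∙ x
  1∙x = ∑-cong λ i → sym (ℚ.*-identityˡ (x i))

module Parameters {n} (G : Graph n) (k : ℕ) (2≤k : 2 ℕ.≤ k) (k≤n : k ℕ.≤ n) where
  open Algorithm G k

  2≤n : 2 ℕ.≤ n
  2≤n = ℕ.≤-trans 2≤k k≤n

  1≤n : 1 ℕ.≤ n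
  1≤n = ℕ.≤-trans (s≤s z≤n) 2≤n

  4≤C : 4 ℕ.≤ C
  4≤C = ℕ.+-monoˡ-≤ 2 (ℕ.*-mono-≤ (ℕ.*-mono-≤ (ℕ.∸-monoˡ-≤ 1 2≤k) 2≤n) (ℕ.∸-monoˡ-≤ 1 2≤n))

  N Γ η : ℚ
  N = fromℕ n
  Γ = fromℕ C
  η = ε / fromℕ n

  0<N : 0ℚ < N
  0<N = 0<fromℕ 1≤n

  2≤N : fromℕ 2 ≤ N
  2≤N = fromℕ-mono-≤ 2≤n

  4≤Γ : fromℕ 4 ≤ Γ
  4≤Γ = fromℕ-mono-≤ 4≤C

  0<Γ : 0ℚ < Γ
  0<Γ = ℚ.<-≤-trans (0<fromℕ-suc 3) 4≤Γ

  ηN≡ε : η * N ≡ ε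
  ηN≡ε = /-*-cancel ε 0<N

  0<2n : 0ℚ < fromℕ (2 ℕ.* n)
  0<2n = 0<fromℕ (ℕ.*-mono-≤ {1} {2} {1} {n} (s≤s z≤n) 1≤n)

  0<ε : 0ℚ < ε
  0<ε = 0<* (0</ 0<1 0<2n) (0</ 0<1 0<Γ)

  0<η : 0ℚ < η
  0<η = 0</ 0<ε 0<N

  ε*2NΓ≡1 : ε * (fromℕ 2 * N * Γ) ≡ 1ℚ
  ε*2NΓ≡1 = trans (cong (λ z → ε * (z * Γ)) (sym (fromℕ-* 2 n)))
    (trans (lemma (1ℚ / fromℕ (2 ℕ.* n)) (1ℚ / Γ) (fromℕ (2 ℕ.* n)) Γ)
      (trans (cong₂ _*_ (/-*-cancel 1ℚ 0<2n) (/-*-cancel 1ℚ 0<Γ)) (ℚ.*-identityˡ 1ℚ)))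
    where
    lemma : ∀ a b c d → a * b * (c * d) ≡ a * c * (b * d)
    lemma = solve-∀ ℚ-ring

  16ε≤1 : fromℕ 16 * ε ≤ 1ℚ
  16ε≤1 = begin
    fromℕ 16 * ε             ≡⟨ ℚ.*-comm (fromℕ 16) ε ⟩
    ε * fromℕ 16             ≤⟨ *-monoˡ-≤ (ℚ.<⇒≤ 0<ε) (*-mono-≤ (0≤fromℕ 4) (ℚ.<⇒≤ 0<Γ) (*-monoˡ-≤ (0≤fromℕ 2) 2≤N) 4≤Γ) ⟩
    ε * (fromℕ 2 * N * Γ)    ≡⟨ ε*2NΓ≡1 ⟩
    1ℚ                       ∎
    where open ℚ.≤-Reasoning

  ε<1 : ε < 1ℚ
  ε<1 = ℚ.<-≤-trans (<-by (fromℕ 15 * ε) (0<* (0<fromℕ-suc 14) 0<ε) (lemma ε)) 16ε≤1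
    where
    lemma : ∀ x → fromℕ 16 * x ≡ x + fromℕ 15 * x
    lemma = solve-∀ ℚ-ring

  η≤ε : η ≤ ε
  η≤ε = begin
    η        ≡⟨ ℚ.*-identityʳ η ⟨
    η * 1ℚ   ≤⟨ *-monoˡ-≤ (ℚ.<⇒≤ 0<η) (fromℕ-mono-≤ 1≤n) ⟩
    η * N    ≡⟨ ηN≡ε ⟩
    ε        ∎
    where open ℚ.≤-Reasoning

  pairGain : (Fin n → ℚ) → Fin n → Fin n → ℚ
  pairGain x i j = (fromℕ 2 * x i * x j) / (x ∙ x)

  -- The sign is reversed against the update rule, so that every weight is multiplied by 1 + η times
  -- its gain.
  apexGain : (Fin n → ℚ) → ℚ
  apexGain x = fromℕ k - (∑ x * ∑ x) / (x ∙ x)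

  module _ {x : Fin n → ℚ} (0<xx : 0ℚ < x ∙ x) where

    pairGain≤1 : ∀ i j → i ≢ j → pairGain x i j ≤ 1ℚ
    pairGain≤1 i j i≢j = *-cancelʳ-≤ 0<xx (subst₂ _≤_ (sym (/-*-cancel (fromℕ 2 * x i * x j) 0<xx))
      (sym (ℚ.*-identityˡ (x ∙ x))) (2xy≤norm² x i j i≢j))

    -1≤pairGain : ∀ i j → i ≢ j → - 1ℚ ≤ pairGain x i j
    -1≤pairGain i j i≢j = *-cancelʳ-≤ 0<xx (subst₂ _≤_ (lemma (x ∙ x)) (sym (/-*-cancel (fromℕ 2 * x i * x j) 0<xx))
      (-norm²≤2xy x i j i≢j))
      where
      lemma : ∀ a → - a ≡ - 1ℚ * a
      lemma = solve-∀ ℚ-ring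

    apexGain≤N : apexGain x ≤ N
    apexGain≤N = ℚ.≤-trans
      (≤-by _ (0≤/ (0≤-square (∑ x)) 0<xx) (lemma (fromℕ k) ((∑ x * ∑ x) / (x ∙ x))))
      (fromℕ-mono-≤ k≤n)
      where
      lemma : ∀ a b → a ≡ a - b + b
      lemma = solve-∀ ℚ-ring

    -N≤apexGain : - N ≤ apexGain x
    -N≤apexGain = ℚ.≤-trans (ℚ.neg-antimono-≤ ratio≤N) (≤+ˡ (- ((∑ x * ∑ x) / (x ∙ x))) (0≤fromℕ k))
      where
      ratio≤N : (∑ x * ∑ x) / (x ∙ x) ≤ N
      ratio≤N = *-cancelʳ-≤ 0<xx (ℚ.≤-trans (ℚ.≤-reflexive (/-*-cancel (∑ x * ∑ x) 0<xx)) (∑²≤n‖x‖² x))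

    ∣ηgain∣≤ε : ∀ {g b} → 0ℚ ≤ b → η * b ≤ ε → - b ≤ g → g ≤ b → (- ε ≤ η * g) × (η * g ≤ ε)
    ∣ηgain∣≤ε {g} {b} 0≤b ηb≤ε -b≤g g≤b =
      ℚ.≤-trans (ℚ.neg-antimono-≤ ηb≤ε) (ℚ.≤-trans (ℚ.≤-reflexive (ℚ.neg-distribʳ-* η b)) (*-monoˡ-≤ (ℚ.<⇒≤ 0<η) -b≤g)) ,
      ℚ.≤-trans (*-monoˡ-≤ (ℚ.<⇒≤ 0<η) g≤b) ηb≤ε

    ∣ηpairGain∣≤ε : ∀ i j → i ≢ j → (- ε ≤ η * pairGain x i j) × (η * pairGain x i j ≤ ε)
    ∣ηpairGain∣≤ε i j i≢j = ∣ηgain∣≤ε 0≤1 (subst (_≤ ε) (sym (ℚ.*-identityʳ η)) η≤ε) (-1≤pairGain i j i≢j) (pairGain≤1 i j i≢j)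

    ∣ηapexGain∣≤ε : (- ε ≤ η * apexGain x) × (η * apexGain x ≤ ε)
    ∣ηapexGain∣≤ε = ∣ηgain∣≤ε (ℚ.<⇒≤ 0<N) (ℚ.≤-reflexive ηN≡ε) -N≤apexGain apexGain≤N

  update-w₀ : ∀ w x → w₀ (update w x) ≡ w₀ w * (1ℚ + η * apexGain x)
  update-w₀ w x = cong (w₀ w *_) (lemma η ((∑ x * ∑ x) / (x ∙ x)) (fromℕ k))
    where
    lemma : ∀ h a k → 1ℚ - h * (a - k) ≡ 1ℚ + h * (k - a)
    lemma = solve-∀ ℚ-ring

  -ε≤⇒0<1+ : ∀ {u} → - ε ≤ u → 0ℚ < 1ℚ + u
  -ε≤⇒0<1+ {u} -ε≤u = ℚ.<-≤-trans (<⇒0<- ε<1) (ℚ.+-monoʳ-≤ 1ℚ -ε≤u)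

  update-positive : ∀ {w x} → 0ℚ < x ∙ x → Positive G w → Positive G (update w x)
  update-positive {w} {x} 0<xx w-pos = record
    { 0<wᴱ̄ = λ i j ij → 0<* (0<wᴱ̄ i j ij) (-ε≤⇒0<1+ (proj₁ (∣ηpairGain∣≤ε {x} 0<xx i j (nonedge⇒≢ G ij))))
    ; 0<w₀ = subst (0ℚ <_) (sym (update-w₀ w x)) (0<* 0<w₀ (-ε≤⇒0<1+ (proj₁ (∣ηapexGain∣≤ε {x} 0<xx))))
    }
    where open Positive w-pos

  initial-positive : Positive G initial
  initial-positive = record { 0<wᴱ̄ = λ _ _ _ → 0<1 ; 0<w₀ = 0<1 }

  threshold : ℚ
  threshold = 1ℚ / fromℕ ((k ℕ.+ 1) ℕ.* C)

  threshold-* : threshold * (fromℕ (k ℕ.+ 1) * Γ) ≡ 1ℚ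
  threshold-* = trans (cong (threshold *_) (sym (fromℕ-* (k ℕ.+ 1) C)))
    (/-*-cancel 1ℚ (0<fromℕ (ℕ.*-mono-≤ {1} {k ℕ.+ 1} {1} {C} (ℕ.m≤n+m 1 k) (ℕ.≤-trans (s≤s z≤n) 4≤C))))

  -- One quarter is what `1-ε̂^-small` requires in order to have 1 / ε̂ > 3.
  threshold<¼ : threshold < ½ * ½
  threshold<¼ = *-cancelʳ-< 0<X (begin-strict
    threshold * X           ≡⟨ threshold-* ⟩
    1ℚ                      <⟨ <-by {a = 1ℚ} 1ℚ 0<1 refl ⟩
    ½ * ½ * fromℕ 8         ≤⟨ *-monoˡ-≤ (ℚ.<⇒≤ (ℚ.positive⁻¹ (½ * ½))) 8≤X ⟩
    ½ * ½ * X               ∎)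
    where
    open ℚ.≤-Reasoning
    X : ℚ
    X = fromℕ (k ℕ.+ 1) * Γ
    8≤X : fromℕ 8 ≤ X
    8≤X = *-mono-≤ (0≤fromℕ 2) (ℚ.<⇒≤ 0<Γ) (fromℕ-mono-≤ (ℕ.≤-trans 2≤k (ℕ.m≤m+n k 1))) 4≤Γ
    0<X : 0ℚ < X
    0<X = ℚ.<-≤-trans (0<fromℕ-suc 7) 8≤X

-- Instances with a clique

module _ {n} (K : Subset n) where

  indicator : Fin n → ℚ
  indicator i = if lookup K i then 1ℚ else 0ℚ

  indicator-idem : ∀ i → indicator i * indicator i ≡ indicator i
  indicator-idem i with lookup K i
  ... | true  = refl
  ... | false = refl

∑-indicator : ∀ {n} (K : Subset n) → ∑ (indicator K) ≡ fromℕ ∣ K ∣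
∑-indicator []          = refl
∑-indicator (true  ∷ K) = trans (cong (λ z → 1ℚ + z) (∑-indicator K)) (sym (fromℕ-suc ∣ K ∣))
∑-indicator (false ∷ K) = trans (ℚ.+-identityˡ (∑ (indicator K))) (∑-indicator K)

module YesInstance {n} (G : Graph n) (k : ℕ) (2≤k : 2 ℕ.≤ k) (k≤n : k ℕ.≤ n)
  (ε̂ : Cut) (T T̂ : ℕ) (admissible : Algorithm.Admissible G k ε̂ T T̂)
  (K : Subset n) (K-clique : IsClique G K) (∣K∣≡k : ∣ K ∣ ≡ k) where
  open Algorithm G k
  open Admissible admissible
  open Parameters G k 2≤k k≤n

  private
    v : Fin n → ℚ
    v = indicator K

    ∑v : ∑ v ≡ fromℕ k
    ∑v = trans (∑-indicator K) (cong fromℕ ∣K∣≡k)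

    v∙v : v ∙ v ≡ fromℕ k
    v∙v = trans (∑-cong (indicator-idem K)) ∑v

    0<v∙v : 0ℚ < v ∙ v
    0<v∙v = subst (0ℚ <_) (sym v∙v) (0<fromℕ (ℕ.≤-trans (s≤s z≤n) 2≤k))

    nonedge-product : ∀ i j → Nonedge G i j → fromℕ 2 * v i * v j ≡ 0ℚ
    nonedge-product i j ij with lookup K i in Kᵢ | lookup K j in Kⱼ
    ... | false | b     = trans (cong (_* (if b then 1ℚ else 0ℚ)) (ℚ.*-zeroʳ (fromℕ 2))) (ℚ.*-zeroˡ (if b then 1ℚ else 0ℚ))
    ... | true  | false = ℚ.*-zeroʳ (fromℕ 2 * 1ℚ)
    ... | true  | true  = contradiction
      (K-clique (Vec.lookup⇒[]= i K Kᵢ) (Vec.lookup⇒[]= j K Kⱼ) (nonedge⇒≢ G ij)) (proj₂ ij)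

  module _ {p : Weights n} (p-dist : Distribution G p) where
    open Distribution p-dist

    private
      l : ℚ
      l = w₀ p * fromℕ k + 1ℚ

      0<l : 0ℚ < l
      0<l = ℚ.<-≤-trans 0<1 (≤+ˡ 1ℚ (0≤* (ℚ.<⇒≤ 0<p₀) (0≤fromℕ k)))

      rayleigh : l * v ∙ v ≤ v ∙ (matrix p · v)
      rayleigh = ℚ.≤-reflexive (begin
        l * v ∙ v
          ≡⟨ lemma (w₀ p) (fromℕ k) (v ∙ v) ⟩
        w₀ p * (fromℕ k * v ∙ v) + v ∙ v - 0ℚ
          ≡⟨ cong₂ (λ a b → w₀ p * a + v ∙ v - b) (cong₂ _*_ (sym ∑v) (trans v∙v (sym ∑v))) (sym nonedges) ⟩
        w₀ p * (∑ v * ∑ v) + v ∙ v - ∑ᴱ̄ G (λ i j → wᴱ̄ p i j * (fromℕ 2 * v i * v j))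
          ≡⟨ quadraticForm G k p v ⟨
        v ∙ (matrix p · v) ∎)
        where
        open ≡-Reasoning
        lemma : ∀ p k v → (p * k + 1ℚ) * v ≡ p * (k * v) + v - 0ℚ
        lemma = solve-∀ ℚ-ring
        nonedges : ∑ᴱ̄ G (λ i j → wᴱ̄ p i j * (fromℕ 2 * v i * v j)) ≡ 0ℚ
        nonedges = trans (∑ᴱ̄-cong G λ i j ij → trans (cong (wᴱ̄ p i j *_) (nonedge-product i j ij))
          (trans (ℚ.*-zeroʳ (wᴱ̄ p i j)) (sym (ℚ.*-zeroˡ 0ℚ))))
          (trans (sym (*-distribˡ-∑ᴱ̄ G 0ℚ λ _ _ → 0ℚ)) (ℚ.*-zeroˡ (∑ᴱ̄ G λ _ _ → 0ℚ)))

      A-sym : Symmetric (matrix p)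
      A-sym = matrix-symmetric G k p

      A-psd : PositiveSemidefinite (matrix p)
      A-psd = matrix-psd p-dist k

    -- A successful test gives a rational d > ε̂ with β < (1 - d) l. The power method then yields 1
    -- ≤ n (1 - d)^(2 T̂), whereas the bound on T̂, taken with M = 2 n, says 2 n (1 - d)^(2 T̂) < 2.
    ¬belowThreshold : ∀ {β x} → WalkCounting.Output (matrix p) T̂ β x → ¬ BelowThreshold ε̂ p β
    ¬belowThreshold {β} {x} output below =
      absurd (<ᴿ[1-ε̂]*⇒ ε̂-real ε̂-positive 0<β 0<l below)
      where
      open ℚ.≤-Reasoning
      0<xx : 0ℚ < x ∙ x
      0<xx = 0<‖x‖² A-sym A-psd T̂ output
      0<β : 0ℚ < β
      0<β = 0<*⇒0< 0<xx (subst (0ℚ <_) (sym (β‖x‖²≡x∙A·x A-sym A-psd T̂ output))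
        (ℚ.<-≤-trans (0<* 0<p₀ 0<xx) (p₀‖x‖²≤x∙A·x p-dist k x)))
      1≤ : ∀ d → d ≤ 1ℚ → β ≤ (1ℚ - d) * l →
        1ℚ * l ^ (T̂ ℕ.+ T̂) ≤ fromℕ n * (1ℚ - d) ^ (T̂ ℕ.+ T̂) * l ^ (T̂ ℕ.+ T̂)
      1≤ d d≤1 β≤ = begin
        1ℚ * l ^ (T̂ ℕ.+ T̂)
          ≡⟨ ℚ.*-identityˡ (l ^ (T̂ ℕ.+ T̂)) ⟩
        l ^ (T̂ ℕ.+ T̂)
          ≤⟨ rayleigh^≤n*ratio^ A-sym A-psd {v} T̂ 0<v∙v (ℚ.<⇒≤ 0<l) rayleigh 0<β (traceMoment-suc≤ A-sym A-psd T̂ output) ⟩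
        fromℕ n * β ^ (T̂ ℕ.+ T̂)
          ≤⟨ *-monoˡ-≤ (0≤fromℕ n) (^-monoˡ-≤ (ℚ.<⇒≤ 0<β) β≤ (T̂ ℕ.+ T̂)) ⟩
        fromℕ n * ((1ℚ - d) * l) ^ (T̂ ℕ.+ T̂)
          ≡⟨ cong (fromℕ n *_) (^-distrib-* (1ℚ - d) l (T̂ ℕ.+ T̂)) ⟩
        fromℕ n * ((1ℚ - d) ^ (T̂ ℕ.+ T̂) * l ^ (T̂ ℕ.+ T̂))
          ≡⟨ ℚ.*-assoc (fromℕ n) ((1ℚ - d) ^ (T̂ ℕ.+ T̂)) (l ^ (T̂ ℕ.+ T̂)) ⟨
        fromℕ n * (1ℚ - d) ^ (T̂ ℕ.+ T̂) * l ^ (T̂ ℕ.+ T̂) ∎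
      absurd : ∃[ d ] (upper ε̂ d × d < 1ℚ × β < (1ℚ - d) * l) → ⊥
      absurd (d , ε̂<d , d<1 , β<[1-d]l) =
        ℚ.<-irrefl refl (begin-strict
          1ℚ + 1ℚ                                       ≤⟨ *-monoˡ-≤ {a = 1ℚ} {b = fromℕ n * (1ℚ - d) ^ (T̂ ℕ.+ T̂)} (0≤fromℕ 2) (*-cancelʳ-≤ (0<^ 0<l (T̂ ℕ.+ T̂)) (1≤ d (ℚ.<⇒≤ d<1) (ℚ.<⇒≤ β<[1-d]l))) ⟩
          fromℕ 2 * (fromℕ n * (1ℚ - d) ^ (T̂ ℕ.+ T̂))    ≡⟨ trans (sym (ℚ.*-assoc (fromℕ 2) (fromℕ n) ((1ℚ - d) ^ (T̂ ℕ.+ T̂)))) (cong (_* (1ℚ - d) ^ (T̂ ℕ.+ T̂)) (sym (fromℕ-* 2 n))) ⟩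
          fromℕ (2 ℕ.* n) * (1ℚ - d) ^ (T̂ ℕ.+ T̂)        <⟨ 1-ε̂^-small ε̂-real ε̂-positive {T̂ = T̂} (fromℕ-mono-≤ (ℕ.*-monoʳ-≤ 2 2≤n))
                                                            (≤ᴿι⇒upper ε̂-real ε̂-positive ε̂-bound threshold<¼) T̂-bound ε̂<d d<1 ⟩
          1ℚ + 1ℚ                                       ∎)

  loop-yes : ∀ r w → Positive G w → Loop ε̂ T̂ YES r w
  loop-yes zero    w w-pos = refl
  loop-yes (suc r) w w-pos =
    output-exists A-sym A-psd T̂ (0<traceMoment p-dist k 1≤n (T̂ ℕ.+ T̂)) ,
    λ β x output →
      (λ below → contradiction below (¬belowThreshold p-dist output)) ,
      (λ _ → loop-yes r (update w x) (update-positive (0<‖x‖² A-sym A-psd T̂ output) w-pos))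
    where
    p-dist : Distribution G (normalise w)
    p-dist = normalise-distribution w-pos k
    A-sym : Symmetric (matrix (normalise w))
    A-sym = matrix-symmetric G k (normalise w)
    A-psd : PositiveSemidefinite (matrix (normalise w))
    A-psd = matrix-psd p-dist k

-- The inequality of arithmetic and geometric means

-- Convexity: as a function of y, the power y^(m + 1) lies above its tangent at x.
tangent-^ : ∀ {x y} → 0ℚ ≤ x → 0ℚ ≤ y → ∀ m →
  fromℕ (suc m) * y * x ^ m ≤ y ^ suc m + fromℕ m * x ^ suc m
tangent-^ {x} {y} 0≤x 0≤y zero = ℚ.≤-reflexive (lemma x y)
  where
  lemma : ∀ x y → 1ℚ * y * 1ℚ ≡ y * 1ℚ + 0ℚ * (x * 1ℚ)
  lemma = solve-∀ ℚ-ring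
tangent-^ {x} {y} 0≤x 0≤y (suc m) = ≤-by
  ((y * (y ^ suc m + fromℕ m * (x * x ^ m)) - y * (fromℕ (suc m) * y * x ^ m)) +
    fromℕ (suc m) * x ^ m * ((y - x) * (y - x)))
  (0≤+ (≤⇒0≤- (*-monoˡ-≤ 0≤y (tangent-^ 0≤x 0≤y m)))
       (0≤* (0≤* (0≤fromℕ (suc m)) (0≤^ 0≤x m)) (0≤-square (y - x))))
  (trans (cong (λ z → y ^ suc (suc m) + z * x ^ suc (suc m)) (fromℕ-suc m))
    (trans (lemma (fromℕ m) x y (x ^ m) (y ^ suc m))
      (cong₂ (λ a b → a * y * (x * x ^ m) + ((y * (y ^ suc m + fromℕ m * (x * x ^ m)) - y * (b * y * x ^ m)) + b * x ^ m * ((y - x) * (y - x))))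
        (sym (trans (fromℕ-suc (suc m)) (cong (λ z → 1ℚ + z) (fromℕ-suc m)))) (sym (fromℕ-suc m)))))
  where
  lemma : ∀ m x y p q → y * q + (1ℚ + m) * (x * (x * p)) ≡
    (1ℚ + (1ℚ + m)) * y * (x * p) +
    ((y * (q + m * (x * p)) - y * ((1ℚ + m) * y * p)) + (1ℚ + m) * p * ((y - x) * (y - x)))
  lemma = solve-∀ ℚ-ring

-- (s / W) ^ W bounds P, with denominators cleared.
record Mean (W : ℕ) (s P : ℚ) : Set where
  constructor mean
  field
    0≤s  : 0ℚ ≤ s
    0≤P  : 0ℚ ≤ P
    gm≤am : fromℕ W ^ W * P ≤ s ^ W

-- The tangent inequality at y = W (a + s) and x = (W + 1) s, which are the new and the old
-- arithmetic mean scaled by W (W + 1). The case W = 0 is separate because a power of W is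
-- cancelled.
Mean-∷ : ∀ {W s P a} → 0ℚ ≤ a → Mean W s P → Mean (suc W) (a + s) (a * P)
Mean-∷ {zero} {s} {P} {a} 0≤a (mean 0≤s 0≤P P≤1) = mean (0≤+ 0≤a 0≤s) (0≤* 0≤a 0≤P) (begin
  1ℚ * 1ℚ * (a * P)   ≡⟨ lemma a P ⟩
  a * (1ℚ * P)        ≤⟨ *-monoˡ-≤ 0≤a P≤1 ⟩
  a * 1ℚ              ≤⟨ *-monoʳ-≤ 0≤1 (≤+ a 0≤s) ⟩
  (a + s) * 1ℚ        ∎)
  where
  open ℚ.≤-Reasoning
  lemma : ∀ a p → 1ℚ * 1ℚ * (a * p) ≡ a * (1ℚ * p)
  lemma = solve-∀ ℚ-ring
Mean-∷ {W@(suc w-1)} {s} {P} {a} 0≤a (mean 0≤s 0≤P gm≤am) =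
  mean (0≤+ 0≤a 0≤s) (0≤* 0≤a 0≤P) (*-cancelˡ-≤ (0<^ 0<w (suc W)) (begin
    w * w ^ W * (w′ * w′ ^ W * (a * P))
      ≡⟨ lemma₁ w (w ^ W) w′ (w′ ^ W) a P ⟩
    w * (w′ * w′ ^ W) * a * (w ^ W * P)
      ≤⟨ *-monoˡ-≤ (0≤* (0≤* (ℚ.<⇒≤ 0<w) (0≤* 0≤w′ (0≤^ 0≤w′ W))) 0≤a) gm≤am ⟩
    w * (w′ * w′ ^ W) * a * s ^ W
      ≡⟨ lemma₂ w w′ (w′ ^ W) a s (s ^ W) ⟩
    w′ * (w * (a + s)) * (s ^ W * w′ ^ W) - w * ((s * w′) * (s ^ W * w′ ^ W))
      ≡⟨ cong (λ z → w′ * (w * (a + s)) * z - w * ((s * w′) * z)) (^-distrib-* s w′ W) ⟨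
    w′ * (w * (a + s)) * (s * w′) ^ W - w * (s * w′) ^ suc W
      ≤⟨ ℚ.+-monoˡ-≤ (- (w * (s * w′) ^ suc W)) (tangent-^ (0≤* 0≤s 0≤w′) (0≤* (ℚ.<⇒≤ 0<w) (0≤+ 0≤a 0≤s)) W) ⟩
    (w * (a + s)) ^ suc W + w * (s * w′) ^ suc W - w * (s * w′) ^ suc W
      ≡⟨ lemma₃ ((w * (a + s)) ^ suc W) (w * (s * w′) ^ suc W) ⟩
    (w * (a + s)) ^ suc W
      ≡⟨ ^-distrib-* w (a + s) (suc W) ⟩
    w ^ suc W * (a + s) ^ suc W ∎))
  where
  open ℚ.≤-Reasoning
  w w′ : ℚ
  w  = fromℕ W
  w′ = fromℕ (suc W)
  0<w : 0ℚ < w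
  0<w = 0<fromℕ-suc w-1
  0≤w′ : 0ℚ ≤ w′
  0≤w′ = 0≤fromℕ (suc W)
  lemma₁ : ∀ w x w′ y a p → w * x * (w′ * y * (a * p)) ≡ w * (w′ * y) * a * (x * p)
  lemma₁ = solve-∀ ℚ-ring
  lemma₂ : ∀ w w′ y a s z → w * (w′ * y) * a * z ≡ w′ * (w * (a + s)) * (z * y) - w * ((s * w′) * (z * y))
  lemma₂ = solve-∀ ℚ-ring
  lemma₃ : ∀ a b → a + b - b ≡ a
  lemma₃ = solve-∀ ℚ-ring

-- P is a product of W nonnegative numbers with sum s.
record MeanStep (W : ℕ) (s P : ℚ) : Set where
  constructor meanStep
  field
    extend : ∀ {W′ s′ P′} → Mean W′ s′ P′ → Mean (W ℕ.+ W′) (s + s′) (P * P′)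

open MeanStep

step-one : ∀ {a} → 0ℚ ≤ a → MeanStep 1 a a
step-one 0≤a = meanStep (Mean-∷ 0≤a)

step-none : MeanStep 0 0ℚ 1ℚ
step-none = meanStep λ {W′} {s′} {P′} m → subst₂ (Mean W′) (sym (ℚ.+-identityˡ s′)) (sym (ℚ.*-identityˡ P′)) m

-- Merging two bounds of the form `Mean` would call for a weighted inequality of means; as
-- extensions of an arbitrary further family they simply compose.
step-* : ∀ {W s P W′ s′ P′} → MeanStep W s P → MeanStep W′ s′ P′ → MeanStep (W ℕ.+ W′) (s + s′) (P * P′)
step-* {W} {s} {P} {W′} {s′} {P′} f g = meanStep go
  where
  go : ∀ {W″ s″ P″} → Mean W″ s″ P″ → Mean (W ℕ.+ W′ ℕ.+ W″) (s + s′ + s″) (P * P′ * P″)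
  go {W″} {s″} {P″} m
    rewrite ℕ.+-assoc W W′ W″ | ℚ.+-assoc s s′ s″ | ℚ.*-assoc P P′ P″ = extend f (extend g m)

step-∏ : ∀ {m W} {s P : Fin m → ℚ} → (∀ i → MeanStep W (s i) (P i)) → MeanStep (m ℕ.* W) (∑ s) (∏ P)
step-∏ {zero}          f = step-none
step-∏ {suc m} {W} {s} {P} f = step-* (f zero) (step-∏ (f ∘ suc))

step-^ : ∀ {a} → 0ℚ ≤ a → ∀ c → MeanStep c (fromℕ c * a) (a ^ c)
step-^ {a} 0≤a zero    = subst (λ z → MeanStep 0 z 1ℚ) (sym (ℚ.*-zeroˡ a)) step-none
step-^ {a} 0≤a (suc c) = subst (λ z → MeanStep (suc c) z (a * a ^ c))
  (trans (lemma a (fromℕ c)) (cong (_* a) (sym (fromℕ-suc c))))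
  (step-* (step-one 0≤a) (step-^ 0≤a c))
  where
  lemma : ∀ a c → a + c * a ≡ (1ℚ + c) * a
  lemma = solve-∀ ℚ-ring

sum≤count⇒product≤1 : ∀ {W s P} → MeanStep W s P → s ≤ fromℕ W → P ≤ 1ℚ
sum≤count⇒product≤1 {W} {s} {P} f s≤W = *-cancelˡ-≤ (0<W^W W) (begin
  fromℕ W ^ W * P   ≡⟨ cong (fromℕ W ^ W *_) (ℚ.*-identityʳ P) ⟨
  fromℕ W ^ W * (P * 1ℚ)   ≡⟨ cong (λ V → fromℕ V ^ V * (P * 1ℚ)) (ℕ.+-identityʳ W) ⟨
  fromℕ (W ℕ.+ 0) ^ (W ℕ.+ 0) * (P * 1ℚ)   ≤⟨ Mean.gm≤am total ⟩
  (s + 0ℚ) ^ (W ℕ.+ 0)     ≡⟨ cong₂ _^_ (ℚ.+-identityʳ s) (ℕ.+-identityʳ W) ⟩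
  s ^ W             ≤⟨ ^-monoˡ-≤ 0≤s s≤W W ⟩
  fromℕ W ^ W       ≡⟨ ℚ.*-identityʳ (fromℕ W ^ W) ⟨
  fromℕ W ^ W * 1ℚ  ∎)
  where
  open ℚ.≤-Reasoning
  total : Mean (W ℕ.+ 0) (s + 0ℚ) (P * 1ℚ)
  total = extend f (mean ℚ.≤-refl 0≤1 ℚ.≤-refl)
  0≤s : 0ℚ ≤ s
  0≤s = subst (0ℚ ≤_) (ℚ.+-identityʳ s) (Mean.0≤s total)
  -- True also for W = 0, where the power is 0 ^ 0 = 1.
  0<W^W : ∀ W → 0ℚ < fromℕ W ^ W
  0<W^W zero    = 0<1
  0<W^W (suc W) = 0<^ (0<fromℕ-suc W) (suc W)

bernoulli : ∀ {y} → 0ℚ ≤ y → y ≤ 1ℚ → ∀ m → 1ℚ - fromℕ m * y ≤ (1ℚ - y) ^ m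
bernoulli {y} 0≤y y≤1 zero = ℚ.≤-reflexive (lemma y)
  where
  lemma : ∀ y → 1ℚ - 0ℚ * y ≡ 1ℚ
  lemma = solve-∀ ℚ-ring
bernoulli {y} 0≤y y≤1 (suc m) = begin
  1ℚ - fromℕ (suc m) * y                          ≡⟨ cong (λ z → 1ℚ - z * y) (fromℕ-suc m) ⟩
  1ℚ - (1ℚ + fromℕ m) * y                         ≤⟨ ≤-by _ (0≤* (0≤fromℕ m) (0≤-square y)) (lemma (fromℕ m) y) ⟩
  (1ℚ - y) * (1ℚ - fromℕ m * y)                   ≤⟨ *-monoˡ-≤ (≤⇒0≤- y≤1) (bernoulli 0≤y y≤1 m) ⟩
  (1ℚ - y) * (1ℚ - y) ^ m                         ∎
  where
  open ℚ.≤-Reasoning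
  lemma : ∀ m y → (1ℚ - y) * (1ℚ - m * y) ≡ 1ℚ - (1ℚ + m) * y + m * (y * y)
  lemma = solve-∀ ℚ-ring

∏-mono : ∀ {m} {f g : Fin m → ℚ} → (∀ i → 0ℚ ≤ f i) → (∀ i → f i ≤ g i) → ∏ f ≤ ∏ g
∏-mono {zero}  0≤f f≤g = ℚ.≤-refl
∏-mono {suc m} 0≤f f≤g = *-mono-≤ (0≤f zero) (ℚ.≤-trans (0≤∏ (0≤f ∘ suc)) (∏-mono (0≤f ∘ suc) (f≤g ∘ suc)))
  (f≤g zero) (∏-mono (0≤f ∘ suc) (f≤g ∘ suc))

∏-const : ∀ m a → ∏ {m} (λ _ → a) ≡ a ^ m
∏-const zero    a = refl
∏-const (suc m) a = cong (a *_) (∏-const m a)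

1≤∏ : ∀ {m} {f : Fin m → ℚ} → (∀ i → 1ℚ ≤ f i) → 1ℚ ≤ ∏ f
1≤∏ {m} 1≤f = ℚ.≤-trans (ℚ.≤-reflexive (sym (trans (∏-const m 1ℚ) (1^ m)))) (∏-mono (λ _ → 0≤1) 1≤f)

-- Sums over monochromatic pairs

∑-punchIn : ∀ {n} i (g : Fin (suc n) → ℚ) → ∑ g ≡ g i + ∑ (λ j → g (punchIn i j))
∑-punchIn i g = CMSum.sum-remove ℚ.+-0-commutativeMonoid {i = i} g

module _ {n c} (f : Fin n → Fin c) (x : Fin n → ℚ) where

  private
    colourSum : Fin c → ℚ
    colourSum a = ∑ λ i → I (f i) a * x i

    ∑-colourSum : ∑ colourSum ≡ ∑ x
    ∑-colourSum = trans (∑-comm λ a i → I (f i) a * x i) (∑-cong λ i → ∑-I (f i) λ _ → x i)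

    ∑-colourSum² : colourSum ∙ colourSum ≡ ∑ λ i → ∑ λ j → I (f i) (f j) * (x i * x j)
    ∑-colourSum² = begin
      ∑ (λ a → colourSum a * colourSum a)
        ≡⟨ ∑-cong (λ a → ∑-*-∑ (λ i → I (f i) a * x i) (λ i → I (f i) a * x i)) ⟩
      ∑ (λ a → ∑ λ i → ∑ λ j → I (f i) a * x i * (I (f j) a * x j))
        ≡⟨ trans (∑-comm λ a i → ∑ λ j → I (f i) a * x i * (I (f j) a * x j))
             (∑-cong λ i → ∑-comm λ a j → I (f i) a * x i * (I (f j) a * x j)) ⟩
      ∑ (λ i → ∑ λ j → ∑ λ a → I (f i) a * x i * (I (f j) a * x j))
        ≡⟨ ∑-cong (λ i → ∑-cong λ j → trans
             (∑-cong λ a → lemma (I (f i) a) (x i) (I (f j) a) (x j))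
             (∑-I (f i) λ a → I (f j) a * (x i * x j))) ⟩
      ∑ (λ i → ∑ λ j → I (f j) (f i) * (x i * x j))
        ≡⟨ ∑-cong (λ i → ∑-cong λ j → cong (_* (x i * x j)) (I-sym (f j) (f i))) ⟩
      ∑ (λ i → ∑ λ j → I (f i) (f j) * (x i * x j)) ∎
      where
      open ≡-Reasoning
      lemma : ∀ a b c d → a * b * (c * d) ≡ a * (c * (b * d))
      lemma = solve-∀ ℚ-ring

  -- Cauchy-Schwarz over the c colour classes.
  ∑²≤c*monochromatic : ∑ x * ∑ x ≤ fromℕ c * ∑ λ i → ∑ λ j → I (f i) (f j) * (x i * x j)
  ∑²≤c*monochromatic = subst₂ _≤_ (cong₂ _*_ ∑-colourSum ∑-colourSum) (cong (fromℕ c *_) ∑-colourSum²)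
    (∑²≤n‖x‖² colourSum)

-- The infeasible combination of constraints

module Constraints {n′} (G : Graph (suc n′)) (c : ℕ) (2≤k : 2 ℕ.≤ suc c) (k≤n : suc c ℕ.≤ suc n′)
  (f : Fin (suc n′) → Fin c) (f-proper : ∀ {u v} → Graph._~_ G u v → f u ≢ f v) where

  private
    n : ℕ
    n = suc n′

  open Algorithm G (suc c)
  open Parameters G (suc c) 2≤k k≤n

  -- `punchIn i` enumerates the vertices other than i, so each unordered pair counts twice.
  monochromaticSum : (Fin n → ℚ) → ℚ
  monochromaticSum x = ∑ λ i → ∑ λ j → I (f i) (f (punchIn i j)) * (x i * x (punchIn i j))

  ∑²≤c*[‖x‖²+M] : ∀ x → ∑ x * ∑ x ≤ fromℕ c * (x ∙ x + monochromaticSum x)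
  ∑²≤c*[‖x‖²+M] x = ℚ.≤-trans (∑²≤c*monochromatic f x) (ℚ.≤-reflexive (cong (fromℕ c *_)
    (trans (∑-cong λ i → trans (∑-punchIn i λ j → I (f i) (f j) * (x i * x j))
        (cong (_+ ∑ λ j → I (f i) (f (punchIn i j)) * (x i * x (punchIn i j)))
          (trans (cong (_* (x i * x i)) (I-refl (f i))) (ℚ.*-identityˡ (x i * x i)))))
      (∑-distrib-+ (λ i → x i * x i) λ i → ∑ λ j → I (f i) (f (punchIn i j)) * (x i * x (punchIn i j))))))

  -- Weights are meaningful only at i < j, while the constraints run over ordered pairs.
  nonedgeWeight : Weights n → Fin n → Fin n → ℚ
  nonedgeWeight w i j = if does (i Fin.<? j) then wᴱ̄ w i j else wᴱ̄ w j i

  -- Monochromatic pairs are nonedges, as the colouring is proper. All other pairs carry the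
  -- constant weight 1 and gain 0; they pad the number of factors to exactly `C`.
  pairWeight : Weights n → Fin n → Fin n → ℚ
  pairWeight w i j = if does (f i Fin.≟ f j) then nonedgeWeight w i j else 1ℚ

  relativeGain : (Fin n → ℚ) → Fin n → Fin n → ℚ
  relativeGain x i j = I (f i) (f j) * (η * pairGain x i j)

  apexRelativeGain : (Fin n → ℚ) → ℚ
  apexRelativeGain x = η * apexGain x

  private
    pairGain-sym : ∀ x i j → pairGain x i j ≡ pairGain x j i
    pairGain-sym x i j = cong (_/ (x ∙ x)) (lemma (fromℕ 2) (x i) (x j))
      where
      lemma : ∀ a b c → a * b * c ≡ a * c * b
      lemma = solve-∀ ℚ-ring

    monochromatic⇒nonedge : ∀ i j → i ≢ j → f i ≡ f j →
      (does (i Fin.<? j) ≡ true × Nonedge G i j) ⊎ (does (i Fin.<? j) ≡ false × Nonedge G j i)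
    monochromatic⇒nonedge i j i≢j fi≡fj with i Fin.<? j
    ... | yes i<j = inj₁ (dec-true (i Fin.<? j) i<j , i<j , λ i~j → f-proper i~j fi≡fj)
    ... | no i≮j  = inj₂ (dec-false (i Fin.<? j) i≮j , ℕ.≤∧≢⇒< (ℕ.≮⇒≥ i≮j) (λ j≡i → i≢j (sym (Fin.toℕ-injective j≡i))) ,
      λ j~i → f-proper j~i (sym fi≡fj))

  pairWeight-update : ∀ w x i j → i ≢ j →
    pairWeight (update w x) i j ≡ pairWeight w i j * (1ℚ + relativeGain x i j)
  pairWeight-update w x i j i≢j = go (f i Fin.≟ f j) (i Fin.<? j)
    where
    lemma₁ : ∀ g → 1ℚ ≡ 1ℚ * (1ℚ + 0ℚ * g)
    lemma₁ = solve-∀ ℚ-ring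
    lemma₂ : ∀ a g → a * (1ℚ + g) ≡ a * (1ℚ + 1ℚ * g)
    lemma₂ = solve-∀ ℚ-ring
    go : ∀ {P Q : Set} (f? : Dec P) (<? : Dec Q) →
      (if does f? then (if does <? then wᴱ̄ (update w x) i j else wᴱ̄ (update w x) j i) else 1ℚ) ≡
      (if does f? then (if does <? then wᴱ̄ w i j else wᴱ̄ w j i) else 1ℚ) *
        (1ℚ + (if does f? then 1ℚ else 0ℚ) * (η * pairGain x i j))
    go (no _)  _       = lemma₁ (η * pairGain x i j)
    go (yes _) (yes _) = lemma₂ (wᴱ̄ w i j) (η * pairGain x i j)
    go (yes _) (no _)  = trans (cong (λ g → wᴱ̄ w j i * (1ℚ + η * g)) (pairGain-sym x j i))
      (lemma₂ (wᴱ̄ w j i) (η * pairGain x i j))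

  module _ {w} (w-pos : Positive G w) where
    open Positive w-pos

    nonedge-bounds : ∀ {B} → totalWeight G w ≤ B → ∀ i j → Nonedge G i j → 0ℚ ≤ wᴱ̄ w i j × wᴱ̄ w i j ≤ B
    nonedge-bounds total≤B i j ij = ℚ.<⇒≤ (0<wᴱ̄ i j ij) ,
      ℚ.≤-trans (term≤∑ᴱ̄ G (λ i j ij → ℚ.<⇒≤ (0<wᴱ̄ i j ij)) i j ij)
        (ℚ.≤-trans (≤+ (∑ᴱ̄ G (wᴱ̄ w)) (ℚ.<⇒≤ 0<w₀)) total≤B)

    pairWeight-bounds : ∀ {B} → 1ℚ ≤ B → totalWeight G w ≤ B → ∀ i j → i ≢ j →
      0ℚ ≤ pairWeight w i j × pairWeight w i j ≤ B
    pairWeight-bounds {B} 1≤B total≤B i j i≢j with f i Fin.≟ f j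
    ... | no _ = 0≤1 , 1≤B
    ... | yes fi≡fj with monochromatic⇒nonedge i j i≢j fi≡fj
    ...   | inj₁ (eq , ij) rewrite eq = nonedge-bounds total≤B i j ij
    ...   | inj₂ (eq , ji) rewrite eq = nonedge-bounds total≤B j i ji

  -- The product over the multiset of 2 + c n (n - 1) = C constraints that proves infeasibility.
  constraintProduct : (Fin n → Fin n → ℚ) → ℚ → ℚ
  constraintProduct a a₀ = a₀ * (a₀ * ∏ λ i → ∏ λ j → a i (punchIn i j) ^ c)

  constraintSum : (Fin n → Fin n → ℚ) → ℚ → ℚ
  constraintSum a a₀ = a₀ + (a₀ + ∑ λ i → ∑ λ j → fromℕ c * a i (punchIn i j))

  constraintProduct-* : ∀ a b a₀ b₀ →
    constraintProduct (λ i j → a i j * b i j) (a₀ * b₀) ≡ constraintProduct a a₀ * constraintProduct b b₀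
  constraintProduct-* a b a₀ b₀ = trans
    (cong (λ z → a₀ * b₀ * (a₀ * b₀ * z))
      (trans (∏-cong λ i → trans (∏-cong λ j → ^-distrib-* (a i (punchIn i j)) (b i (punchIn i j)) c)
          (∏-distrib-* (λ j → a i (punchIn i j) ^ c) (λ j → b i (punchIn i j) ^ c)))
        (∏-distrib-* (λ i → ∏ λ j → a i (punchIn i j) ^ c) (λ i → ∏ λ j → b i (punchIn i j) ^ c))))
    (lemma a₀ b₀ (∏ λ i → ∏ λ j → a i (punchIn i j) ^ c) (∏ λ i → ∏ λ j → b i (punchIn i j) ^ c))
    where
    lemma : ∀ a b p q → a * b * (a * b * (p * q)) ≡ a * (a * p) * (b * (b * q))
    lemma = solve-∀ ℚ-ring

  constraintProduct-cong : ∀ {a b a₀ b₀} → (∀ i j → i ≢ j → a i j ≡ b i j) → a₀ ≡ b₀ →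
    constraintProduct a a₀ ≡ constraintProduct b b₀
  constraintProduct-cong {b₀ = b₀} a≗b refl = cong (λ z → b₀ * (b₀ * z))
    (∏-cong λ i → ∏-cong λ j → cong (_^ c) (a≗b i (punchIn i j) (Fin.punchInᵢ≢i i j ∘ sym)))

  0≤constraintProduct : ∀ {a a₀} → (∀ i j → i ≢ j → 0ℚ ≤ a i j) → 0ℚ ≤ a₀ → 0ℚ ≤ constraintProduct a a₀
  0≤constraintProduct 0≤a 0≤a₀ = 0≤* 0≤a₀ (0≤* 0≤a₀ (0≤∏ λ i → 0≤∏ λ j →
    0≤^ (0≤a i (punchIn i j) (Fin.punchInᵢ≢i i j ∘ sym)) c))

  1≤constraintProduct : ∀ {a a₀} → (∀ i j → i ≢ j → 1ℚ ≤ a i j) → 1ℚ ≤ a₀ → 1ℚ ≤ constraintProduct a a₀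
  1≤constraintProduct 1≤a 1≤a₀ = 1≤* 1≤a₀ (1≤* 1≤a₀ (1≤∏ λ i → 1≤∏ λ j →
    1≤^ (1≤a i (punchIn i j) (Fin.punchInᵢ≢i i j ∘ sym)) c))
    where
    1≤* : ∀ {a b} → 1ℚ ≤ a → 1ℚ ≤ b → 1ℚ ≤ a * b
    1≤* 1≤a 1≤b = *-mono-≤ 0≤1 (ℚ.≤-trans 0≤1 1≤b) 1≤a 1≤b

  constraintProduct≤^C : ∀ {a a₀ B} → (∀ i j → i ≢ j → 0ℚ ≤ a i j × a i j ≤ B) → 0ℚ ≤ a₀ → a₀ ≤ B →
    constraintProduct a a₀ ≤ B ^ C
  constraintProduct≤^C {a} {a₀} {B} a-bounds 0≤a₀ a₀≤B = begin
    constraintProduct a a₀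
      ≤⟨ *-mono-≤ 0≤a₀ (0≤* 0≤B 0≤rest) a₀≤B (*-mono-≤ 0≤a₀ 0≤rest a₀≤B
           (∏-mono (λ i → 0≤∏ λ j → 0≤factor i j) λ i → ∏-mono (0≤factor i) (factor≤ i))) ⟩
    B * (B * ∏ {n} (λ _ → ∏ {n′} λ _ → B ^ c))
      ≡⟨ cong (λ z → B * (B * z)) (trans (∏-cong {n} λ _ → trans (∏-const n′ (B ^ c)) (^-assocʳ B c n′))
           (trans (∏-const n (B ^ (c ℕ.* n′))) (^-assocʳ B (c ℕ.* n′) n))) ⟩
    B ^ (2 ℕ.+ c ℕ.* n′ ℕ.* n)
      ≡⟨ cong (B ^_) (trans (ℕ.+-comm 2 (c ℕ.* n′ ℕ.* n)) (cong (ℕ._+ 2) (trans (ℕ.*-assoc c n′ n)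
           (trans (cong (c ℕ.*_) (ℕ.*-comm n′ n)) (sym (ℕ.*-assoc c n n′)))))) ⟩
    B ^ C ∎
    where
    open ℚ.≤-Reasoning
    0≤B : 0ℚ ≤ B
    0≤B = ℚ.≤-trans 0≤a₀ a₀≤B
    0≤rest : 0ℚ ≤ ∏ {n} (λ _ → ∏ {n′} λ _ → B ^ c)
    0≤rest = 0≤∏ {n} λ _ → 0≤∏ {n′} λ _ → 0≤^ 0≤B c
    0≤factor : ∀ i j → 0ℚ ≤ a i (punchIn i j) ^ c
    0≤factor i j = 0≤^ (proj₁ (a-bounds i (punchIn i j) (Fin.punchInᵢ≢i i j ∘ sym))) c
    factor≤ : ∀ i j → a i (punchIn i j) ^ c ≤ B ^ c
    factor≤ i j = ^-monoˡ-≤ (proj₁ a-b) (proj₂ a-b) c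
      where a-b = a-bounds i (punchIn i j) (Fin.punchInᵢ≢i i j ∘ sym)

  constraintProduct-step : ∀ {a a₀} → (∀ i j → i ≢ j → 0ℚ ≤ a i j) → 0ℚ ≤ a₀ →
    MeanStep (2 ℕ.+ n ℕ.* (n′ ℕ.* c)) (constraintSum a a₀) (constraintProduct a a₀)
  constraintProduct-step 0≤a 0≤a₀ = step-* (step-one 0≤a₀) (step-* (step-one 0≤a₀)
    (step-∏ λ i → step-∏ λ j → step-^ (0≤a i (punchIn i j) (Fin.punchInᵢ≢i i j ∘ sym)) c))

  potential : Weights n → ℚ
  potential w = constraintProduct (pairWeight w) (w₀ w)

  potential-update : ∀ w x → potential (update w x) ≡
    potential w * constraintProduct (λ i j → 1ℚ + relativeGain x i j) (1ℚ + apexRelativeGain x)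
  potential-update w x = trans
    (constraintProduct-cong (pairWeight-update w x) (update-w₀ w x))
    (constraintProduct-* (pairWeight w) (λ i j → 1ℚ + relativeGain x i j) (w₀ w) (1ℚ + apexRelativeGain x))

  potential≤^C : ∀ {w B} → Positive G w → 1ℚ ≤ B → totalWeight G w ≤ B → potential w ≤ B ^ C
  potential≤^C {w} w-pos 1≤B total≤B = constraintProduct≤^C (pairWeight-bounds w-pos 1≤B total≤B)
    (ℚ.<⇒≤ 0<w₀) (ℚ.≤-trans (≤+ˡ (w₀ w) (0≤∑ᴱ̄ G λ i j ij → ℚ.<⇒≤ (0<wᴱ̄ i j ij))) total≤B)
    where open Positive w-pos

  0≤potential : ∀ {w} → Positive G w → 0ℚ ≤ potential w
  0≤potential w-pos = 0≤constraintProduct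
    (λ i j i≢j → proj₁ (pairWeight-bounds w-pos (≤+ˡ 1ℚ (ℚ.<⇒≤ (0<totalWeight w-pos (suc c)))) (≤+ _ 0≤1) i j i≢j))
    (ℚ.<⇒≤ (Positive.0<w₀ w-pos))

-- Instances without a clique

square-mono : ∀ {u b} → - b ≤ u → u ≤ b → u * u ≤ b * b
square-mono {u} {b} -b≤u u≤b = ≤-by _ (0≤* (≤⇒0≤- u≤b) (≤⇒0≤- -b≤u)) (lemma u b)
  where
  lemma : ∀ u b → b * b ≡ u * u + (b - u) * (u - - b)
  lemma = solve-∀ ℚ-ring

I-cases : ∀ {n} (i j : Fin n) → I i j ≡ 0ℚ ⊎ I i j ≡ 1ℚ
I-cases i j with i Fin.≟ j
... | yes _ = inj₂ refl
... | no _  = inj₁ refl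

0-1-scale-bounds : ∀ {χ u b} → χ ≡ 0ℚ ⊎ χ ≡ 1ℚ → 0ℚ ≤ b → - b ≤ u → u ≤ b →
  - b ≤ χ * u × χ * u ≤ b
0-1-scale-bounds {u = u} {b} (inj₁ refl) 0≤b _ _ =
  subst (λ z → - b ≤ z × z ≤ b) (sym (ℚ.*-zeroˡ u)) (ℚ.neg-antimono-≤ 0≤b , 0≤b)
0-1-scale-bounds {u = u} {b} (inj₂ refl) _ -b≤u u≤b =
  subst (λ z → - b ≤ z × z ≤ b) (sym (ℚ.*-identityˡ u)) (-b≤u , u≤b)

module NoInstance {n′} (G : Graph (suc n′)) (c : ℕ) (2≤k : 2 ℕ.≤ suc c) (k≤n : suc c ℕ.≤ suc n′)
  (f : Fin (suc n′) → Fin c) (f-proper : ∀ {u v} → Graph._~_ G u v → f u ≢ f v) where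
  open Algorithm G (suc c)
  open Parameters G (suc c) 2≤k k≤n
  open Constraints G c 2≤k k≤n f f-proper

  private
    n : ℕ
    n = suc n′

    -- `κ` exceeds 1 to absorb the cubic error in the expansion of 1 / (1 + u). The growth rate `v₀`
    -- is 2 η less the 3 η / 8 that the second-order terms can cost.
    ⅛ κ v₀ N′ c′ : ℚ
    ⅛  = ½ * ½ * ½
    κ  = fromℕ 9 * ⅛
    v₀ = fromℕ 13 * ⅛ * η
    N′ = fromℕ n′
    c′ = fromℕ c

    0≤⅛ : 0ℚ ≤ ⅛
    0≤⅛ = ℚ.nonNegative⁻¹ ⅛

    0≤κ : 0ℚ ≤ κ
    0≤κ = ℚ.nonNegative⁻¹ κ

    0≤v₀ : 0ℚ ≤ v₀
    0≤v₀ = 0≤* (ℚ.nonNegative⁻¹ (fromℕ 13 * ⅛)) (ℚ.<⇒≤ 0<η)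

  -- An upper bound of 1 / (1 + u) that is accurate to second order in u.
  approxInverse : ℚ → ℚ
  approxInverse u = 1ℚ - u + κ * (u * u)

  -- The product equals 1 + u² (1 + 9 u) / 8, and u ≥ - ε ≥ - 1 / 16.
  1≤[1+u]*approxInverse : ∀ {u} → - ε ≤ u → 1ℚ ≤ (1ℚ + u) * approxInverse u
  1≤[1+u]*approxInverse {u} -ε≤u = ≤-by _
    (0≤* (0≤-square u) (0≤+ (0≤* 0≤κ (≤⇒0≤- -ε≤u)) (0≤* 0≤⅛ (0≤+ (≤⇒0≤- 16ε≤1) (0≤* (0≤fromℕ 7) (ℚ.<⇒≤ 0<ε))))))
    (lemma u ε)
    where
    lemma : ∀ u e → (1ℚ + u) * (1ℚ - u + fromℕ 9 * (½ * ½ * ½) * (u * u)) ≡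
      1ℚ + u * u * (fromℕ 9 * (½ * ½ * ½) * (u - - e) + ½ * ½ * ½ * (1ℚ - fromℕ 16 * e + fromℕ 7 * e))
    lemma = solve-∀ ℚ-ring

  0≤approxInverse : ∀ {u} → u ≤ ε → 0ℚ ≤ approxInverse u
  0≤approxInverse {u} u≤ε = 0≤+ (≤⇒0≤- (ℚ.≤-trans u≤ε (ℚ.<⇒≤ ε<1))) (0≤* 0≤κ (0≤-square u))

  private
    η*2N²Γ≡1 : η * (fromℕ 2 * N * N * Γ) ≡ 1ℚ
    η*2N²Γ≡1 = trans (lemma η (fromℕ 2) N Γ) (trans (cong (_* (fromℕ 2 * N * Γ)) ηN≡ε) ε*2NΓ≡1)
      where
      lemma : ∀ h t n g → h * (t * n * n * g) ≡ h * n * (t * n * g)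
      lemma = solve-∀ ℚ-ring

    Γ≡ : Γ ≡ c′ * N * N′ + fromℕ 2
    Γ≡ = trans (fromℕ-+ (c ℕ.* n ℕ.* n′) 2) (cong (_+ fromℕ 2)
      (trans (fromℕ-* (c ℕ.* n) n′) (cong (_* N′) (fromℕ-* c n))))

    -- The pairs contribute c n (n - 1) squares of size η², the apex two of size ε² = (η n)². By 2
    -- n² C η = 1 the claim reduces to 3 (C - 2 + 2 n²) ≤ 2 n² C.
    secondOrder : κ * (c′ * N * N′ * (η * η) + fromℕ 2 * (ε * ε)) ≤ fromℕ 3 * ⅛ * η
    secondOrder = begin
      κ * (c′ * N * N′ * (η * η) + fromℕ 2 * (ε * ε))
        ≡⟨ cong₂ (λ e g → κ * (g * (η * η) + fromℕ 2 * (e * e))) (sym ηN≡ε) cNN′≡ ⟩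
      κ * ((Γ - fromℕ 2) * (η * η) + fromℕ 2 * (η * N * (η * N)))
        ≡⟨ lemma₁ η Γ N ⟩
      fromℕ 3 * ⅛ * η * (η * (fromℕ 3 * (Γ - fromℕ 2 + fromℕ 2 * (N * N))))
        ≤⟨ *-monoˡ-≤ (0≤* (ℚ.nonNegative⁻¹ (fromℕ 3 * ⅛)) (ℚ.<⇒≤ 0<η)) (*-monoˡ-≤ (ℚ.<⇒≤ 0<η) polynomial) ⟩
      fromℕ 3 * ⅛ * η * (η * (fromℕ 2 * N * N * Γ))
        ≡⟨ cong (fromℕ 3 * ⅛ * η *_) η*2N²Γ≡1 ⟩
      fromℕ 3 * ⅛ * η * 1ℚ
        ≡⟨ ℚ.*-identityʳ (fromℕ 3 * ⅛ * η) ⟩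
      fromℕ 3 * ⅛ * η ∎
      where
      open ℚ.≤-Reasoning
      cNN′≡ : c′ * N * N′ ≡ Γ - fromℕ 2
      cNN′≡ = trans (lemma (c′ * N * N′)) (cong (_- fromℕ 2) (sym Γ≡))
        where
        lemma : ∀ a → a ≡ a + fromℕ 2 - fromℕ 2
        lemma = solve-∀ ℚ-ring
      lemma₁ : ∀ h g n → fromℕ 9 * (½ * ½ * ½) * ((g - fromℕ 2) * (h * h) + fromℕ 2 * (h * n * (h * n))) ≡
        fromℕ 3 * (½ * ½ * ½) * h * (h * (fromℕ 3 * (g - fromℕ 2 + fromℕ 2 * (n * n))))
      lemma₁ = solve-∀ ℚ-ring
      a b : ℚ
      a = N - fromℕ 2
      b = Γ - fromℕ 4
      0≤a : 0ℚ ≤ a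
      0≤a = ≤⇒0≤- 2≤N
      0≤b : 0ℚ ≤ b
      0≤b = ≤⇒0≤- 4≤Γ
      -- Expanded at the corner N = 2, Γ = 4 of the admissible range, the difference has only
      -- positive coefficients.
      polynomial : fromℕ 3 * (Γ - fromℕ 2 + fromℕ 2 * (N * N)) ≤ fromℕ 2 * N * N * Γ
      polynomial = ≤-by (fromℕ 2 + fromℕ 8 * a + fromℕ 2 * (a * a) + fromℕ 5 * b + fromℕ 8 * (a * b) + fromℕ 2 * (a * a * b))
        (0≤+ (0≤+ (0≤+ (0≤+ (0≤+ (0≤fromℕ 2) (0≤* (0≤fromℕ 8) 0≤a)) (0≤* (0≤fromℕ 2) (0≤* 0≤a 0≤a))) (0≤* (0≤fromℕ 5) 0≤b))
          (0≤* (0≤fromℕ 8) (0≤* 0≤a 0≤b))) (0≤* (0≤fromℕ 2) (0≤* (0≤* 0≤a 0≤a) 0≤b)))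
        (lemma N Γ)
        where
        lemma : ∀ n g → fromℕ 2 * n * n * g ≡ fromℕ 3 * (g - fromℕ 2 + fromℕ 2 * (n * n)) +
          (fromℕ 2 + fromℕ 8 * (n - fromℕ 2) + fromℕ 2 * ((n - fromℕ 2) * (n - fromℕ 2)) + fromℕ 5 * (g - fromℕ 4)
            + fromℕ 8 * ((n - fromℕ 2) * (g - fromℕ 4)) + fromℕ 2 * ((n - fromℕ 2) * (n - fromℕ 2) * (g - fromℕ 4)))
        lemma = solve-∀ ℚ-ring

  module _ {x : Fin n → ℚ} (0<xx : 0ℚ < x ∙ x) where

    private
      u : Fin n → Fin n → ℚ
      u = relativeGain x

      u₀ E : ℚ
      u₀ = apexRelativeGain x
      E  = ∑ λ i → ∑ λ j → u i (punchIn i j)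

      u-bounds : ∀ i j → i ≢ j → - η ≤ u i j × u i j ≤ η
      u-bounds i j i≢j = 0-1-scale-bounds (I-cases (f i) (f j)) (ℚ.<⇒≤ 0<η)
        (ℚ.≤-trans (ℚ.≤-reflexive (lemma η)) (*-monoˡ-≤ (ℚ.<⇒≤ 0<η) (-1≤pairGain {x} 0<xx i j i≢j)))
        (ℚ.≤-trans (*-monoˡ-≤ (ℚ.<⇒≤ 0<η) (pairGain≤1 {x} 0<xx i j i≢j)) (ℚ.≤-reflexive (ℚ.*-identityʳ η)))
        where
        lemma : ∀ h → - h ≡ h * - 1ℚ
        lemma = solve-∀ ℚ-ring

      -ε≤u : ∀ i j → i ≢ j → - ε ≤ u i j
      -ε≤u i j i≢j = ℚ.≤-trans (ℚ.neg-antimono-≤ η≤ε) (proj₁ (u-bounds i j i≢j))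

      u≤ε : ∀ i j → i ≢ j → u i j ≤ ε
      u≤ε i j i≢j = ℚ.≤-trans (proj₂ (u-bounds i j i≢j)) η≤ε

      -ε≤u₀ : - ε ≤ u₀
      -ε≤u₀ = proj₁ (∣ηapexGain∣≤ε {x} 0<xx)

      u₀≤ε : u₀ ≤ ε
      u₀≤ε = proj₂ (∣ηapexGain∣≤ε {x} 0<xx)

      E‖x‖² : E * x ∙ x ≡ η * (fromℕ 2 * monochromaticSum x)
      E‖x‖² = begin
        E * x ∙ x
          ≡⟨ *-distribʳ-∑ (x ∙ x) (λ i → ∑ λ j → u i (punchIn i j)) ⟩
        ∑ (λ i → ∑ (λ j → u i (punchIn i j)) * x ∙ x)
          ≡⟨ ∑-cong (λ i → trans (*-distribʳ-∑ (x ∙ x) (λ j → u i (punchIn i j)))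
               (∑-cong λ j → term i (punchIn i j))) ⟩
        ∑ (λ i → ∑ λ j → η * fromℕ 2 * (I (f i) (f (punchIn i j)) * (x i * x (punchIn i j))))
          ≡⟨ trans (*-distribˡ-∑ (η * fromℕ 2) (λ i → ∑ λ j → I (f i) (f (punchIn i j)) * (x i * x (punchIn i j))))
               (∑-cong λ i → *-distribˡ-∑ (η * fromℕ 2) (λ j → I (f i) (f (punchIn i j)) * (x i * x (punchIn i j)))) ⟨
        η * fromℕ 2 * monochromaticSum x
          ≡⟨ ℚ.*-assoc η (fromℕ 2) (monochromaticSum x) ⟩
        η * (fromℕ 2 * monochromaticSum x) ∎
        where
        open ≡-Reasoning
        lemma₁ : ∀ i h g x → i * (h * g) * x ≡ i * (h * (g * x))
        lemma₁ = solve-∀ ℚ-ring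
        lemma₂ : ∀ i h t x y → i * (h * (t * x * y)) ≡ h * t * (i * (x * y))
        lemma₂ = solve-∀ ℚ-ring
        term : ∀ i j → u i j * x ∙ x ≡ η * fromℕ 2 * (I (f i) (f j) * (x i * x j))
        term i j = trans (lemma₁ (I (f i) (f j)) η (pairGain x i j) (x ∙ x))
          (trans (cong (λ z → I (f i) (f j) * (η * z)) (/-*-cancel (fromℕ 2 * x i * x j) 0<xx))
            (lemma₂ (I (f i) (f j)) η (fromℕ 2) (x i) (x j)))

      -- The colouring makes the combined constraints infeasible.
      2η≤cE+2u₀ : fromℕ 2 * η ≤ c′ * E + fromℕ 2 * u₀
      2η≤cE+2u₀ = *-cancelʳ-≤ 0<xx (≤-by _
        (0≤* (0≤* (0≤fromℕ 2) (ℚ.<⇒≤ 0<η)) (≤⇒0≤- (∑²≤c*[‖x‖²+M] x)))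
        (begin
          (c′ * E + fromℕ 2 * (η * (fromℕ (suc c) - ∑² / (x ∙ x)))) * x ∙ x
            ≡⟨ lemma₁ c′ E (fromℕ 2) η (fromℕ (suc c)) (∑² / (x ∙ x)) (x ∙ x) ⟩
          c′ * (E * x ∙ x) + fromℕ 2 * (η * (fromℕ (suc c) * x ∙ x - ∑² / (x ∙ x) * x ∙ x))
            ≡⟨ cong₂ (λ a b → c′ * a + fromℕ 2 * (η * (fromℕ (suc c) * x ∙ x - b))) E‖x‖² (/-*-cancel ∑² 0<xx) ⟩
          c′ * (η * (fromℕ 2 * monochromaticSum x)) + fromℕ 2 * (η * (fromℕ (suc c) * x ∙ x - ∑²))
            ≡⟨ cong (λ k → c′ * (η * (fromℕ 2 * monochromaticSum x)) + fromℕ 2 * (η * (k * x ∙ x - ∑²))) (fromℕ-suc c) ⟩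
          c′ * (η * (fromℕ 2 * monochromaticSum x)) + fromℕ 2 * (η * ((1ℚ + c′) * x ∙ x - ∑²))
            ≡⟨ lemma₂ c′ η (fromℕ 2) (monochromaticSum x) (x ∙ x) ∑² ⟩
          fromℕ 2 * η * x ∙ x + fromℕ 2 * η * (c′ * (x ∙ x + monochromaticSum x) - ∑²) ∎))
        where
        open ≡-Reasoning
        ∑² : ℚ
        ∑² = ∑ x * ∑ x
        lemma₁ : ∀ c e t h k r x → (c * e + t * (h * (k - r))) * x ≡ c * (e * x) + t * (h * (k * x - r * x))
        lemma₁ = solve-∀ ℚ-ring
        lemma₂ : ∀ c h t m x s → c * (h * (t * m)) + t * (h * ((1ℚ + c) * x - s)) ≡
          t * h * x + t * h * (c * (x + m) - s)
        lemma₂ = solve-∀ ℚ-ring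

      -- With the extra factor 1 + v₀ there are C + 1 factors, and a sum of at most C + 1 is what
      -- the inequality of means needs. The balance is exact: 13 η / 8 from `v₀`, at most 3 η / 8
      -- from the second-order terms, and at most - 2 η from the first-order ones.
      constraintSum-bound : 1ℚ + v₀ + constraintSum (λ i j → approxInverse (u i j)) (approxInverse u₀)
        ≤ fromℕ (3 ℕ.+ n ℕ.* (n′ ℕ.* c))
      constraintSum-bound = begin
        1ℚ + v₀ + (approxInverse u₀ + (approxInverse u₀ + ∑ λ i → ∑ λ j → c′ * approxInverse (u i (punchIn i j))))
          ≤⟨ ℚ.+-monoʳ-≤ (1ℚ + v₀) (ℚ.+-mono-≤ inverse₀ (ℚ.+-mono-≤ inverse₀
               (∑-mono λ i → ∑-mono λ j → inverse i (punchIn i j) (Fin.punchInᵢ≢i i j ∘ sym)))) ⟩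
        1ℚ + v₀ + (b₀ + (b₀ + ∑ λ i → ∑ λ j → b + - c′ * u i (punchIn i j)))
          ≡⟨ cong (λ z → 1ℚ + v₀ + (b₀ + (b₀ + z))) double-sum ⟩
        1ℚ + v₀ + (b₀ + (b₀ + (N * (N′ * b) + - c′ * E)))
          ≡⟨ lemma₁ v₀ u₀ κ ε N N′ c′ η E ⟩
        fromℕ 3 + N * (N′ * c′) + (v₀ + κ * (c′ * N * N′ * (η * η) + fromℕ 2 * (ε * ε)) - (c′ * E + fromℕ 2 * u₀))
          ≤⟨ ℚ.+-monoʳ-≤ (fromℕ 3 + N * (N′ * c′)) (ℚ.+-mono-≤ (ℚ.+-monoʳ-≤ v₀ secondOrder) (ℚ.neg-antimono-≤ 2η≤cE+2u₀)) ⟩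
        fromℕ 3 + N * (N′ * c′) + (v₀ + fromℕ 3 * ⅛ * η - fromℕ 2 * η)
          ≡⟨ lemma₂ (fromℕ 3 + N * (N′ * c′)) η ⟩
        fromℕ 3 + N * (N′ * c′)
          ≡⟨ trans (fromℕ-+ 3 (n ℕ.* (n′ ℕ.* c))) (cong (λ z → fromℕ 3 + z) (trans (fromℕ-* n (n′ ℕ.* c)) (cong (N *_) (fromℕ-* n′ c)))) ⟨
        fromℕ (3 ℕ.+ n ℕ.* (n′ ℕ.* c)) ∎
        where
        open ℚ.≤-Reasoning
        b₀ b : ℚ
        b₀ = 1ℚ - u₀ + κ * (ε * ε)
        b  = c′ * (1ℚ + κ * (η * η))
        inverse₀ : approxInverse u₀ ≤ b₀
        inverse₀ = ℚ.+-monoʳ-≤ (1ℚ - u₀) (*-monoˡ-≤ 0≤κ (square-mono -ε≤u₀ u₀≤ε))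
        inverse : ∀ i j → i ≢ j → c′ * approxInverse (u i j) ≤ b + - c′ * u i j
        inverse i j i≢j = ℚ.≤-trans
          (*-monoˡ-≤ (0≤fromℕ c) (ℚ.+-monoʳ-≤ (1ℚ - u i j) (*-monoˡ-≤ 0≤κ
            (square-mono (proj₁ (u-bounds i j i≢j)) (proj₂ (u-bounds i j i≢j))))))
          (ℚ.≤-reflexive (lemma c′ (u i j) (κ * (η * η))))
          where
          lemma : ∀ c u k → c * (1ℚ - u + k) ≡ c * (1ℚ + k) + - c * u
          lemma = solve-∀ ℚ-ring
        affine-sum : ∀ m a (g : Fin m → ℚ) → ∑ (λ i → a + - c′ * g i) ≡ fromℕ m * a + - c′ * ∑ g
        affine-sum m a g = trans (∑-distrib-+ (λ _ → a) (λ i → - c′ * g i))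
          (cong₂ _+_ (∑-const m a) (sym (*-distribˡ-∑ (- c′) g)))
        double-sum : ∑ (λ i → ∑ λ j → b + - c′ * u i (punchIn i j)) ≡ N * (N′ * b) + - c′ * E
        double-sum = trans (∑-cong λ i → affine-sum n′ b (λ j → u i (punchIn i j)))
          (affine-sum n (N′ * b) (λ i → ∑ λ j → u i (punchIn i j)))
        lemma₁ : ∀ v u k e n m c h s →
          1ℚ + v + ((1ℚ - u + k * (e * e)) + ((1ℚ - u + k * (e * e)) + (n * (m * (c * (1ℚ + k * (h * h)))) + - c * s))) ≡
          fromℕ 3 + n * (m * c) + (v + k * (c * n * m * (h * h) + fromℕ 2 * (e * e)) - (c * s + fromℕ 2 * u))
        lemma₁ = solve-∀ ℚ-ring
        lemma₂ : ∀ a h → a + (fromℕ 13 * (½ * ½ * ½) * h + fromℕ 3 * (½ * ½ * ½) * h - fromℕ 2 * h) ≡ a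
        lemma₂ = solve-∀ ℚ-ring

    -- The inequality of means bounds products only from above, so it is applied to approximate
    -- inverses of the factors: (1 + v₀) times their product is at most 1, while their product with
    -- the factors themselves is at least 1.
    1+v₀≤gainProduct : 1ℚ + v₀ ≤ constraintProduct (λ i j → 1ℚ + u i j) (1ℚ + u₀)
    1+v₀≤gainProduct = begin
      1ℚ + v₀
        ≡⟨ ℚ.*-identityʳ (1ℚ + v₀) ⟨
      (1ℚ + v₀) * 1ℚ
        ≤⟨ *-monoˡ-≤ 0≤1+v₀ (1≤constraintProduct (λ i j i≢j → 1≤[1+u]*approxInverse (-ε≤u i j i≢j)) (1≤[1+u]*approxInverse -ε≤u₀)) ⟩
      (1ℚ + v₀) * constraintProduct (λ i j → (1ℚ + u i j) * approxInverse (u i j)) ((1ℚ + u₀) * approxInverse u₀)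
        ≡⟨ cong ((1ℚ + v₀) *_) (constraintProduct-* (λ i j → 1ℚ + u i j) (λ i j → approxInverse (u i j)) (1ℚ + u₀) (approxInverse u₀)) ⟩
      (1ℚ + v₀) * (R * A)
        ≡⟨ lemma (1ℚ + v₀) R A ⟩
      R * ((1ℚ + v₀) * A)
        ≤⟨ *-monoˡ-≤ 0≤R (sum≤count⇒product≤1 (step-* (step-one 0≤1+v₀)
             (constraintProduct-step (λ i j i≢j → 0≤approxInverse (u≤ε i j i≢j)) (0≤approxInverse u₀≤ε))) constraintSum-bound) ⟩
      R * 1ℚ
        ≡⟨ ℚ.*-identityʳ R ⟩
      R ∎
      where
      open ℚ.≤-Reasoning
      R A : ℚ
      R = constraintProduct (λ i j → 1ℚ + u i j) (1ℚ + u₀)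
      A = constraintProduct (λ i j → approxInverse (u i j)) (approxInverse u₀)
      0≤1+v₀ : 0ℚ ≤ 1ℚ + v₀
      0≤1+v₀ = 0≤+ 0≤1 0≤v₀
      0≤R : 0ℚ ≤ R
      0≤R = 0≤constraintProduct (λ i j i≢j → ℚ.<⇒≤ (-ε≤⇒0<1+ (-ε≤u i j i≢j))) (ℚ.<⇒≤ (-ε≤⇒0<1+ -ε≤u₀))
      lemma : ∀ a b c → a * (b * c) ≡ b * (a * c)
      lemma = solve-∀ ℚ-ring

    potential-growth : ∀ {w} → Positive G w → (1ℚ + v₀) * potential w ≤ potential (update w x)
    potential-growth {w} w-pos = begin
      (1ℚ + v₀) * potential w      ≤⟨ *-monoʳ-≤ (0≤potential w-pos) 1+v₀≤gainProduct ⟩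
      constraintProduct (λ i j → 1ℚ + u i j) (1ℚ + u₀) * potential w
                                   ≡⟨ ℚ.*-comm (constraintProduct (λ i j → 1ℚ + u i j) (1ℚ + u₀)) (potential w) ⟩
      potential w * constraintProduct (λ i j → 1ℚ + u i j) (1ℚ + u₀)
                                   ≡⟨ potential-update w x ⟨
      potential (update w x)       ∎
      where open ℚ.≤-Reasoning

-- Growth of the total weight in one step

module _ {n} (G : Graph n) (k : ℕ) (2≤k : 2 ℕ.≤ k) (k≤n : k ℕ.≤ n) where
  open Algorithm G k
  open Parameters G k 2≤k k≤n

  threshold*[k+1] : threshold * (fromℕ k + 1ℚ) ≡ 1ℚ / Γ
  threshold*[k+1] = /-unique 0<Γ (trans (cong (λ z → threshold * z * Γ) (sym (fromℕ-+ k 1)))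
    (trans (ℚ.*-assoc threshold (fromℕ (k ℕ.+ 1)) Γ) threshold-*))

  module _ {w : Weights n} (w-pos : Positive G w) {T̂ β x}
    (output : WalkCounting.Output (matrix (normalise w)) T̂ β x) where

    private
      p : Weights n
      p = normalise w

      p-dist : Distribution G p
      p-dist = normalise-distribution w-pos k

      Φ : ℚ
      Φ = totalWeight G w

      0<Φ : 0ℚ < Φ
      0<Φ = 0<totalWeight w-pos k

      0<xx : 0ℚ < x ∙ x
      0<xx = 0<‖x‖² (matrix-symmetric G k p) (matrix-psd p-dist k) T̂ output

      weightedGain : ℚ
      weightedGain = ∑ᴱ̄ G (λ i j → wᴱ̄ w i j * pairGain x i j) + w₀ w * apexGain x

      totalWeight-update : totalWeight G (update w x) ≡ Φ + η * weightedGain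
      totalWeight-update = trans (cong₂ _+_ pairs (update-w₀ w x)) (lemma₂ (∑ᴱ̄ G (wᴱ̄ w)) η D (w₀ w) (apexGain x))
        where
        D : ℚ
        D = ∑ᴱ̄ G (λ i j → wᴱ̄ w i j * pairGain x i j)
        lemma₁ : ∀ w h g → w * (1ℚ + h * g) ≡ w + h * (w * g)
        lemma₁ = solve-∀ ℚ-ring
        lemma₂ : ∀ e h d w g → e + h * d + w * (1ℚ + h * g) ≡ e + w + h * (d + w * g)
        lemma₂ = solve-∀ ℚ-ring
        pairs : ∑ᴱ̄ G (wᴱ̄ (update w x)) ≡ ∑ᴱ̄ G (wᴱ̄ w) + η * D
        pairs = trans (∑ᴱ̄-cong G λ i j _ → lemma₁ (wᴱ̄ w i j) η (pairGain x i j))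
          (trans (∑ᴱ̄-+ G (wᴱ̄ w) (λ i j → η * (wᴱ̄ w i j * pairGain x i j)))
            (cong (∑ᴱ̄ G (wᴱ̄ w) +_) (sym (*-distribˡ-∑ᴱ̄ G η (λ i j → wᴱ̄ w i j * pairGain x i j)))))

      -- Multiplied by ‖x‖², the average of the gains under `p` is (1 + p₀ k) ‖x‖² minus the
      -- quadratic form of the matrix at `x`, and the latter is β ‖x‖².
      weightedGain≡ : weightedGain ≡ Φ * (1ℚ + w₀ p * fromℕ k - β)
      weightedGain≡ = *-cancelʳ-≡ 0<xx (begin
        (∑ᴱ̄ G (λ i j → wᴱ̄ w i j * pairGain x i j) + w₀ w * (fromℕ k - r)) * x ∙ x
          ≡⟨ lemma₁ (∑ᴱ̄ G (λ i j → wᴱ̄ w i j * pairGain x i j)) (w₀ w) (fromℕ k) r (x ∙ x) ⟩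
        ∑ᴱ̄ G (λ i j → wᴱ̄ w i j * pairGain x i j) * x ∙ x + w₀ w * (fromℕ k * x ∙ x - r * x ∙ x)
          ≡⟨ cong₂ (λ a b → a + w₀ w * (fromℕ k * x ∙ x - b)) pairs (/-*-cancel ∑² 0<xx) ⟩
        Φ * D + w₀ w * (fromℕ k * x ∙ x - ∑²)
          ≡⟨ cong (λ a → Φ * D + a * (fromℕ k * x ∙ x - ∑²)) (/-*-cancel (w₀ w) 0<Φ) ⟨
        Φ * D + w₀ p * Φ * (fromℕ k * x ∙ x - ∑²)
          ≡⟨ lemma₂ Φ D (w₀ p) (fromℕ k) (x ∙ x) ∑² ⟩
        Φ * ((1ℚ + w₀ p * fromℕ k) * x ∙ x - (w₀ p * ∑² + x ∙ x - D))
          ≡⟨ cong (λ a → Φ * ((1ℚ + w₀ p * fromℕ k) * x ∙ x - a)) (trans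
               (β‖x‖²≡x∙A·x (matrix-symmetric G k p) (matrix-psd p-dist k) T̂ output) (quadraticForm G k p x)) ⟨
        Φ * ((1ℚ + w₀ p * fromℕ k) * x ∙ x - β * x ∙ x)
          ≡⟨ lemma₃ Φ (1ℚ + w₀ p * fromℕ k) β (x ∙ x) ⟩
        Φ * (1ℚ + w₀ p * fromℕ k - β) * x ∙ x ∎)
        where
        open ≡-Reasoning
        ∑² r D : ℚ
        ∑² = ∑ x * ∑ x
        r  = ∑² / (x ∙ x)
        D  = ∑ᴱ̄ G (λ i j → wᴱ̄ p i j * (fromℕ 2 * x i * x j))
        lemma₁ : ∀ d w k r x → (d + w * (k - r)) * x ≡ d * x + w * (k * x - r * x)
        lemma₁ = solve-∀ ℚ-ring
        lemma₂ : ∀ f d p k x s → f * d + p * f * (k * x - s) ≡ f * ((1ℚ + p * k) * x - (p * s + x - d))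
        lemma₂ = solve-∀ ℚ-ring
        lemma₃ : ∀ f a b x → f * (a * x - b * x) ≡ f * (a - b) * x
        lemma₃ = solve-∀ ℚ-ring
        lemma₄ : ∀ f p y → p * f * y ≡ f * (p * y)
        lemma₄ = solve-∀ ℚ-ring
        pairs : ∑ᴱ̄ G (λ i j → wᴱ̄ w i j * pairGain x i j) * x ∙ x ≡ Φ * D
        pairs = trans (*-distribʳ-∑ᴱ̄ G (x ∙ x) (λ i j → wᴱ̄ w i j * pairGain x i j))
          (trans (∑ᴱ̄-cong G λ i j _ → trans (ℚ.*-assoc (wᴱ̄ w i j) (pairGain x i j) (x ∙ x))
              (trans (cong₂ _*_ (sym (/-*-cancel (wᴱ̄ w i j) 0<Φ)) (/-*-cancel (fromℕ 2 * x i * x j) 0<xx))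
                (lemma₄ Φ (wᴱ̄ p i j) (fromℕ 2 * x i * x j))))
            (sym (*-distribˡ-∑ᴱ̄ G Φ (λ i j → wᴱ̄ p i j * (fromℕ 2 * x i * x j)))))

    -- The average gain 1 + p₀ k - β is at most `threshold` times p₀ k + 1 ≤ k + 1, hence at most 1
    -- / C; this explains the factor k + 1 in the bound on ε̂.
    totalWeight-growth : (1ℚ - threshold) * (w₀ p * fromℕ k + 1ℚ) ≤ β →
      totalWeight G (update w x) ≤ Φ * (1ℚ + η * (1ℚ / Γ))
    totalWeight-growth ≤β = begin
      totalWeight G (update w x)                        ≡⟨ totalWeight-update ⟩
      Φ + η * weightedGain                              ≡⟨ cong (λ z → Φ + η * z) weightedGain≡ ⟩
      Φ + η * (Φ * (1ℚ + w₀ p * fromℕ k - β))           ≤⟨ ℚ.+-monoʳ-≤ Φ (*-monoˡ-≤ (ℚ.<⇒≤ 0<η) (*-monoˡ-≤ (ℚ.<⇒≤ 0<Φ) excess)) ⟩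
      Φ + η * (Φ * (1ℚ / Γ))                            ≡⟨ lemma₁ Φ η (1ℚ / Γ) ⟩
      Φ * (1ℚ + η * (1ℚ / Γ))                           ∎
      where
      open ℚ.≤-Reasoning
      open Distribution p-dist
      lemma₁ : ∀ f h g → f + h * (f * g) ≡ f * (1ℚ + h * g)
      lemma₁ = solve-∀ ℚ-ring
      lemma₂ : ∀ p k e → 1ℚ + p * k - (1ℚ - e) * (p * k + 1ℚ) ≡ e * (p * k + 1ℚ)
      lemma₂ = solve-∀ ℚ-ring
      p₀≤1 : w₀ p ≤ 1ℚ
      p₀≤1 = ℚ.≤-trans (≤+ˡ (w₀ p) (0≤∑ᴱ̄ G 0≤pᴱ̄)) (ℚ.≤-reflexive total≡1)
      0≤threshold : 0ℚ ≤ threshold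
      0≤threshold = 0≤/ 0≤1 (0<fromℕ (ℕ.*-mono-≤ {1} {k ℕ.+ 1} {1} {C} (ℕ.m≤n+m 1 k) (ℕ.≤-trans (s≤s z≤n) 4≤C)))
      excess : 1ℚ + w₀ p * fromℕ k - β ≤ 1ℚ / Γ
      excess = begin
        1ℚ + w₀ p * fromℕ k - β                                          ≤⟨ ℚ.+-monoʳ-≤ (1ℚ + w₀ p * fromℕ k) (ℚ.neg-antimono-≤ ≤β) ⟩
        1ℚ + w₀ p * fromℕ k - (1ℚ - threshold) * (w₀ p * fromℕ k + 1ℚ)   ≡⟨ lemma₂ (w₀ p) (fromℕ k) threshold ⟩
        threshold * (w₀ p * fromℕ k + 1ℚ)                                ≤⟨ *-monoˡ-≤ 0≤threshold (ℚ.+-monoˡ-≤ 1ℚ (*-monoʳ-≤ (0≤fromℕ k) p₀≤1)) ⟩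
        threshold * (1ℚ * fromℕ k + 1ℚ)                                  ≡⟨ cong (λ z → threshold * (z + 1ℚ)) (ℚ.*-identityˡ (fromℕ k)) ⟩
        threshold * (fromℕ k + 1ℚ)                                       ≡⟨ threshold*[k+1] ⟩
        1ℚ / Γ                                                           ∎

    -- The failed test is a negation about cuts. It refutes the strict rational inequality, and the
    -- order of ℚ is decidable, so the reverse inequality follows.
    ¬belowThreshold⇒ : ∀ {ε̂} → IsDedekind ε̂ → ι 0ℚ <ᴿ ε̂ → ε̂ ≤ᴿ ι threshold →
      ¬ BelowThreshold ε̂ p β → (1ℚ - threshold) * (w₀ p * fromℕ k + 1ℚ) ≤ β
    ¬belowThreshold⇒ {ε̂} ε̂-real 0<ε̂ ε̂≤threshold ¬below = ℚ.≮⇒≥ λ β<l →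
      ¬below (⇒<ᴿ[1-ε̂]* ε̂-real 0<ε̂ {β} {w₀ p * fromℕ k + 1ℚ} {threshold} 0<β
        (ℚ.<-≤-trans 0<1 (≤+ˡ 1ℚ (0≤* (ℚ.<⇒≤ (Distribution.0<p₀ p-dist)) (0≤fromℕ k))))
        (λ d → ≤ᴿι⇒upper ε̂-real 0<ε̂ ε̂≤threshold) β<l)
      where
      0<β : 0ℚ < β
      0<β = 0<*⇒0< 0<xx (subst (0ℚ <_) (sym (β‖x‖²≡x∙A·x (matrix-symmetric G k p) (matrix-psd p-dist k) T̂ output))
        (ℚ.<-≤-trans (0<* (Distribution.0<p₀ p-dist) 0<xx) (p₀‖x‖²≤x∙A·x p-dist k x)))

1≤^⇒1≤ : ∀ {b m} → 1 ℕ.≤ m → 0ℚ ≤ b → 1ℚ ≤ b ^ m → 1ℚ ≤ b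
1≤^⇒1≤ {b} {suc m} _ 0≤b 1≤bᵐ = ^-cancelˡ-≤ 0≤b m (ℚ.≤-trans (ℚ.≤-reflexive (1^ (suc m))) 1≤bᵐ)

-- Comparison of the growth rates of total weight and potential

module _ {n} (G : Graph n) (k : ℕ) (2≤k : 2 ℕ.≤ k) (k≤n : k ℕ.≤ n) where
  open Algorithm G k
  open Parameters G k 2≤k k≤n

  private
    -- `g` is the rate of the total weight and `v` that of the potential. Multiplication by `z`
    -- turns 1 + g into at most 1 - h, and yet (1 + v) zᶜ remains at least 1.
    γ g h z v : ℚ
    γ = 1ℚ / Γ
    g = η * γ
    h = ½ * g
    z = 1ℚ - (h + g)
    v = fromℕ 13 * (½ * ½ * ½) * η

    γΓ≡1 : γ * Γ ≡ 1ℚ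
    γΓ≡1 = /-*-cancel 1ℚ 0<Γ

    0≤g : 0ℚ ≤ g
    0≤g = 0≤* (ℚ.<⇒≤ 0<η) (0≤/ 0≤1 0<Γ)

    0≤h : 0ℚ ≤ h
    0≤h = 0≤* (ℚ.nonNegative⁻¹ ½) 0≤g

    32η≤1 : fromℕ 32 * η ≤ 1ℚ
    32η≤1 = begin
      fromℕ 32 * η              ≡⟨ lemma η ⟩
      fromℕ 16 * (η * fromℕ 2)  ≤⟨ *-monoˡ-≤ (0≤fromℕ 16) (*-monoˡ-≤ (ℚ.<⇒≤ 0<η) 2≤N) ⟩
      fromℕ 16 * (η * N)        ≡⟨ cong (fromℕ 16 *_) ηN≡ε ⟩
      fromℕ 16 * ε              ≤⟨ 16ε≤1 ⟩
      1ℚ                        ∎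
      where
      open ℚ.≤-Reasoning
      lemma : ∀ h → fromℕ 32 * h ≡ fromℕ 16 * (h * fromℕ 2)
      lemma = solve-∀ ℚ-ring

    Γ[h+g]≡ : Γ * (h + g) ≡ fromℕ 3 * ½ * η
    Γ[h+g]≡ = trans (lemma Γ η γ) (trans (cong (fromℕ 3 * ½ * η *_) γΓ≡1) (ℚ.*-identityʳ (fromℕ 3 * ½ * η)))
      where
      lemma : ∀ c e d → c * (½ * (e * d) + e * d) ≡ fromℕ 3 * ½ * e * (d * c)
      lemma = solve-∀ ℚ-ring

    h+g≤1 : h + g ≤ 1ℚ
    h+g≤1 = begin
      h + g                   ≡⟨ ℚ.*-identityˡ (h + g) ⟨
      1ℚ * (h + g)            ≤⟨ *-monoʳ-≤ (0≤+ 0≤h 0≤g) (fromℕ-mono-≤ {1} {C} (ℕ.≤-trans (s≤s z≤n) 4≤C)) ⟩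
      Γ * (h + g)             ≡⟨ Γ[h+g]≡ ⟩
      fromℕ 3 * ½ * η         ≤⟨ *-monoʳ-≤ (ℚ.<⇒≤ 0<η) (≤-by {a = fromℕ 3 * ½} (fromℕ 61 * ½) (ℚ.nonNegative⁻¹ (fromℕ 61 * ½)) refl) ⟩
      fromℕ 32 * η            ≤⟨ 32η≤1 ⟩
      1ℚ                      ∎
      where open ℚ.≤-Reasoning

    0≤z : 0ℚ ≤ z
    0≤z = ≤⇒0≤- h+g≤1

    0≤v : 0ℚ ≤ v
    0≤v = 0≤* (ℚ.nonNegative⁻¹ (fromℕ 13 * (½ * ½ * ½))) (ℚ.<⇒≤ 0<η)

    -- Bernoulli bounds zᶜ below by 1 - 3 η / 2, and (1 + 13 η / 8) (1 - 3 η / 2) = 1 + (η / 8) (1 -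
    -- 39 η / 2), where 32 η ≤ 1.
    1≤[1+v]zᶜ : 1ℚ ≤ (1ℚ + v) * z ^ C
    1≤[1+v]zᶜ = begin
      1ℚ
        ≤⟨ ≤-by _ (0≤* (0≤* (ℚ.nonNegative⁻¹ (½ * ½ * ½)) (ℚ.<⇒≤ 0<η))
             (0≤+ (≤⇒0≤- 32η≤1) (0≤* (ℚ.nonNegative⁻¹ (fromℕ 25 * ½)) (ℚ.<⇒≤ 0<η)))) (lemma η) ⟩
      (1ℚ + v) * (1ℚ - fromℕ 3 * ½ * η)    ≡⟨ cong (λ y → (1ℚ + v) * (1ℚ - y)) Γ[h+g]≡ ⟨
      (1ℚ + v) * (1ℚ - Γ * (h + g))        ≤⟨ *-monoˡ-≤ (0≤+ 0≤1 0≤v) (bernoulli (0≤+ 0≤h 0≤g) h+g≤1 C) ⟩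
      (1ℚ + v) * z ^ C                     ∎
      where
      open ℚ.≤-Reasoning
      lemma : ∀ e → (1ℚ + fromℕ 13 * (½ * ½ * ½) * e) * (1ℚ - fromℕ 3 * ½ * e) ≡
        1ℚ + ½ * ½ * ½ * e * (1ℚ - fromℕ 32 * e + fromℕ 25 * ½ * e)
      lemma = solve-∀ ℚ-ring

    [1+g]z≤1-h : (1ℚ + g) * z ≤ 1ℚ - h
    [1+g]z≤1-h = ≤-by _ (0≤* 0≤g (0≤+ 0≤h 0≤g)) (lemma g h)
      where
      lemma : ∀ g h → 1ℚ - h ≡ (1ℚ + g) * (1ℚ - (h + g)) + g * (h + g)
      lemma = solve-∀ ℚ-ring

    h≤1 : h ≤ 1ℚ
    h≤1 = ℚ.≤-trans (≤+ h 0≤g) h+g≤1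

    -- The origin of the bound on T: it says exactly that T h exceeds ln L.
    h*4K≡1 : h * (fromℕ 4 * fromℕ (n ℕ.^ 2 ℕ.* C ℕ.^ 2)) ≡ 1ℚ
    h*4K≡1 = begin
      h * (fromℕ 4 * fromℕ (n ℕ.^ 2 ℕ.* C ℕ.^ 2))
        ≡⟨ cong (λ y → h * (fromℕ 4 * y)) (trans (fromℕ-* (n ℕ.^ 2) (C ℕ.^ 2)) (cong₂ _*_ (square n) (square C))) ⟩
      ½ * (η * γ) * (fromℕ 4 * (N * N * (Γ * Γ)))
        ≡⟨ lemma η γ N Γ ⟩
      η * N * (fromℕ 2 * N * Γ) * (γ * Γ)
        ≡⟨ cong₂ (λ a b → a * (fromℕ 2 * N * Γ) * b) ηN≡ε γΓ≡1 ⟩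
      ε * (fromℕ 2 * N * Γ) * 1ℚ
        ≡⟨ trans (ℚ.*-identityʳ (ε * (fromℕ 2 * N * Γ))) ε*2NΓ≡1 ⟩
      1ℚ ∎
      where
      open ≡-Reasoning
      square : ∀ m → fromℕ (m ℕ.^ 2) ≡ fromℕ m * fromℕ m
      square m = trans (cong (λ l → fromℕ (m ℕ.* l)) (ℕ.*-identityʳ m)) (fromℕ-* m m)
      lemma : ∀ e d n c → ½ * (e * d) * (fromℕ 4 * (n * n * (c * c))) ≡ e * n * (fromℕ 2 * n * c) * (d * c)
      lemma = solve-∀ ℚ-ring

  -- T exceeds ln L / h, so L (1 - h)ᵀ < 1; but the bounds on the potential yield the opposite.
  growth-contradiction : ∀ {L T} → 1ℚ ≤ L →
    ι (fromℕ 4) *ᴿ ln (ι L) *ᴿ ι (fromℕ (n ℕ.^ 2 ℕ.* C ℕ.^ 2)) <ᴿ ι (fromℕ T) →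
    ¬ ((1ℚ + v) ^ T ≤ (L * (1ℚ + g) ^ T) ^ C)
  growth-contradiction {L} {T} 1≤L T-bound growth =
    absurd (T-bound⇒ {L} {K} {fromℕ T} 1≤L (0≤fromℕ (n ℕ.^ 2 ℕ.* C ℕ.^ 2)) T-bound)
    where
    open ℚ.≤-Reasoning
    K : ℚ
    K = fromℕ (n ℕ.^ 2 ℕ.* C ℕ.^ 2)
    0≤L : 0ℚ ≤ L
    0≤L = ℚ.≤-trans 0≤1 1≤L
    0≤1+g : 0ℚ ≤ 1ℚ + g
    0≤1+g = 0≤+ 0≤1 0≤g
    1≤[L[1-h]ᵀ]ᶜ : 1ℚ ≤ (L * (1ℚ - h) ^ T) ^ C
    1≤[L[1-h]ᵀ]ᶜ = begin
      1ℚ                                           ≤⟨ 1≤^ 1≤[1+v]zᶜ T ⟩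
      ((1ℚ + v) * z ^ C) ^ T                       ≡⟨ ^-distrib-* (1ℚ + v) (z ^ C) T ⟩
      (1ℚ + v) ^ T * (z ^ C) ^ T                   ≤⟨ *-monoʳ-≤ (0≤^ (0≤^ 0≤z C) T) growth ⟩
      (L * (1ℚ + g) ^ T) ^ C * (z ^ C) ^ T         ≡⟨ cong ((L * (1ℚ + g) ^ T) ^ C *_) (trans (^-assocʳ z C T)
                                                        (trans (cong (z ^_) (ℕ.*-comm C T)) (sym (^-assocʳ z T C)))) ⟩
      (L * (1ℚ + g) ^ T) ^ C * (z ^ T) ^ C         ≡⟨ ^-distrib-* (L * (1ℚ + g) ^ T) (z ^ T) C ⟨
      (L * (1ℚ + g) ^ T * z ^ T) ^ C               ≡⟨ cong (_^ C) (trans (ℚ.*-assoc L ((1ℚ + g) ^ T) (z ^ T))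
                                                        (cong (L *_) (sym (^-distrib-* (1ℚ + g) z T)))) ⟩
      (L * ((1ℚ + g) * z) ^ T) ^ C                 ≤⟨ ^-monoˡ-≤ (0≤* 0≤L (0≤^ (0≤* 0≤1+g 0≤z) T))
                                                        (*-monoˡ-≤ 0≤L (^-monoˡ-≤ (0≤* 0≤1+g 0≤z) [1+g]z≤1-h T)) C ⟩
      (L * (1ℚ - h) ^ T) ^ C                       ∎
    1≤L[1-h]ᵀ : 1ℚ ≤ L * (1ℚ - h) ^ T
    1≤L[1-h]ᵀ = 1≤^⇒1≤ {m = C} (ℕ.≤-trans (s≤s z≤n) 4≤C) (0≤* 0≤L (0≤^ (≤⇒0≤- h≤1) T)) 1≤[L[1-h]ᵀ]ᶜ
    0<[1-h]ᵀ : 0ℚ < (1ℚ - h) ^ T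
    0<[1-h]ᵀ = 0<^ (<⇒0<- (ℚ.<-≤-trans (<-by {a = h} g (0<* 0<η (0</ 0<1 0<Γ)) refl) h+g≤1)) T
    absurd : ∃[ x ] (upper (ln (ι L)) x × fromℕ 4 * x * K < fromℕ T) → ⊥
    absurd (x , lnL<x , 4xK<T) = ℚ.<-irrefl refl (begin-strict
      1ℚ                                    ≤⟨ 1≤L[1-h]ᵀ ⟩
      L * (1ℚ - h) ^ T                      <⟨ *-monoʳ-< 0<[1-h]ᵀ (proj₂ exceeds m ℕ.≤-refl) ⟩
      expSum x m * (1ℚ - h) ^ T             ≤⟨ *-monoʳ-≤ (ℚ.<⇒≤ 0<[1-h]ᵀ) (expSum-mono (ℚ.<⇒≤ (ln-upper-positive 1≤L lnL<x)) x≤Th m) ⟩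
      expSum (fromℕ T * h) m * (1ℚ - h) ^ T ≤⟨ expSum-multiple 0≤h h≤1 T m ⟩
      1ℚ                                    ∎)
      where
      exceeds : ∃[ m ] (∀ l → m ℕ.≤ l → L < expSum x l)
      exceeds = <ᴿexp⇒<expSum {L} {x} lnL<x
      m : ℕ
      m = proj₁ exceeds
      lemma : ∀ x h k → x * (h * (fromℕ 4 * k)) ≡ fromℕ 4 * x * k * h
      lemma = solve-∀ ℚ-ring
      x≤Th : x ≤ fromℕ T * h
      x≤Th = begin
        x                       ≡⟨ trans (cong (x *_) h*4K≡1) (ℚ.*-identityʳ x) ⟨
        x * (h * (fromℕ 4 * K)) ≡⟨ lemma x h K ⟩
        fromℕ 4 * x * K * h     ≤⟨ *-monoʳ-≤ 0≤h (ℚ.<⇒≤ 4xK<T) ⟩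
        fromℕ T * h             ∎

-- The loop on instances without a clique

module _ {n′} (G : Graph (suc n′)) (c : ℕ) (2≤k : 2 ℕ.≤ suc c) (k≤n : suc c ℕ.≤ suc n′)
  (f : Fin (suc n′) → Fin c) (f-proper : ∀ {u v} → Graph._~_ G u v → f u ≢ f v)
  (ε̂ : Cut) (T T̂ : ℕ) (admissible : Algorithm.Admissible G (suc c) ε̂ T T̂) where
  open Algorithm G (suc c)
  open Admissible admissible
  open Parameters G (suc c) 2≤k k≤n
  open Constraints G c 2≤k k≤n f f-proper
  open NoInstance G c 2≤k k≤n f f-proper

  private
    L g v : ℚ
    L = #nonedges G + 1ℚ
    g = η * (1ℚ / Γ)
    v = fromℕ 13 * (½ * ½ * ½) * η

    1≤L : 1ℚ ≤ L
    1≤L = ≤+ˡ 1ℚ (0≤∑ᴱ̄ G λ _ _ _ → 0≤1)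

    0≤g : 0ℚ ≤ g
    0≤g = 0≤* (ℚ.<⇒≤ 0<η) (0≤/ 0≤1 0<Γ)

    0≤1+g : 0ℚ ≤ 1ℚ + g
    0≤1+g = 0≤+ 0≤1 0≤g

    0≤1+v : 0ℚ ≤ 1ℚ + v
    0≤1+v = 0≤+ 0≤1 (0≤* (ℚ.nonNegative⁻¹ (fromℕ 13 * (½ * ½ * ½))) (ℚ.<⇒≤ 0<η))

  record Invariant (t : ℕ) (w : Weights (suc n′)) : Set where
    field
      w-pos       : Positive G w
      totalWeight≤ : totalWeight G w ≤ L * (1ℚ + g) ^ t
      ≤potential  : (1ℚ + v) ^ t ≤ potential w

  initial-invariant : Invariant 0 initial
  initial-invariant = record
    { w-pos        = initial-positive
    ; totalWeight≤ = ℚ.≤-reflexive (sym (ℚ.*-identityʳ L))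
    ; ≤potential   = 1≤constraintProduct (λ i j _ → 1≤pairWeight (f i Fin.≟ f j) (i Fin.<? j)) ℚ.≤-refl
    }
    where
    1≤pairWeight : ∀ {P Q : Set} (P? : Dec P) (Q? : Dec Q) →
      1ℚ ≤ (if does P? then (if does Q? then 1ℚ else 1ℚ) else 1ℚ)
    1≤pairWeight (no _)  _       = ℚ.≤-refl
    1≤pairWeight (yes _) (yes _) = ℚ.≤-refl
    1≤pairWeight (yes _) (no _)  = ℚ.≤-refl

  -- At t = T the bound on the total weight is at least 1 and so dominates every factor of the
  -- potential, including the padding; the two rates then collide. Hence the loop cannot run out of
  -- iterations, which would be the only way to answer YES.
  ¬final-invariant : ∀ {w} → ¬ Invariant T w
  ¬final-invariant {w} inv = growth-contradiction G (suc c) 2≤k k≤n {T = T} 1≤L T-bound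
    (ℚ.≤-trans ≤potential (potential≤^C w-pos
      (*-mono-≤ 0≤1 (0≤^ 0≤1+g T) 1≤L (1≤^ (≤+ 1ℚ 0≤g) T)) totalWeight≤))
    where open Invariant inv

  loop-no : ∀ t r w → t ℕ.+ r ≡ T → Invariant t w → Loop ε̂ T̂ NO r w
  loop-no t zero w t+0≡T inv = contradiction
    (subst (λ s → Invariant s w) (trans (sym (ℕ.+-identityʳ t)) t+0≡T) inv) ¬final-invariant
  loop-no t (suc r) w t+r≡T inv =
    output-exists A-sym A-psd T̂ (0<traceMoment p-dist (suc c) 1≤n (T̂ ℕ.+ T̂)) ,
    λ β x output → (λ _ → refl) , λ ¬below →
      loop-no (suc t) r (update w x) (trans (sym (ℕ.+-suc t r)) t+r≡T) (step output ¬below)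
    where
    open Invariant inv
    p-dist : Distribution G (normalise w)
    p-dist = normalise-distribution w-pos (suc c)
    A-sym : Symmetric (matrix (normalise w))
    A-sym = matrix-symmetric G (suc c) (normalise w)
    A-psd : PositiveSemidefinite (matrix (normalise w))
    A-psd = matrix-psd p-dist (suc c)
    lemma : ∀ l a b → l * a * b ≡ l * (b * a)
    lemma = solve-∀ ℚ-ring
    step : ∀ {β x} → WalkCounting.Output (matrix (normalise w)) T̂ β x →
      ¬ BelowThreshold ε̂ (normalise w) β → Invariant (suc t) (update w x)
    step {β} {x} output ¬below = record
      { w-pos        = update-positive {x = x} 0<xx w-pos
      ; totalWeight≤ = ℚ.≤-trans
          (totalWeight-growth G (suc c) 2≤k k≤n w-pos {T̂} output
            (¬belowThreshold⇒ G (suc c) 2≤k k≤n w-pos {T̂} output ε̂-real ε̂-positive ε̂-bound ¬below))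
          (ℚ.≤-trans (*-monoʳ-≤ 0≤1+g totalWeight≤) (ℚ.≤-reflexive (lemma L ((1ℚ + g) ^ t) (1ℚ + g))))
      ; ≤potential   = ℚ.≤-trans (*-monoˡ-≤ 0≤1+v ≤potential) (potential-growth {x} 0<xx w-pos)
      }
      where
      0<xx : 0ℚ < x ∙ x
      0<xx = 0<‖x‖² A-sym A-psd T̂ output

-- Colourings of perfect graphs and the conclusion

shrink : ∀ {n} (K : Subset n) {m} → m ℕ.≤ ∣ K ∣ → ∃[ K′ ] (K′ ⊆ K × ∣ K′ ∣ ≡ m)
shrink []          z≤n = [] , (λ ()) , refl
shrink (false ∷ K) m≤∣K∣ =
  let K′ , K′⊆K , ∣K′∣≡m = shrink K m≤∣K∣
  in false ∷ K′ , s⊆s K′⊆K , ∣K′∣≡m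
shrink {suc n} (true ∷ K) {zero} _ = ⊥ₛ , (λ i∈⊥ → contradiction i∈⊥ ∉⊥) , ∣⊥∣≡0 (suc n)
shrink (true ∷ K) {suc m} (s≤s m≤∣K∣) =
  let K′ , K′⊆K , ∣K′∣≡m = shrink K m≤∣K∣
  in true ∷ K′ , s⊆s K′⊆K , cong suc ∣K′∣≡m

-- Along the identity injection the induced subgraph has the adjacency of `G`. If its chromatic
-- number exceeds c, so does its clique number; `shrink` then cuts a largest clique down to exactly
-- c + 1 vertices, as `HasClique` demands the exact size.
perfect⇒colourable : ∀ {n} (G : Graph n) → Perfect G → ∀ c → ¬ HasClique G (suc c) → Colourable G c
perfect⇒colourable {n} G perfect c no-clique
  with χ , ((f , f-proper) , _) , (K , K-clique , ∣K∣≡χ) , _ ← perfect (↣-id (Fin n))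
  with χ ℕ.≤? c
... | yes χ≤c = (λ v → Fin.inject≤ (f v) χ≤c) ,
  λ {u} {v} u~v eq → f-proper {u} {v} u~v (Fin.inject≤-injective χ≤c χ≤c _ _ eq)
... | no χ≰c =
  let K′ , K′⊆K , ∣K′∣≡k = shrink K (ℕ.≤-trans (ℕ.≰⇒> χ≰c) (ℕ.≤-reflexive (sym ∣K∣≡χ)))
  in contradiction (K′ , (λ {u} {v} u∈K′ v∈K′ → K-clique {u} {v} (K′⊆K u∈K′) (K′⊆K v∈K′)) , ∣K′∣≡k) no-clique

theorem12 : ∀ (n : ℕ) (G : Graph n) → Perfect G →
    ∀ (k : ℕ) → 2 ℕ.≤ k → k ℕ.≤ n →
    ∀ (ε̂ : Cut) (T T̂ : ℕ) → Algorithm.Admissible G k ε̂ T T̂ →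
    (HasClique G k → Algorithm.Returns G k ε̂ T T̂ YES) ×
    (¬ HasClique G k → Algorithm.Returns G k ε̂ T T̂ NO)
-- The bounds 2 ≤ k ≤ n exclude zero for both, and with k = suc c the truncated difference k ∸ 1
-- computes to the number c of colours.
theorem12 (suc n′) G perfect (suc c) 2≤k k≤n ε̂ T T̂ admissible =
  (λ (K , K-clique , ∣K∣≡k) →
    let open YesInstance G (suc c) 2≤k k≤n ε̂ T T̂ admissible K K-clique ∣K∣≡k
    in loop-yes T initial initial-positive) ,
  (λ no-clique →
    let f , f-proper = perfect⇒colourable G perfect c no-clique
    in loop-no G c 2≤k k≤n f f-proper ε̂ T T̂ admissible 0 T initial refl
         (initial-invariant G c 2≤k k≤n f f-proper ε̂ T T̂ admissible))
  where
  open Algorithm G (suc c)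
  open Parameters G (suc c) 2≤k k≤n
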